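{- Let $M$ be an ordered matroid on $E$ with maximum base $T$ (the maximum element of $L(M)$), and let $r^*=\mathrm{rk}(M^*|T)$. Then $$\tilde H_i(\Delta(M))\cong\begin{cases}\mathbb Z^{\tilde\mu(M.T)} & \text{if } i=r^*-1,\\ 0 & \text{otherwise.}\end{cases}$$
   Context: An ordered matroid is a matroid on a finite set $E$ together with a linear order on $E$. For $F\subseteq E$, $e\in E$ is active with respect to $F$ if there is a circuit $C\subseteq F\cup\{e\}$ with $e\in C$ and $e$ the minimum of $C$; $\mathrm{Act}_M(F)$ is the set of such $e$ (possibly $e\in F$), and $\mathrm{Ext}_M(F)=\mathrm{Act}_M(F)\setminus F$. The external order on bases: $A\le B$ iff $A\subseteq B\cup\mathrm{Ext}_M(B)$; $L(M)$ is the set of bases with this order and a new minimum $\hat0$ adjoined (a lattice), with maximum element $T=E\setminus\mathrm{Act}_M(E)$. $\Delta(M)$ is the order complex of $L(M)$ (simplicial complex on $L(M)\setminus\{\hat0,T\}$ whose faces are nonempty chains); $\tilde H_i$ is reduced homology with $\mathbb Z$ coefficients. $M^*$ is the dual matroid and $M^*|T$ its restriction to $T$. $M.T$ is the contraction of $M$ to $T$ (i.e. $M/(E\setminus T)$), so $(M^*|T)^*=M.T$. For a matroid $N$ with lattice of flats $L_F(N)$, the reduced Möbius function is $\tilde\mu(N)=|\mu(L_F(N))|$ (Möbius function from bottom to top of $L_F(N)$) if $N$ is loopless, and $\tilde\mu(N)=0$ otherwise. -}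

module Defs where

open import Data.Nat as ℕ using (ℕ; zero; suc; _⊔_; _<_)
open import Data.Integer as ℤ using (ℤ; +_; -[1+_])
open import Data.Bool using (Bool; true; false; _∧_; _∨_; not; if_then_else_)
open import Data.Fin using (Fin; toℕ)
open import Data.Fin.Subset using (Subset; ⊥; ⊤; ⁅_⁆; _∪_; _─_; ∣_∣)
open import Data.Vec using (Vec; []; _∷_; lookup; tabulate; removeAt; replicate; zipWith)
open import Data.List using (List; []; _∷_; [_]; concatMap; map; foldr; allFin; _++_)
open import Data.Bool.ListAction using (all; any)
open import Data.Product using (Σ; _×_; _,_; proj₂)
open import Relation.Binary.PropositionalEquality using (_≡_)

-- Finite sets: the ground set E is Fin n with its natural linear order;
-- subsets of E are Data.Fin.Subset (Vec Bool n).  All notions below are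
-- boolean (decidable) since everything is finite.

private variable n : ℕ

allᶠ : (Fin n → Bool) → Bool
allᶠ {n} p = all p (allFin n)

subsets : (n : ℕ) → List (Subset n)
subsets zero    = [ [] ]
subsets (suc n) = concatMap (λ s → (true ∷ s) ∷ (false ∷ s) ∷ []) (subsets n)

infix 4 _⊆ᵇ_
_⊆ᵇ_ : Subset n → Subset n → Bool
A ⊆ᵇ B = allᶠ (λ e → not (lookup A e) ∨ lookup B e)

eqᵇ : Subset n → Subset n → Bool
eqᵇ A B = (A ⊆ᵇ B) ∧ (B ⊆ᵇ A)

filterᵇ : {A : Set} → (A → Bool) → List A → List A
filterᵇ p []       = []
filterᵇ p (x ∷ xs) = if p x then x ∷ filterᵇ p xs else filterᵇ p xs

sumℤ : List ℤ → ℤ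
sumℤ = foldr ℤ._+_ (+ 0)

record IndepSystem (n : ℕ) : Set where
  field
    ground : Subset n
    indep  : Subset n → Bool
open IndepSystem public

record IsMatroid (N : IndepSystem n) : Set where
  field
    indep-ground : ∀ I → indep N I ≡ true → (I ⊆ᵇ ground N) ≡ true
    indep-empty  : indep N ⊥ ≡ true
    indep-down   : ∀ I J → (J ⊆ᵇ I) ≡ true → indep N I ≡ true → indep N J ≡ true
    indep-aug    : ∀ I J → indep N I ≡ true → indep N J ≡ true → ∣ I ∣ < ∣ J ∣ →
                   Σ (Fin n) λ e → lookup J e ≡ true × lookup I e ≡ false
                                   × indep N (I ∪ ⁅ e ⁆) ≡ true

rank : IndepSystem n → Subset n → ℕ
rank {n} N X = foldr (λ I r → if (I ⊆ᵇ X) ∧ indep N I then ∣ I ∣ ⊔ r else r) 0 (subsets n)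

dual : IndepSystem n → IndepSystem n
dual N = record
  { ground = ground N
  ; indep  = λ I → (I ⊆ᵇ ground N) ∧ (rank N (ground N ─ I) ℕ.≡ᵇ rank N (ground N)) }

restrict : IndepSystem n → Subset n → IndepSystem n
restrict N T = record { ground = T ; indep = λ I → indep N I ∧ (I ⊆ᵇ T) }

contract : IndepSystem n → Subset n → IndepSystem n
contract N X = record
  { ground = ground N ─ X
  ; indep  = λ I → (I ⊆ᵇ (ground N ─ X)) ∧ (rank N (I ∪ X) ℕ.≡ᵇ (∣ I ∣ ℕ.+ rank N X)) }

contractTo : IndepSystem n → Subset n → IndepSystem n
contractTo N T = contract N (ground N ─ T)

closure : IndepSystem n → Subset n → Subset n
closure N X = tabulate (λ e → lookup (ground N) e ∧ (rank N (X ∪ ⁅ e ⁆) ℕ.≡ᵇ rank N X))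

isFlat : IndepSystem n → Subset n → Bool
isFlat N F = (F ⊆ᵇ ground N) ∧ eqᵇ (closure N F) F

botFlat : IndepSystem n → Subset n
botFlat N = closure N ⊥

-- μ(0̂, y) in L_F(N), by the defining recursion
--   μ(0̂,0̂) = 1,  μ(0̂,y) = - Σ_{0̂ ≤ z < y} μ(0̂,z);
-- the first argument is fuel (strict chains of flats have length ≤ n+1)
mobius : IndepSystem n → ℕ → Subset n → ℤ
mobius     N zero    y = + 0
mobius {n} N (suc f) y =
  if eqᵇ y (botFlat N) then + 1
  else ℤ.- sumℤ (map (mobius N f)
         (filterᵇ (λ z → isFlat N z ∧ (botFlat N ⊆ᵇ z) ∧ (z ⊆ᵇ y) ∧ not (eqᵇ z y))
                  (subsets n)))

loopless : IndepSystem n → Bool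
loopless N = allᶠ (λ e → not (lookup (ground N) e) ∨ indep N ⁅ e ⁆)

-- reduced Möbius invariant μ̃(N) = |μ(L_F(N))| if loopless, else 0
-- (top of L_F(N) is the ground set)
muTilde : IndepSystem n → ℕ
muTilde {n} N = if loopless N then ℤ.∣ mobius N (suc n) (ground N) ∣ else 0

isCircuit : IndepSystem n → Subset n → Bool
isCircuit {n} N C = (C ⊆ᵇ ground N) ∧ not (indep N C)
  ∧ all (λ D → not ((D ⊆ᵇ C) ∧ not (eqᵇ D C)) ∨ indep N D) (subsets n)

isActive : IndepSystem n → Subset n → Fin n → Bool
isActive {n} N F e = any (λ C → isCircuit N C ∧ (C ⊆ᵇ (F ∪ ⁅ e ⁆)) ∧ lookup C e
                        ∧ allᶠ (λ c → not (lookup C c) ∨ (toℕ e ℕ.≤ᵇ toℕ c)))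
                     (subsets n)

Act : IndepSystem n → Subset n → Subset n
Act N F = tabulate (isActive N F)

Ext : IndepSystem n → Subset n → Subset n
Ext N F = Act N F ─ F

isBasis : IndepSystem n → Subset n → Bool
isBasis N B = indep N B
  ∧ allᶠ (λ e → not (lookup (ground N) e ∧ not (lookup B e)) ∨ not (indep N (B ∪ ⁅ e ⁆)))

-- T = E ∖ Act(E), the maximum of L(M)
topBasis : IndepSystem n → Subset n
topBasis N = ground N ─ Act N (ground N)

extLeq : IndepSystem n → Subset n → Subset n → Bool
extLeq N A B = A ⊆ᵇ (B ∪ Ext N B)

extLt : IndepSystem n → Subset n → Subset n → Bool
extLt N A B = extLeq N A B ∧ not (eqᵇ A B)

-- The order complex Δ(M) of L(M) ∖ {0̂, T}: vertices are bases ≠ T;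
-- a (j-1)-simplex is a chain B₀ < … < B_{j-1}, written in increasing order
-- (this gives its orientation).  j = 0 is the empty simplex (reduced).

isVertex : IndepSystem n → Subset n → Bool
isVertex N B = isBasis N B ∧ not (eqᵇ B (topBasis N))

validSimplex : {j : ℕ} → IndepSystem n → Vec (Subset n) j → Bool
validSimplex N σ = allᶠ (λ a → isVertex N (lookup σ a))
  ∧ allᶠ (λ a → allᶠ (λ b → not (toℕ a ℕ.<ᵇ toℕ b) ∨ extLt N (lookup σ a) (lookup σ b)))

Chain : ℕ → ℕ → Set
Chain n j = List (ℤ × Vec (Subset n) j)

validChain : {j : ℕ} → IndepSystem n → Chain n j → Bool
validChain N c = all (λ p → validSimplex N (proj₂ p)) c

vecEqᵇ : {j : ℕ} → Vec (Subset n) j → Vec (Subset n) j → Bool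
vecEqᵇ σ τ = allᶠ (λ a → eqᵇ (lookup σ a) (lookup τ a))

coeff : {j : ℕ} → Chain n j → Vec (Subset n) j → ℤ
coeff c σ = sumℤ (map (λ p → if vecEqᵇ (proj₂ p) σ then Data.Product.proj₁ p else + 0) c)

_≈ᶜ_ : {j : ℕ} → Chain n j → Chain n j → Set
c ≈ᶜ d = ∀ σ → coeff c σ ≡ coeff d σ

signℤ : ℕ → ℤ
signℤ zero    = + 1
signℤ (suc k) = ℤ.- signℤ k

-- simplicial boundary (from j = 1 to j = 0 it is the augmentation)
∂ : {j : ℕ} → Chain n (suc j) → Chain n j
∂ {j = j} c = concatMap (λ p → map (λ k → (signℤ (toℕ k) ℤ.* Data.Product.proj₁ p , removeAt (proj₂ p) k))
                                     (allFin (suc j))) c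

IsCycle : IndepSystem n → (j : ℕ) → Chain n j → Set
IsCycle N zero    c = validChain N c ≡ true
IsCycle N (suc j) c = validChain N c ≡ true × ∂ c ≈ᶜ []

IsBoundary : IndepSystem n → (j : ℕ) → Chain n j → Set
IsBoundary {n} N j c = Σ (Chain n (suc j)) λ d → validChain N d ≡ true × ∂ d ≈ᶜ c

-- H̃_{j-1}(Δ(M)) ≅ ℤ^k : there is a surjective homomorphism from the cycle
-- group onto ℤ^k whose kernel is exactly the boundary group.
HomologyIso : IndepSystem n → (j k : ℕ) → Set
HomologyIso {n} N j k = Σ (Chain n j → Vec ℤ k) λ φ →
    (∀ c d → IsCycle N j c → IsCycle N j d → c ≈ᶜ d → φ c ≡ φ d)
  × (∀ c d → IsCycle N j c → IsCycle N j d → φ (c ++ d) ≡ zipWith ℤ._+_ (φ c) (φ d))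
  × (∀ v → Σ (Chain n j) λ c → IsCycle N j c × φ c ≡ v)
  × (∀ c → IsCycle N j c → φ c ≡ replicate k (+ 0) → IsBoundary N j c)
  × (∀ c → IsCycle N j c → IsBoundary N j c → φ c ≡ replicate k (+ 0))

-- H̃_i(Δ(M)) ≅ ℤ^k for i ∈ ℤ (degrees i ≤ -2 have zero chain groups)
ReducedHomologyIso : IndepSystem n → ℤ → ℕ → Set
ReducedHomologyIso N (+ m)           k = HomologyIso N (suc m) k
ReducedHomologyIso N -[1+ zero ]     k = HomologyIso N zero k
ReducedHomologyIso N -[1+ suc m ]    k = k ≡ 0

{-# OPTIONS --safe #-}
module Submission where

-- Write r* for the rank of M*|T.  Sending a base B to the face T ∖ B of the
-- independence complex IN of M*|T reverses the external order, and the bases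
-- avoiding a nonempty face J have a maximum, the colexicographically largest
-- one.  Let X be the complex of all σ ∪ I, where σ is a chain of bases ≠ T and
-- I ∈ IN is disjoint from every member of σ.  Deleting the bases from X in
-- decreasing order removes vertices whose links are cones (over an element of
-- T ∖ B), so X and IN have the same homology.  Deleting the elements of T
-- removes vertices whose links are acyclic, by induction down to a cone over
-- the maximum of the bases avoiding J, so X and Δ(M) have the same homology.
--
-- Deletion and link of the vertices of IN show that its homology is free and
-- concentrated in degree r* - 1, of rank |χ(IN)|.  In terms of complements in
-- T, χ(IN) is up to sign the sum of (-1)^|A| over the spanning sets A of M.T,
-- which is the Möbius invariant if M.T is loopless, and which vanishes, by
-- toggling a loop, otherwise.

open import Defs
open import Data.Nat as ℕ using (ℕ; zero; suc; _≤_; _<_; z≤n; s≤s)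
import Data.Nat.Properties as ℕ
open import Data.Integer as ℤ using (ℤ; +_; -[1+_]; -_; _-_; _+_; _*_; 0ℤ; 1ℤ; -1ℤ)
import Data.Integer.Properties as ℤ
open import Data.Integer.Tactic.RingSolver using (solve-∀)
open import Data.Bool using (Bool; true; false; _∧_; _∨_; _xor_; not; if_then_else_)
import Data.Bool
import Data.Bool.Properties
open import Data.Fin using (Fin; zero; suc)
open import Data.Fin.Subset using (Subset; ∣_∣; ⊤)
open import Data.Vec using (Vec; []; _∷_; lookup; replicate; _[_]≔_) renaming (_++_ to _++ᵛ_)
import Data.Vec as Vec
import Data.Vec.Properties as Vec
open import Data.Vec.Relation.Unary.All as All using (All; []; _∷_)
import Data.Vec.Relation.Unary.All.Properties as All
open import Data.Product using (Σ; ∃; _×_; _,_; proj₁; proj₂)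
open import Data.Sum using (_⊎_; inj₁; inj₂)
open import Data.Empty using (⊥; ⊥-elim)
open import Function using (_∘_; id; case_of_)
open import Relation.Nullary using (¬_; Dec; yes; no; _×-dec_; _→-dec_)
open import Relation.Nullary.Decidable using (decidable-stable)
open import Relation.Binary.PropositionalEquality
  using (_≡_; _≢_; _≗_; refl; sym; trans; cong; cong₂; subst; subst₂; module ≡-Reasoning)
open import Data.Bool.ListAction using (all; any)
open import Data.List using (List; []; _∷_; map; foldr; allFin; concatMap; _++_)
open import Data.List.Membership.Propositional using (_∈_)
open import Data.List.Membership.Propositional.Properties using (∈-allFin)
open import Data.List.Relation.Unary.Any using (here; there)
import Data.Fin.Subset as Sub
import Data.Fin.Subset.Properties as Subset
import Data.Sum
import Data.Fin as Fin
import Data.Fin.Properties as Fin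
open import Relation.Binary.Definitions using (tri<; tri≈; tri>)
open import Data.List.Properties using (map-tabulate)

-- What has to be controlled is the link of each vertex thrown out. Linking with an element `e` of T
-- obliges the remaining bases to avoid `e`; the set `J` records such elements, and `cospan` is
-- asked of `J ∪ I`, so that the family is closed under links. Bases leave from the top because then
-- the link of `B` retains only bases below `B`; no element of T is ever active, so these meet T
-- inside `B`, and whatever `B` misses in T can be added to every face. The colexicographic order is
-- a linear extension of the external order: it provides the order of removal and an order on
-- vertices for which increasing chains of bases carry no sign. Topology is replaced by algebra:
-- chains are integer functions on the subsets of one fixed simplex, elements of an exterior
-- algebra, and removing a vertex becomes a statement on fillings relative to a subcomplex. Since
-- homology has to be exhibited as ℤ^k by a map, the induction for the independence complex carries
-- an explicit basis of the top cycles; the Euler characteristic only identifies its length.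

private variable
  m n : ℕ

-- Chains on the full simplex with vertex set Fin m

Ch : ℕ → Set
Ch m = Subset m → ℤ

infix 4 _∌_
infixl 6 _+[_]_

_∌_ : Subset m → Fin m → Set
s ∌ v = lookup s v ≡ false

_+[_]_ : Ch m → ℤ → Ch m → Ch m
(c +[ a ] d) s = c s + a * d s

-- The coefficient at `s` sums `c (s ∪ v)` over the vertices `v` outside `s`, with a sign for each
-- element of `s` below `v`: that is what passing `true` costs. The empty set counts as a face, so
-- the homology is reduced.
bd : Ch m → Ch m
bd {zero}  c []          = 0ℤ
bd {suc m} c (false ∷ s) = bd (c ∘ (false ∷_)) s + c (true ∷ s)
bd {suc m} c (true ∷ s)  = - bd (c ∘ (true ∷_)) s

-- Left multiplication by the vertex v in the exterior algebra ...
cone : Fin m → Ch m → Ch m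
cone zero    c (false ∷ s) = 0ℤ
cone zero    c (true ∷ s)  = c (false ∷ s)
cone (suc v) c (false ∷ s) = cone v (c ∘ (false ∷_)) s
cone (suc v) c (true ∷ s)  = - cone v (c ∘ (true ∷_)) s

-- ... and contraction by v.
link : Fin m → Ch m → Ch m
link zero    c (false ∷ s) = c (true ∷ s)
link zero    c (true ∷ s)  = 0ℤ
link (suc v) c (false ∷ s) = link v (c ∘ (false ∷_)) s
link (suc v) c (true ∷ s)  = - link v (c ∘ (true ∷_)) s

bd-cong : {c d : Ch m} → c ≗ d → bd c ≗ bd d
bd-cong {zero}  eq []          = refl
bd-cong {suc m} eq (false ∷ s) = cong₂ _+_ (bd-cong (λ t → eq (false ∷ t)) s) (eq (true ∷ s))
bd-cong {suc m} eq (true ∷ s)  = cong -_ (bd-cong (λ t → eq (true ∷ t)) s)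

cone-cong : ∀ v {c d : Ch m} → c ≗ d → cone v c ≗ cone v d
cone-cong zero    eq (false ∷ s) = refl
cone-cong zero    eq (true ∷ s)  = eq (false ∷ s)
cone-cong (suc v) eq (false ∷ s) = cone-cong v (λ t → eq (false ∷ t)) s
cone-cong (suc v) eq (true ∷ s)  = cong -_ (cone-cong v (λ t → eq (true ∷ t)) s)

link-cong : ∀ v {c d : Ch m} → c ≗ d → link v c ≗ link v d
link-cong zero    eq (false ∷ s) = eq (true ∷ s)
link-cong zero    eq (true ∷ s)  = refl
link-cong (suc v) eq (false ∷ s) = link-cong v (λ t → eq (false ∷ t)) s
link-cong (suc v) eq (true ∷ s)  = cong -_ (link-cong v (λ t → eq (true ∷ t)) s)

private
  neg-lin : ∀ x a y → - (x + a * y) ≡ - x + a * - y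
  neg-lin = solve-∀
  add-lin : ∀ x y a z w → x + a * y + (z + a * w) ≡ x + z + a * (y + w)
  add-lin = solve-∀

bd-lin : ∀ (c : Ch m) a d → bd (c +[ a ] d) ≗ bd c +[ a ] bd d
bd-lin {zero}  c a d []          = sym (trans (ℤ.+-identityˡ _) (ℤ.*-zeroʳ a))
bd-lin {suc m} c a d (false ∷ s) =
  trans (cong (_+ (c (true ∷ s) + a * d (true ∷ s))) (bd-lin (c ∘ (false ∷_)) a (d ∘ (false ∷_)) s))
        (add-lin (bd (c ∘ (false ∷_)) s) _ a (c (true ∷ s)) (d (true ∷ s)))
bd-lin {suc m} c a d (true ∷ s)  =
  trans (cong -_ (bd-lin (c ∘ (true ∷_)) a (d ∘ (true ∷_)) s))
        (neg-lin (bd (c ∘ (true ∷_)) s) a _)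

cone-lin : ∀ v (c : Ch m) a d → cone v (c +[ a ] d) ≗ cone v c +[ a ] cone v d
cone-lin zero    c a d (false ∷ s) = sym (trans (ℤ.+-identityˡ _) (ℤ.*-zeroʳ a))
cone-lin zero    c a d (true ∷ s)  = refl
cone-lin (suc v) c a d (false ∷ s) = cone-lin v (c ∘ (false ∷_)) a (d ∘ (false ∷_)) s
cone-lin (suc v) c a d (true ∷ s)  =
  trans (cong -_ (cone-lin v (c ∘ (true ∷_)) a (d ∘ (true ∷_)) s))
        (neg-lin (cone v (c ∘ (true ∷_)) s) a _)

link-lin : ∀ v (c : Ch m) a d → link v (c +[ a ] d) ≗ link v c +[ a ] link v d
link-lin zero    c a d (false ∷ s) = refl
link-lin zero    c a d (true ∷ s)  = sym (trans (ℤ.+-identityˡ _) (ℤ.*-zeroʳ a))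
link-lin (suc v) c a d (false ∷ s) = link-lin v (c ∘ (false ∷_)) a (d ∘ (false ∷_)) s
link-lin (suc v) c a d (true ∷ s)  =
  trans (cong -_ (link-lin v (c ∘ (true ∷_)) a (d ∘ (true ∷_)) s))
        (neg-lin (link v (c ∘ (true ∷_)) s) a _)

0ᶜ : Ch m
0ᶜ _ = 0ℤ

bd-0 : bd {m} 0ᶜ ≗ 0ᶜ
bd-0 {zero}  []          = refl
bd-0 {suc m} (false ∷ s) = cong (_+ 0ℤ) (bd-0 s)
bd-0 {suc m} (true ∷ s)  = cong -_ (bd-0 s)

bd-neg : (c : Ch m) → bd (λ s → - c s) ≗ (λ s → - bd c s)
bd-neg {zero}  c []          = refl
bd-neg {suc m} c (false ∷ s) = trans (cong (_+ - c (true ∷ s)) (bd-neg (c ∘ (false ∷_)) s))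
                                     (sym (ℤ.neg-distrib-+ (bd (c ∘ (false ∷_)) s) (c (true ∷ s))))
bd-neg {suc m} c (true ∷ s)  = cong -_ (bd-neg (c ∘ (true ∷_)) s)

link-0 : ∀ v → link {m} v 0ᶜ ≗ 0ᶜ
link-0 zero    (false ∷ s) = refl
link-0 zero    (true ∷ s)  = refl
link-0 (suc v) (false ∷ s) = link-0 v s
link-0 (suc v) (true ∷ s)  = cong -_ (link-0 v s)

cone-neg : ∀ v (c : Ch m) → cone v (λ s → - c s) ≗ (λ s → - cone v c s)
cone-neg zero    c (false ∷ s) = refl
cone-neg zero    c (true ∷ s)  = refl
cone-neg (suc v) c (false ∷ s) = cone-neg v (c ∘ (false ∷_)) s
cone-neg (suc v) c (true ∷ s)  = cong -_ (cone-neg v (c ∘ (true ∷_)) s)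

cone-+ : ∀ v (c d : Ch m) → cone v (λ s → c s + d s) ≗ (λ s → cone v c s + cone v d s)
cone-+ zero    c d (false ∷ s) = refl
cone-+ zero    c d (true ∷ s)  = refl
cone-+ (suc v) c d (false ∷ s) = cone-+ v (c ∘ (false ∷_)) (d ∘ (false ∷_)) s
cone-+ (suc v) c d (true ∷ s)  =
  trans (cong -_ (cone-+ v (c ∘ (true ∷_)) (d ∘ (true ∷_)) s)) (ℤ.neg-distrib-+ (cone v (c ∘ (true ∷_)) s) (cone v (d ∘ (true ∷_)) s))

link-neg : ∀ v (c : Ch m) → link v (λ s → - c s) ≗ (λ s → - link v c s)
link-neg zero    c (false ∷ s) = refl
link-neg zero    c (true ∷ s)  = refl
link-neg (suc v) c (false ∷ s) = link-neg v (c ∘ (false ∷_)) s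
link-neg (suc v) c (true ∷ s)  = cong -_ (link-neg v (c ∘ (true ∷_)) s)

link-+ : ∀ v (c d : Ch m) → link v (λ s → c s + d s) ≗ (λ s → link v c s + link v d s)
link-+ zero    c d (false ∷ s) = refl
link-+ zero    c d (true ∷ s)  = refl
link-+ (suc v) c d (false ∷ s) = link-+ v (c ∘ (false ∷_)) (d ∘ (false ∷_)) s
link-+ (suc v) c d (true ∷ s)  =
  trans (cong -_ (link-+ v (c ∘ (true ∷_)) (d ∘ (true ∷_)) s)) (ℤ.neg-distrib-+ (link v (c ∘ (true ∷_)) s) (link v (d ∘ (true ∷_)) s))

bd-+ : (c d : Ch m) → bd (λ s → c s + d s) ≗ (λ s → bd c s + bd d s)
bd-+ c d s = trans (bd-cong (λ t → cong (_+_ (c t)) (sym (ℤ.*-identityˡ (d t)))) s)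
            (trans (bd-lin c 1ℤ d s) (cong (_+_ (bd c s)) (ℤ.*-identityˡ _)))

bd-bd : (c : Ch m) → bd (bd c) ≗ 0ᶜ
bd-bd {zero}  c []          = refl
bd-bd {suc m} c (false ∷ s) = begin
  bd (λ t → bd c₀ t + c₁ t) s + - bd c₁ s       ≡⟨ cong (_+ - bd c₁ s) (bd-+ (bd c₀) c₁ s) ⟩
  bd (bd c₀) s + bd c₁ s + - bd c₁ s            ≡⟨ cong (λ x → x + bd c₁ s + - bd c₁ s) (bd-bd c₀ s) ⟩
  0ℤ + bd c₁ s + - bd c₁ s                      ≡⟨ lem (bd c₁ s) ⟩
  0ℤ ∎
  where
  open ≡-Reasoning
  c₀ = c ∘ (false ∷_)
  c₁ = c ∘ (true ∷_)
  lem : ∀ x → 0ℤ + x + - x ≡ 0ℤ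
  lem = solve-∀
bd-bd {suc m} c (true ∷ s)  =
  trans (cong -_ (bd-neg (bd (c ∘ (true ∷_))) s)) (cong (λ x → - - x) (bd-bd (c ∘ (true ∷_)) s))

-- Leibniz rule in the exterior algebra: `cone v` is a contracting homotopy of the full augmented
-- chain complex, faces through `v` included.
bd-cone : ∀ v (c : Ch m) s → bd (cone v c) s ≡ c s - cone v (bd c) s
bd-cone {suc m} zero c (false ∷ s) =
  trans (cong (_+ c (false ∷ s)) (bd-0 s)) (trans (ℤ.+-identityˡ (c (false ∷ s))) (sym (ℤ.+-identityʳ (c (false ∷ s)))))
bd-cone {suc m} zero c (true ∷ s)  = lem (bd (c ∘ (false ∷_)) s) (c (true ∷ s))
  where
  lem : ∀ x y → - x ≡ y - (x + y)
  lem = solve-∀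
bd-cone {suc m} (suc v) c (false ∷ s) = begin
  bd (cone v c₀) s + - cone v c₁ s              ≡⟨ cong (_+ - cone v c₁ s) (bd-cone v c₀ s) ⟩
  (c₀ s - cone v (bd c₀) s) + - cone v c₁ s     ≡⟨ lem (c₀ s) (cone v (bd c₀) s) (cone v c₁ s) ⟩
  c₀ s - (cone v (bd c₀) s + cone v c₁ s)       ≡⟨ cong (λ x → c₀ s - x) (cone-+ v (bd c₀) c₁ s) ⟨
  c₀ s - cone v (λ t → bd c₀ t + c₁ t) s        ∎
  where
  open ≡-Reasoning
  c₀ = c ∘ (false ∷_)
  c₁ = c ∘ (true ∷_)
  lem : ∀ x y z → x - y + - z ≡ x - (y + z)
  lem = solve-∀
bd-cone {suc m} (suc v) c (true ∷ s) = begin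
  - bd (λ t → - cone v c₁ t) s                  ≡⟨ cong -_ (bd-neg (cone v c₁) s) ⟩
  - - bd (cone v c₁) s                          ≡⟨ ℤ.neg-involutive _ ⟩
  bd (cone v c₁) s                              ≡⟨ bd-cone v c₁ s ⟩
  c₁ s - cone v (bd c₁) s                       ≡⟨ cong (λ x → c₁ s + x) (lem (cone v (bd c₁) s)) ⟩
  c₁ s - - - cone v (bd c₁) s                   ≡⟨ cong (λ x → c₁ s - - x) (cone-neg v (bd c₁) s) ⟨
  c₁ s - - cone v (λ t → - bd c₁ t) s           ∎
  where
  open ≡-Reasoning
  c₁ = c ∘ (true ∷_)
  lem : ∀ x → - x ≡ - - - x
  lem = solve-∀

-- `bd` is itself a contraction, by the sum of the coordinate functionals of all vertices, and any
-- two contractions anticommute.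
bd-link : ∀ v (c : Ch m) s → bd (link v c) s ≡ - link v (bd c) s
bd-link {suc m} zero c (false ∷ s) =
  trans (ℤ.+-identityʳ _) (sym (ℤ.neg-involutive _))
bd-link {suc m} zero c (true ∷ s)  = cong -_ (bd-0 s)
bd-link {suc m} (suc v) c (false ∷ s) = begin
  bd (link v c₀) s + - link v c₁ s              ≡⟨ cong (_+ - link v c₁ s) (bd-link v c₀ s) ⟩
  - link v (bd c₀) s + - link v c₁ s            ≡⟨ ℤ.neg-distrib-+ (link v (bd c₀) s) (link v c₁ s) ⟨
  - (link v (bd c₀) s + link v c₁ s)            ≡⟨ cong -_ (link-+ v (bd c₀) c₁ s) ⟨
  - link v (λ t → bd c₀ t + c₁ t) s             ∎
  where
  open ≡-Reasoning
  c₀ = c ∘ (false ∷_)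
  c₁ = c ∘ (true ∷_)
bd-link {suc m} (suc v) c (true ∷ s) = begin
  - bd (λ t → - link v c₁ t) s                  ≡⟨ cong -_ (bd-neg (link v c₁) s) ⟩
  - - bd (link v c₁) s                          ≡⟨ cong (λ x → - - x) (bd-link v c₁ s) ⟩
  - - - link v (bd c₁) s                        ≡⟨ cong (λ x → - - x) (link-neg v (bd c₁) s) ⟨
  - - link v (λ t → - bd c₁ t) s                ∎
  where
  open ≡-Reasoning
  c₁ = c ∘ (true ∷_)

-- The Clifford relation between multiplication and contraction by the same vertex, with the cross
-- term moved to the right.
link-cone : ∀ v (c : Ch m) s → link v (cone v c) s ≡ c s - cone v (link v c) s
link-cone zero    c (false ∷ s) = sym (ℤ.+-identityʳ _)
link-cone zero    c (true ∷ s)  = sym (ℤ.+-inverseʳ (c (true ∷ s)))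
link-cone (suc v) c (false ∷ s) = link-cone v (c ∘ (false ∷_)) s
link-cone (suc v) c (true ∷ s)  = begin
  - link v (λ t → - cone v c₁ t) s              ≡⟨ cong -_ (link-neg v (cone v c₁) s) ⟩
  - - link v (cone v c₁) s                      ≡⟨ ℤ.neg-involutive _ ⟩
  link v (cone v c₁) s                          ≡⟨ link-cone v c₁ s ⟩
  c₁ s - cone v (link v c₁) s                   ≡⟨ cong (λ x → c₁ s + x) (lem (cone v (link v c₁) s)) ⟩
  c₁ s - - - cone v (link v c₁) s               ≡⟨ cong (λ x → c₁ s - - x) (cone-neg v (link v c₁) s) ⟨
  c₁ s - - cone v (λ t → - link v c₁ t) s       ∎
  where
  open ≡-Reasoning
  c₁ = c ∘ (true ∷_)
  lem : ∀ x → - x ≡ - - - x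
  lem = solve-∀

≢0-+ : ∀ x y → x + y ≢ 0ℤ → x ≢ 0ℤ ⊎ y ≢ 0ℤ
≢0-+ x y ne with x ℤ.≟ 0ℤ
... | no x≢0   = inj₁ x≢0
... | yes refl = inj₂ (λ y≡0 → ne (cong (_+_ (0ℤ)) y≡0))

≢0-neg : ∀ x → - x ≢ 0ℤ → x ≢ 0ℤ
≢0-neg x ne x≡0 = ne (cong -_ x≡0)

≢0-* : ∀ a x → a * x ≢ 0ℤ → x ≢ 0ℤ
≢0-* a x ne x≡0 = ne (trans (cong (a *_) x≡0) (ℤ.*-zeroʳ a))

bd-supp : ∀ (c : Ch m) s → bd c s ≢ 0ℤ → ∃ λ v → s ∌ v × c (s [ v ]≔ true) ≢ 0ℤ
bd-supp {zero}  c []          ne = ⊥-elim (ne refl)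
bd-supp {suc m} c (false ∷ s) ne with ≢0-+ _ (c (true ∷ s)) ne
... | inj₂ ne₁ = zero , refl , ne₁
... | inj₁ ne₀ with v , s∌v , ne₁ ← bd-supp (c ∘ (false ∷_)) s ne₀ = suc v , s∌v , ne₁
bd-supp {suc m} c (true ∷ s)  ne
  with v , s∌v , ne₁ ← bd-supp (c ∘ (true ∷_)) s (≢0-neg _ ne) = suc v , s∌v , ne₁

cone-supp : ∀ v (c : Ch m) s → cone v c s ≢ 0ℤ → lookup s v ≡ true × c (s [ v ]≔ false) ≢ 0ℤ
cone-supp zero    c (false ∷ s) ne = ⊥-elim (ne refl)
cone-supp zero    c (true ∷ s)  ne = refl , ne
cone-supp (suc v) c (false ∷ s) ne = cone-supp v (c ∘ (false ∷_)) s ne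
cone-supp (suc v) c (true ∷ s)  ne = cone-supp v (c ∘ (true ∷_)) s (≢0-neg _ ne)

link-supp : ∀ v (c : Ch m) s → link v c s ≢ 0ℤ → s ∌ v × c (s [ v ]≔ true) ≢ 0ℤ
link-supp zero    c (false ∷ s) ne = refl , ne
link-supp zero    c (true ∷ s)  ne = ⊥-elim (ne refl)
link-supp (suc v) c (false ∷ s) ne = link-supp v (c ∘ (false ∷_)) s ne
link-supp (suc v) c (true ∷ s)  ne = link-supp v (c ∘ (true ∷_)) s (≢0-neg _ ne)

private
  x-0 : ∀ x → x - 0ℤ ≡ x
  x-0 = solve-∀

-- Together with `cone-link-∋`: `cone v (link v c)` is exactly the part of `c` carried by faces
-- through `v`, so subtracting it restricts `c` to the deletion of `v`.
cone-link-∌ : ∀ v (c : Ch m) s → s ∌ v → cone v (link v c) s ≡ 0ℤ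
cone-link-∌ zero    c (false ∷ s) _   = refl
cone-link-∌ (suc v) c (false ∷ s) s∌v = cone-link-∌ v (c ∘ (false ∷_)) s s∌v
cone-link-∌ (suc v) c (true ∷ s)  s∌v =
  cong -_ (trans (cone-cong v (λ t → refl) s) (trans (cone-neg v _ s) (cong -_ (cone-link-∌ v (c ∘ (true ∷_)) s s∌v))))

cone-link-∋ : ∀ v (c : Ch m) s → lookup s v ≡ true → cone v (link v c) s ≡ c s
cone-link-∋ zero    c (true ∷ s)  _   = refl
cone-link-∋ (suc v) c (false ∷ s) s∋v = cone-link-∋ v (c ∘ (false ∷_)) s s∋v
cone-link-∋ (suc v) c (true ∷ s)  s∋v =
  trans (cong -_ (cone-neg v (link v (c ∘ (true ∷_))) s))
 (trans (ℤ.neg-involutive _) (cone-link-∋ v (c ∘ (true ∷_)) s s∋v))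

remainder-supp : ∀ v (c : Ch m) s → c s - cone v (link v c) s ≢ 0ℤ → s ∌ v × c s ≢ 0ℤ
remainder-supp v c s ne with lookup s v in eq
... | true  = ⊥-elim (ne (trans (cong (λ x → c s - x) (cone-link-∋ v c s eq)) (ℤ.+-inverseʳ (c s))))
... | false = refl , λ c≡0 → ne (trans (cong (λ x → c s - x) (cone-link-∌ v c s eq)) (trans (x-0 (c s)) c≡0))

∣insert∣ : ∀ v (s : Subset m) → s ∌ v → ∣ s [ v ]≔ true ∣ ≡ suc ∣ s ∣
∣insert∣ zero    (false ∷ s) _   = refl
∣insert∣ (suc v) (false ∷ s) s∌v = ∣insert∣ v s s∌v
∣insert∣ (suc v) (true ∷ s)  s∌v = cong suc (∣insert∣ v s s∌v)

∣remove∣ : ∀ v (s : Subset m) → lookup s v ≡ true → ∣ s ∣ ≡ suc ∣ s [ v ]≔ false ∣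
∣remove∣ zero    (true ∷ s)  _   = refl
∣remove∣ (suc v) (false ∷ s) s∋v = ∣remove∣ v s s∋v
∣remove∣ (suc v) (true ∷ s)  s∋v = cong suc (∣remove∣ v s s∋v)

insert-remove : ∀ v (s : Subset m) → lookup s v ≡ true → (s [ v ]≔ false) [ v ]≔ true ≡ s
insert-remove zero    (true ∷ s) _   = refl
insert-remove (suc v) (x ∷ s)    s∋v = cong (x ∷_) (insert-remove v s s∋v)

remove-insert : ∀ v (s : Subset m) → s ∌ v → (s [ v ]≔ true) [ v ]≔ false ≡ s
remove-insert zero    (false ∷ s) _  = refl
remove-insert (suc v) (x ∷ s)    s∌v = cong (x ∷_) (remove-insert v s s∌v)

remove-∌ : ∀ v (s : Subset m) → (s [ v ]≔ false) ∌ v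
remove-∌ zero    (x ∷ s) = refl
remove-∌ (suc v) (x ∷ s) = remove-∌ v s

insert-∋ : ∀ v (s : Subset m) → lookup (s [ v ]≔ true) v ≡ true
insert-∋ zero    (x ∷ s) = refl
insert-∋ (suc v) (x ∷ s) = insert-∋ v s

insert-idem : ∀ v (s : Subset m) → lookup s v ≡ true → s [ v ]≔ true ≡ s
insert-idem zero    (true ∷ s) _   = refl
insert-idem (suc v) (x ∷ s)    s∋v = cong (x ∷_) (insert-idem v s s∋v)

-- Homology of subcomplexes

Cx : ℕ → Set₁
Cx m = Subset m → Set

Supp : Cx m → ℕ → Ch m → Set
Supp K j c = ∀ s → c s ≢ 0ℤ → K s × ∣ s ∣ ≡ j

On : Cx m → Ch m → Set
On K c = ∀ s → c s ≢ 0ℤ → K s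

∅ᶜ : Cx m
∅ᶜ _ = ⊥

-- Vanishing of the relative homology of (K, K′).
RelAcyclic : Cx m → Cx m → Set
RelAcyclic K′ K = ∀ j c → Supp K j c → On K′ (bd c) →
  ∃ λ b → Supp K (suc j) b × On K′ (λ s → c s + bd b s)

On-∅ : {c : Ch m} → On ∅ᶜ c → c ≗ 0ᶜ
On-∅ h s = decidable-stable (_ ℤ.≟ _) (h s)

On-≗ : {K : Cx m} {c d : Ch m} → c ≗ d → On K c → On K d
On-≗ eq h s ne = h s (λ c≡0 → ne (trans (sym (eq s)) c≡0))

0-On : {K : Cx m} {c : Ch m} → c ≗ 0ᶜ → On K c
0-On eq s ne = ⊥-elim (ne (eq s))

Supp-≗ : ∀ {K : Cx m} {j} {c d : Ch m} → c ≗ d → Supp K j c → Supp K j d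
Supp-≗ eq h s ne = h s (λ c≡0 → ne (trans (sym (eq s)) c≡0))

Supp-lin : ∀ {K : Cx m} {j} {c d : Ch m} a → Supp K j c → Supp K j d → Supp K j (c +[ a ] d)
Supp-lin a h g s ne with ≢0-+ _ _ ne
... | inj₁ n = h s n
... | inj₂ n = g s (≢0-* a _ n)

Supp-+ : ∀ {K : Cx m} {j} {c d : Ch m} → Supp K j c → Supp K j d → Supp K j (λ s → c s + d s)
Supp-+ h g s ne with ≢0-+ _ _ ne
... | inj₁ n = h s n
... | inj₂ n = g s n

Supp-⊆ : ∀ {K L : Cx m} {j} {c : Ch m} → (∀ s → K s → L s) → Supp K j c → Supp L j c
Supp-⊆ K⊆L h s ne = K⊆L s (proj₁ (h s ne)) , proj₂ (h s ne)

bd-absorb : (c b : Ch m) → bd (λ t → c t + bd b t) ≗ bd c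
bd-absorb c b s = trans (bd-+ c (bd b) s) (trans (cong (_+_ (bd c s)) (bd-bd b s)) (ℤ.+-identityʳ _))

Supp-bd : ∀ {K : Cx m} {j} {c : Ch m} → Supp K (suc j) c → ∀ s → bd c s ≢ 0ℤ → ∣ s ∣ ≡ j
Supp-bd {c = c} h s ne with v , s∌v , ne₁ ← bd-supp c s ne =
  ℕ.suc-injective (trans (sym (∣insert∣ v s s∌v)) (proj₂ (h _ ne₁)))

size-absorb : ∀ {K L : Cx m} {j} {c b : Ch m} → Supp K j c → Supp L (suc j) b →
  ∀ s → c s + bd b s ≢ 0ℤ → ∣ s ∣ ≡ j
size-absorb {b = b} hc hb s ne with ≢0-+ _ _ ne
... | inj₁ n = proj₂ (hc s n)
... | inj₂ n = Supp-bd {c = b} hb s n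

-- A chain is first pushed into `L` and then into `K`; the second step applies because adding a
-- boundary leaves `bd c` unchanged.
RelAcyclic-trans : {K L P : Cx m} → (∀ s → K s → L s) → (∀ s → L s → P s) →
  RelAcyclic K L → RelAcyclic L P → RelAcyclic K P
RelAcyclic-trans K⊆L L⊆P kl lp j c hc hbd
  with b₁ , hb₁ , on₁ ← lp j c hc (λ s ne → K⊆L s (hbd s ne))
  with b₂ , hb₂ , on₂ ← kl j (λ s → c s + bd b₁ s)
         (λ s ne → on₁ s ne , size-absorb hc hb₁ s ne)
         (On-≗ (λ s → sym (bd-absorb c b₁ s)) hbd)
  = (λ s → b₁ s + b₂ s) , Supp-+ {c = b₁} hb₁ (Supp-⊆ L⊆P hb₂)
  , On-≗ (λ s → trans (ℤ.+-assoc (c s) _ _) (cong (_+_ (c s)) (sym (bd-+ b₁ b₂ s)))) on₂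

cone-0 : ∀ v → cone {m} v 0ᶜ ≗ 0ᶜ
cone-0 zero    (false ∷ s) = refl
cone-0 zero    (true ∷ s)  = refl
cone-0 (suc v) (false ∷ s) = cone-0 v s
cone-0 (suc v) (true ∷ s)  = cong -_ (cone-0 v s)

bd-cycle-cone : ∀ v (c : Ch m) → bd c ≗ 0ᶜ → bd (cone v c) ≗ c
bd-cycle-cone v c z s = trans (bd-cone v c s)
  (trans (cong (λ x → c s - x) (trans (cone-cong v z s) (cone-0 v s))) (x-0 (c s)))

-- The boundary of `cone v c` is `c` for a cycle `c`; the minus sign in the filling is forced by
-- `RelAcyclic` asking for `c + bd b` to vanish.
cone-acyclic : ∀ {K : Cx m} v → (∀ s → K s → K (s [ v ]≔ true)) → RelAcyclic ∅ᶜ K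
cone-acyclic {K = K} v closed j c hc hbd = (λ s → - cone v c s) , supp , 0-On′
  where
  supp : Supp K (suc j) (λ s → - cone v c s)
  supp s ne with s∋v , ne₁ ← cone-supp v c s (≢0-neg _ ne) =
    subst K (insert-remove v s s∋v) (closed _ (proj₁ (hc _ ne₁))) ,
    trans (∣remove∣ v s s∋v) (cong suc (proj₂ (hc _ ne₁)))
  0-On′ : On ∅ᶜ (λ s → c s + bd (λ t → - cone v c t) s)
  0-On′ s ne = ne (trans (cong (_+_ (c s)) (trans (bd-neg (cone v c) s)
     (cong -_ (bd-cycle-cone v c (On-∅ hbd) s)))) (ℤ.+-inverseʳ (c s)))

acyclic-fill : {K₁ : Cx m} → RelAcyclic ∅ᶜ K₁ → ∀ j c → Supp K₁ j c → bd c ≗ 0ᶜ → ∃ λ b → Supp K₁ (suc j) b × bd b ≗ c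
acyclic-fill ac j c hc z with b , hb , on ← ac j c hc (0-On z) =
  (λ s → - b s) , (λ s ne → hb s (≢0-neg _ ne)) ,
  λ s → trans (bd-neg b s) (lem (c s) (bd b s) (On-∅ on s))
  where
  lem : ∀ x y → x + y ≡ 0ℤ → - y ≡ x
  lem x y h = trans (lem′ x y) (trans (cong (λ z → x - z) h) (x-0 x))
    where
    lem′ : ∀ x y → - y ≡ x - (x + y)
    lem′ = solve-∀

-- K₀ and K₁ are the deletion and the link of the vertex v of K.
record Split {m} (v : Fin m) (K K₀ K₁ : Cx m) : Set where
  field
    del⇒  : ∀ s → K s → s ∌ v → K₀ s
    del⇐  : ∀ s → K₀ s → K s × s ∌ v
    link⇒ : ∀ s → s ∌ v → K (s [ v ]≔ true) → K₁ s
    link⇐ : ∀ s → K₁ s → K (s [ v ]≔ true) × s ∌ v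
    link⊆del : ∀ s → K₁ s → K₀ s

module _ {m : ℕ} {v : Fin m} {K K₀ K₁ : Cx m} (sp : Split v K K₀ K₁) where
  open Split sp

  K₀∌v : ∀ {c : Ch m} → On K₀ c → link v c ≗ 0ᶜ
  K₀∌v {c} h s = decidable-stable (_ ℤ.≟ _) λ ne → let (_ , ne₁) = link-supp v c s ne in
    true≢false (trans (sym (insert-∋ v s)) (proj₂ (del⇐ _ (h _ ne₁))))
    where
    true≢false : true ≡ false → ⊥
    true≢false ()

  Supp-link : ∀ {j} {c : Ch m} → Supp K (suc j) c → Supp K₁ j (link v c)
  Supp-link {c = c} h s ne with s∌v , ne₁ ← link-supp v c s ne =
    link⇒ s s∌v (proj₁ (h _ ne₁)) , ℕ.suc-injective (trans (sym (∣insert∣ v s s∌v)) (proj₂ (h _ ne₁)))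

  Supp-cone : ∀ {j} {c : Ch m} → Supp K₁ j c → Supp K (suc j) (cone v c)
  Supp-cone {c = c} h s ne with s∋v , ne₁ ← cone-supp v c s ne =
    subst K (insert-remove v s s∋v) (proj₁ (link⇐ _ (proj₁ (h _ ne₁)))) ,
    trans (∣remove∣ v s s∋v) (cong suc (proj₂ (h _ ne₁)))

  Supp-remainder : ∀ {j} {c : Ch m} → Supp K j c → Supp K₀ j (λ s → c s - cone v (link v c) s)
  Supp-remainder {c = c} h s ne with s∌v , ne₁ ← remainder-supp v c s ne =
    del⇒ s (proj₁ (h s ne₁)) s∌v , proj₂ (h s ne₁)

  -- By the Leibniz rule, adding `bd (cone v b)` cancels the part of `c` through `v`, which is
  -- `cone v (bd b)`, and contributes `b`, which lies in the link and hence in the deletion.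
  push : ∀ {j} {c b : Ch m} → Supp K j c → Supp K₁ j b → bd b ≗ link v c →
         Supp K₀ j (λ s → c s + bd (cone v b) s)
  push {j} {c} {b} hc hb eq = Supp-≗ eq′ (Supp-+ {c = λ s → c s - cone v (link v c) s} (Supp-remainder hc) (Supp-⊆ link⊆del hb))
    where
    open ≡-Reasoning
    lem : ∀ x y z → x - y + z ≡ x + (z - y)
    lem = solve-∀
    eq′ : ∀ s → c s - cone v (link v c) s + b s ≡ c s + bd (cone v b) s
    eq′ s = begin
      c s - cone v (link v c) s + b s      ≡⟨ lem (c s) _ (b s) ⟩
      c s + (b s - cone v (link v c) s)    ≡⟨ cong (λ x → c s + (b s - x)) (cone-cong v eq s) ⟨
      c s + (b s - cone v (bd b) s)        ≡⟨ cong (_+_ (c s)) (bd-cone v b s) ⟨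
      c s + bd (cone v b) s                ∎

  link-cycle : ∀ {c : Ch m} → On K₀ (bd c) → bd (link v c) ≗ 0ᶜ
  link-cycle {c} h s = trans (bd-link v c s) (cong -_ (K₀∌v h s))

  Supp-0 : ∀ {c : Ch m} → Supp K 0 c → link v c ≗ 0ᶜ
  Supp-0 {c} h s = decidable-stable (_ ℤ.≟ _) λ ne → let (s∌v , ne₁) = link-supp v c s ne in
    ℕ.0≢1+n (trans (sym (proj₂ (h _ ne₁))) (∣insert∣ v s s∌v))

  -- Taking links lowers the degree, so degree 0 needs a case of its own: there the link vanishes.
  -- The hypothesis speaks of the single degree below `j`, because `Wedge-split` can supply it only
  -- off the top degree.
  link-filling : ∀ j →
    (∀ i → j ≡ suc i → ∀ c → Supp K₁ i c → bd c ≗ 0ᶜ → ∃ λ b → Supp K₁ (suc i) b × bd b ≗ c) →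
    ∀ c → Supp K j c → On K₀ (bd c) → ∃ λ b → Supp K₁ j b × bd b ≗ link v c
  link-filling zero    fill c hc hbd = 0ᶜ , (λ s ne → ⊥-elim (ne refl)) , λ s → trans (bd-0 s) (sym (Supp-0 hc s))
  link-filling (suc j) fill c hc hbd = fill j refl (link v c) (Supp-link hc) (link-cycle hbd)

  -- By excision the homology of `K` relative to `K₀` is that of the link, shifted by one degree; a
  -- filling `b` of `link v c` becomes the correction `cone v b`.
  remove-vertex : RelAcyclic ∅ᶜ K₁ → RelAcyclic K₀ K
  remove-vertex ac j c hc hbd
    with b , hb , eq ← link-filling j (λ i _ → acyclic-fill ac i) c hc hbd
    = cone v b , Supp-cone hb , λ s ne → proj₁ (push hc hb eq s ne)

-- Complexes with free homology in a single degree

lin : ∀ {m k} → Vec ℤ k → Vec (Ch m) k → Ch m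
lin []      []       s = 0ℤ
lin (a ∷ v) (z ∷ zs) s = a * z s + lin v zs s

IsCyc : Cx m → ℕ → Ch m → Set
IsCyc K d z = Supp K d z × bd z ≗ 0ᶜ

-- Chains are graded by the number of vertices: the homology of K is concentrated in degree d - 1.
record Wedge {m} (K : Cx m) (d k : ℕ) : Set where
  field
    dim     : ∀ s → K s → ∣ s ∣ ≤ d
    acyclic : ∀ j → j ≢ d → ∀ c → IsCyc K j c → ∃ λ b → Supp K (suc j) b × bd b ≗ c
    basis   : Vec (Ch m) k
    cycles  : All (IsCyc K d) basis
    span    : ∀ c → IsCyc K d c → ∃ λ v → lin v basis ≗ c
    independent : ∀ v → lin v basis ≗ 0ᶜ → v ≡ replicate k 0ℤ

replicate-++ : ∀ k l → replicate (k ℕ.+ l) 0ℤ ≡ replicate k 0ℤ ++ᵛ replicate l 0ℤ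
replicate-++ zero    l = refl
replicate-++ (suc k) l = cong (0ℤ ∷_) (replicate-++ k l)

IsCyc-0 : ∀ {K : Cx m} {d} → IsCyc K d 0ᶜ
IsCyc-0 = (λ s ne → ⊥-elim (ne refl)) , bd-0

IsCyc-lin : ∀ {K : Cx m} {d} {c e : Ch m} a → IsCyc K d c → IsCyc K d e → IsCyc K d (c +[ a ] e)
IsCyc-lin {c = c} {e} a (hc , zc) (he , ze) = Supp-lin {c = c} a hc he ,
  λ s → trans (bd-lin c a e s) (trans (cong₂ (λ x y → x + a * y) (zc s) (ze s)) (trans (ℤ.+-identityˡ _) (ℤ.*-zeroʳ a)))

IsCyc-≗ : ∀ {K : Cx m} {d} {c e : Ch m} → c ≗ e → IsCyc K d c → IsCyc K d e
IsCyc-≗ eq (hc , zc) = Supp-≗ eq hc , λ s → trans (sym (bd-cong eq s)) (zc s)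

IsCyc-⊆ : ∀ {K L : Cx m} {d} {c : Ch m} → (∀ s → K s → L s) → IsCyc K d c → IsCyc L d c
IsCyc-⊆ f (hc , zc) = Supp-⊆ f hc , zc

lin-step : ∀ {m k} a v (z : Ch m) (zs : Vec (Ch m) k) → lin v zs +[ a ] z ≗ lin (a ∷ v) (z ∷ zs)
lin-step a v z zs s = ℤ.+-comm (lin v zs s) (a * z s)

lin-cyc : ∀ {K : Cx m} {d k} v {zs : Vec (Ch m) k} → All (IsCyc K d) zs → IsCyc K d (lin v zs)
lin-cyc []      []       = IsCyc-≗ (λ _ → refl) IsCyc-0
lin-cyc (a ∷ v) {z ∷ zs} (h ∷ hs) = IsCyc-≗ (lin-step a v z zs) (IsCyc-lin a (lin-cyc v hs) h)

lin-++ : ∀ {m k l} v (w : Vec ℤ l) (zs : Vec (Ch m) k) ys s →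
  lin (v ++ᵛ w) (zs ++ᵛ ys) s ≡ lin v zs s + lin w ys s
lin-++ []      w []       ys s = sym (ℤ.+-identityˡ _)
lin-++ (a ∷ v) w (z ∷ zs) ys s =
  trans (cong (_+_ (a * z s)) (lin-++ v w zs ys s)) (sym (ℤ.+-assoc (a * z s) (lin v zs s) (lin w ys s)))

lin-0 : ∀ {m k} (zs : Vec (Ch m) k) → lin (replicate k 0ℤ) zs ≗ 0ᶜ
lin-0 []       s = refl
lin-0 (z ∷ zs) s = trans (ℤ.+-identityˡ _) (lin-0 zs s)

lin-add : ∀ {m k} v w (zs : Vec (Ch m) k) s → lin (Vec.zipWith _+_ v w) zs s ≡ lin v zs s + lin w zs s
lin-add []      []      []       s = refl
lin-add (a ∷ v) (b ∷ w) (z ∷ zs) s =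
  trans (cong (_+_ ((a + b) * z s)) (lin-add v w zs s)) (lem a b (z s) (lin v zs s) (lin w zs s))
  where
  lem : ∀ a b z x y → (a + b) * z + (x + y) ≡ (a * z + x) + (b * z + y)
  lem = solve-∀

lin-neg : ∀ {m k} v (zs : Vec (Ch m) k) s → lin (Vec.map -_ v) zs s ≡ - lin v zs s
lin-neg []      []       s = refl
lin-neg (a ∷ v) (z ∷ zs) s = trans (cong (_+_ (- a * z s)) (lin-neg v zs s)) (lem a (z s) (lin v zs s))
  where
  lem : ∀ a z x → - a * z + - x ≡ - (a * z + x)
  lem = solve-∀

Wedge-⇔ : ∀ {K L : Cx m} {d k} → (∀ s → K s → L s) → (∀ s → L s → K s) → Wedge K d k → Wedge L d k
Wedge-⇔ f g w = record
  { dim     = λ s h → dim s (g s h)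
  ; acyclic = λ j ne c z → let (b , hb , eq) = acyclic j ne c (IsCyc-⊆ g z) in b , Supp-⊆ f hb , eq
  ; basis   = basis
  ; cycles  = All.map (IsCyc-⊆ f) cycles
  ; span    = λ c z → span c (IsCyc-⊆ g z)
  ; independent   = independent
  }
  where open Wedge w

Supp-high : ∀ {K : Cx m} {d j} {c : Ch m} → (∀ s → K s → ∣ s ∣ ≤ d) → d < j → Supp K j c → c ≗ 0ᶜ
Supp-high dim d<j h s = decidable-stable (_ ℤ.≟ _) λ ne →
  let (k , eq) = h s ne in ℕ.<⇒≱ d<j (subst (_≤ _) eq (dim s k))

cone-wedge : ∀ {K : Cx m} {d} v → (∀ s → K s → K (s [ v ]≔ true)) → (∀ s → K s → ∣ s ∣ ≤ d) → Wedge K d 0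
cone-wedge {K = K} {d} v closed dim = record
  { dim     = dim
  ; acyclic = λ j _ c (h , z) → fill j c h z
  ; basis   = []
  ; cycles  = []
  -- A top cycle is the boundary of a chain one degree above `d`, where the dimension bound leaves
  -- no nonzero chain.
  ; span    = λ c (h , z) → [] , λ s → let (b , hb , eq) = fill d c h z in
                sym (trans (sym (eq s)) (trans (bd-cong (Supp-high dim (ℕ.n<1+n d) hb) s) (bd-0 s)))
  ; independent   = λ { [] _ → refl }
  }
  where fill = acyclic-fill (cone-acyclic {K = K} v closed)

δ : Subset m → Ch m
δ []          []          = 1ℤ
δ (true ∷ t)  (true ∷ s)  = δ t s
δ (false ∷ t) (false ∷ s) = δ t s
δ (true ∷ t)  (false ∷ s) = 0ℤ
δ (false ∷ t) (true ∷ s)  = 0ℤ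

δ-refl : (s : Subset m) → δ s s ≡ 1ℤ
δ-refl []          = refl
δ-refl (true ∷ s)  = δ-refl s
δ-refl (false ∷ s) = δ-refl s

δ-≢ : (t s : Subset m) → t ≢ s → δ t s ≡ 0ℤ
δ-≢ []          []          ne = ⊥-elim (ne refl)
δ-≢ (true ∷ t)  (true ∷ s)  ne = δ-≢ t s (ne ∘ cong (true ∷_))
δ-≢ (false ∷ t) (false ∷ s) ne = δ-≢ t s (ne ∘ cong (false ∷_))
δ-≢ (true ∷ t)  (false ∷ s) ne = refl
δ-≢ (false ∷ t) (true ∷ s)  ne = refl

δ-supp : (t s : Subset m) → δ t s ≢ 0ℤ → t ≡ s
δ-supp t s ne = decidable-stable (Vec.≡-dec Data.Bool._≟_ t s) (λ t≢s → ne (δ-≢ t s t≢s))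

-- The complex with the empty face only, a sphere of dimension -1: the start of the induction for
-- the independence complex.
point-wedge : ∀ {K : Cx m} t → K t → (∀ s → K s → s ≡ t) → ∣ t ∣ ≡ 0 → Wedge K 0 1
point-wedge {K = K} t Kt only size = record
  { dim     = λ s h → subst (λ x → ∣ x ∣ ≤ 0) (sym (only s h)) (ℕ.≤-reflexive size)
  ; acyclic = λ j ne c (h , z) → 0ᶜ , (λ s ne → ⊥-elim (ne refl)) ,
      λ s → trans (bd-0 s) (sym (decidable-stable (_ ℤ.≟ _) λ nz →
        ne (trans (sym (proj₂ (h s nz))) (trans (cong ∣_∣ (only s (proj₁ (h s nz)))) size))))
  ; basis   = δ t ∷ []
  ; cycles  = (supp , λ s → decidable-stable (_ ℤ.≟ _) λ ne → let (v , s∌v , ne₁) = bd-supp (δ t) s ne in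
                 ℕ.1+n≢0 (trans (sym (∣insert∣ v s s∌v)) (proj₂ (supp _ ne₁)))) ∷ []
  ; span    = λ c (h , z) → (c t ∷ []) , λ s → trans (ℤ.+-identityʳ _) (coef c h s)
  ; independent   = λ { (a ∷ []) eq → cong (_∷ []) (trans (sym (ℤ.*-identityʳ a))
                (trans (cong (a *_) (sym (δ-refl t))) (trans (sym (ℤ.+-identityʳ _)) (eq t)))) }
  }
  where
  supp : Supp K 0 (δ t)
  supp s ne with refl ← δ-supp t s ne = Kt , size
  coef : ∀ c → Supp K 0 c → ∀ s → c t * δ t s ≡ c s
  coef c h s with Vec.≡-dec Data.Bool._≟_ t s
  ... | yes refl = trans (cong (c t *_) (δ-refl t)) (ℤ.*-identityʳ (c t))
  ... | no t≢s   = trans (cong (c t *_) (δ-≢ t s t≢s)) (trans (ℤ.*-zeroʳ (c t))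
                     (sym (decidable-stable (_ ℤ.≟ _) λ ne → t≢s (sym (only s (proj₁ (h s ne)))))))

module _ {m : ℕ} {v : Fin m} {K K₀ K₁ : Cx m} (sp : Split v K K₀ K₁) where
  open Split sp

  On-K₀ : ∀ {j} {c : Ch m} → Supp K j c → link v c ≗ 0ᶜ → Supp K₀ j c
  On-K₀ {c = c} h eq = Supp-≗ (λ s → trans (cong (λ x → c s - x) (cone-link-0 s)) (lem (c s))) (Supp-remainder sp h)
    where
    lem : ∀ x → x - 0ℤ ≡ x
    lem = solve-∀
    cone-link-0 : cone v (link v c) ≗ 0ᶜ
    cone-link-0 s with lookup s v in e
    ... | false = cone-link-∌ v c s e
    ... | true  = decidable-stable (_ ℤ.≟ _) λ ne → let (_ , ne₁) = cone-supp v (link v c) s ne in ne₁ (eq _)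

  -- The cycle v * z - f of K, where f fills z in the deletion.
  lift-cycle : ∀ {d} → (∀ c → IsCyc K₀ d c → ∃ λ b → Supp K₀ (suc d) b × bd b ≗ c) →
    ∀ z → IsCyc K₁ d z → ∃ λ c → IsCyc K (suc d) c × link v c ≗ z
  lift-cycle {d} fill z (hz , bz) with f , hf , eq ← fill z (Supp-⊆ link⊆del hz , bz) =
    cone v z +[ -1ℤ ] f ,
    (Supp-lin {c = cone v z} -1ℤ (Supp-cone sp hz) (Supp-⊆ (λ s h → proj₁ (del⇐ s h)) hf) ,
     λ s → trans (bd-lin (cone v z) -1ℤ f s) (trans (cong₂ (λ x y → x + -1ℤ * y) (bd-cycle-cone v z bz s) (eq s)) (lem₁ (z s)))) ,
    λ s → trans (link-lin v (cone v z) -1ℤ f s)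
            (trans (cong₂ (λ x y → x + -1ℤ * y) (link-cone v z s) (K₀∌v sp (λ t ne → proj₁ (hf t ne)) s))
              (trans (cong (λ x → z s - x + -1ℤ * 0ℤ) (cone-link-0 s)) (lem₂ (z s))))
    where
    lem₁ : ∀ x → x + -1ℤ * x ≡ 0ℤ
    lem₁ = solve-∀
    lem₂ : ∀ x → x - 0ℤ + -1ℤ * 0ℤ ≡ x
    lem₂ = solve-∀
    cone-link-0 : cone v (link v z) ≗ 0ᶜ
    cone-link-0 s with lookup s v in e
    ... | false = cone-link-∌ v z s e
    ... | true  = decidable-stable (_ ℤ.≟ _) λ ne → let (_ , ne₁) = cone-supp v (link v z) s ne in
                    ne₁ (K₀∌v sp (λ t n → link⊆del t (proj₁ (hz t n))) _)

  lift-cycles : ∀ {d k} → (∀ c → IsCyc K₀ d c → ∃ λ b → Supp K₀ (suc d) b × bd b ≗ c) →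
    (zs : Vec (Ch m) k) → All (IsCyc K₁ d) zs →
    ∃ λ (cs : Vec (Ch m) k) → All (IsCyc K (suc d)) cs × (∀ w → link v (lin w cs) ≗ lin w zs)
  lift-cycles fill []       []       = [] , [] , λ { [] → link-0 v }
  lift-cycles fill (z ∷ zs) (h ∷ hs)
    with c , hc , ec ← lift-cycle fill z h
    with cs , hcs , ecs ← lift-cycles fill zs hs
    = c ∷ cs , hc ∷ hcs , λ { (a ∷ w) s →
        trans (link-cong v (λ t → sym (lin-step a w c cs t)) s)
       (trans (link-lin v (lin w cs) a c s)
       (trans (cong₂ (λ x y → x + a * y) (ecs w s) (ec s)) (lin-step a w z zs s))) }

  -- The long exact sequence of a vertex. As the deletion has no homology in degree `d`, every cycle
  -- of the link lifts to `K`, and the top cycles of `K` are freely generated by those of the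
  -- deletion together with these lifts.
  Wedge-split : ∀ {d k₀ k₁} → Wedge K₀ (suc d) k₀ → Wedge K₁ d k₁ → Wedge K (suc d) (k₀ ℕ.+ k₁)
  Wedge-split {d} {k₀} {k₁} w₀ w₁ = record
    { dim     = dim
    ; acyclic = acyclic
    ; basis   = W₀.basis ++ᵛ cs
    ; cycles  = All.++⁺ (All.map (IsCyc-⊆ (λ s h → proj₁ (del⇐ s h))) W₀.cycles) (proj₁ (proj₂ lifted))
    ; span    = span
    ; independent   = independent
    }
    where
    module W₀ = Wedge w₀
    module W₁ = Wedge w₁
    lifted = lift-cycles (W₀.acyclic d (ℕ.<⇒≢ ℕ.≤-refl)) W₁.basis W₁.cycles
    cs = proj₁ lifted
    linked = proj₂ (proj₂ lifted)
    dim : ∀ s → K s → ∣ s ∣ ≤ suc d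
    dim s h with lookup s v in e
    ... | false = W₀.dim s (del⇒ s h e)
    ... | true  = subst (_≤ suc d) (sym (∣remove∣ v s e)) (s≤s (W₁.dim _
                    (link⇒ _ (remove-∌ v s) (subst K (sym (insert-remove v s e)) h))))
    acyclic : ∀ j → j ≢ suc d → ∀ c → IsCyc K j c → ∃ λ b → Supp K (suc j) b × bd b ≗ c
    acyclic j ne c (hc , bc)
      -- First the part of the cycle through `v` is filled in the link, then what remains is filled
      -- in the deletion.
      with b₁ , h₁ , e₁ ← link-filling sp j (λ { i refl c hc bc → W₁.acyclic i (ne ∘ cong suc) c (hc , bc) }) c hc (0-On bc)
      with b₀ , h₀ , e₀ ← W₀.acyclic j ne (λ s → c s + bd (cone v b₁) s)
             (push sp hc h₁ e₁ , λ s → trans (bd-absorb c (cone v b₁) s) (bc s))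
      = b₀ +[ -1ℤ ] cone v b₁ ,
        Supp-lin {c = b₀} -1ℤ (Supp-⊆ (λ s h → proj₁ (del⇐ s h)) h₀) (Supp-cone sp h₁) ,
        λ s → trans (bd-lin b₀ -1ℤ (cone v b₁) s) (trans (cong (_+ -1ℤ * bd (cone v b₁) s) (e₀ s)) (lem (c s) (bd (cone v b₁) s)))
      where
      lem : ∀ x y → x + y + -1ℤ * y ≡ x
      lem = solve-∀
    x-x : ∀ x → x + -1ℤ * x ≡ 0ℤ
    x-x = solve-∀
    span : ∀ c → IsCyc K (suc d) c → ∃ λ w → lin w (W₀.basis ++ᵛ cs) ≗ c
    span c (hc , bc)
      with w₁ , e₁ ← W₁.span (link v c) (Supp-link sp hc , link-cycle sp (0-On bc))
      with hc′ , bc′ ← IsCyc-lin -1ℤ (hc , bc) (lin-cyc w₁ (proj₁ (proj₂ lifted)))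
      with w₀ , e₀ ← W₀.span (c +[ -1ℤ ] lin w₁ cs) (On-K₀ hc′ (λ s →
             trans (link-lin v c -1ℤ (lin w₁ cs) s)
            (trans (cong (λ x → link v c s + -1ℤ * x) (trans (linked w₁ s) (e₁ s))) (x-x (link v c s)))) , bc′)
      = w₀ ++ᵛ w₁ , λ s → trans (lin-++ w₀ w₁ W₀.basis cs s) (trans (cong (_+ lin w₁ cs s) (e₀ s)) (lem (c s) (lin w₁ cs s)))
      where
      lem : ∀ x y → x + -1ℤ * y + y ≡ x
      lem = solve-∀
    independent : ∀ w → lin w (W₀.basis ++ᵛ cs) ≗ 0ᶜ → w ≡ replicate (k₀ ℕ.+ k₁) 0ℤ
    independent w eq with w₀ , w₁ , refl ← Vec.splitAt k₀ w = trans (cong₂ _++ᵛ_ w₀≡0 w₁≡0) (sym (replicate-++ k₀ k₁))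
      where
      sum≡0 : ∀ s → lin w₀ W₀.basis s + lin w₁ cs s ≡ 0ℤ
      sum≡0 s = trans (sym (lin-++ w₀ w₁ W₀.basis cs s)) (eq s)
      lin₀-cyc = lin-cyc w₀ W₀.cycles
      -- Taking links kills the generators from the deletion and turns the lifts back into the basis
      -- of the link.
      w₁≡0 : w₁ ≡ replicate k₁ 0ℤ
      w₁≡0 = W₁.independent w₁ λ s → trans (sym (linked w₁ s))
        (trans (sym (trans (cong (_+ link v (lin w₁ cs) s) (K₀∌v sp (λ t ne → proj₁ (proj₁ lin₀-cyc t ne)) s)) (ℤ.+-identityˡ _)))
        (trans (sym (link-+ v (lin w₀ W₀.basis) (lin w₁ cs) s)) (trans (link-cong v sum≡0 s) (link-0 v s))))
      w₀≡0 : w₀ ≡ replicate k₀ 0ℤ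
      w₀≡0 = W₀.independent w₀ λ s → trans (sym (trans (cong (_+_ (lin w₀ W₀.basis s))
        (trans (cong (λ u → lin u cs s) w₁≡0) (lin-0 cs s))) (ℤ.+-identityʳ _))) (sum≡0 s)

-- Reflection of the boolean definitions

infix 4 _∋_ _⊑_

_∋_ : Subset n → Fin n → Set
S ∋ e = lookup S e ≡ true

-- A record, so that both sets can be inferred from a proof; a bare function type would hide them
-- behind `lookup`.
record _⊑_ {n : ℕ} (A B : Subset n) : Set where
  constructor sub
  field at : ∀ e → A ∋ e → B ∋ e
open _⊑_ public

∋∌-⊥ : {b : Bool} {C : Set} → b ≡ true → b ≡ false → C
∋∌-⊥ refl ()

¬∋⇒∌ : {b : Bool} → b ≢ true → b ≡ false
¬∋⇒∌ {true}  h = ⊥-elim (h refl)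
¬∋⇒∌ {false} h = refl

∧-true : ∀ {a b} → a ∧ b ≡ true → a ≡ true × b ≡ true
∧-true {true} {true} _ = refl , refl

true-∧ : ∀ {a b} → a ≡ true → b ≡ true → a ∧ b ≡ true
true-∧ refl refl = refl

not-true : ∀ {a} → not a ≡ true → a ≡ false
not-true {false} _ = refl

true-not : ∀ {a} → a ≡ false → not a ≡ true
true-not refl = refl

impl-true : ∀ {a b} → not a ∨ b ≡ true → a ≡ true → b ≡ true
impl-true h refl = h

true-impl : ∀ {a b} → (a ≡ true → b ≡ true) → not a ∨ b ≡ true
true-impl {false} h = refl
true-impl {true}  h = h refl

all-true : ∀ {A : Set} (p : A → Bool) xs → all p xs ≡ true → ∀ {x} → x ∈ xs → p x ≡ true
all-true p (x ∷ xs) h (here refl) = proj₁ (∧-true h)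
all-true p (x ∷ xs) h (there i)   = all-true p xs (proj₂ (∧-true {p x} h)) i

true-all : ∀ {A : Set} (p : A → Bool) xs → (∀ {x} → x ∈ xs → p x ≡ true) → all p xs ≡ true
true-all p []       h = refl
true-all p (x ∷ xs) h = true-∧ (h (here refl)) (true-all p xs (h ∘ there))

any-true : ∀ {A : Set} (p : A → Bool) xs → any p xs ≡ true → ∃ λ x → p x ≡ true
any-true p (x ∷ xs) h with p x in eq
... | true  = x , eq
... | false = any-true p xs h

true-any : ∀ {A : Set} (p : A → Bool) xs {x} → x ∈ xs → p x ≡ true → any p xs ≡ true
true-any p (x ∷ xs) (here refl) h = cong (_∨ any p xs) h
true-any p (x ∷ xs) (there i)   h with p x
... | true  = refl
... | false = true-any p xs i h

allᶠ-true : (p : Fin n → Bool) → allᶠ p ≡ true → ∀ e → p e ≡ true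
allᶠ-true p h e = all-true p (allFin _) h (∈-allFin e)

true-allᶠ : (p : Fin n → Bool) → (∀ e → p e ≡ true) → allᶠ p ≡ true
true-allᶠ p h = true-all p (allFin _) (λ {e} _ → h e)

∈-subsets : (s : Subset n) → s ∈ subsets n
∈-subsets []                = here refl
∈-subsets {suc n} (b ∷ s)   = go (subsets n) b (∈-subsets s)
  where
  go : ∀ xs b → s ∈ xs → (b ∷ s) ∈ concatMap (λ s → (true ∷ s) ∷ (false ∷ s) ∷ []) xs
  go (x ∷ xs) true  (here refl) = here refl
  go (x ∷ xs) false (here refl) = there (here refl)
  go (x ∷ xs) b     (there i)   = there (there (go xs b i))

⊆ᵇ⇒⊑ : {A B : Subset n} → (A ⊆ᵇ B) ≡ true → A ⊑ B
⊆ᵇ⇒⊑ h = sub λ e → impl-true (allᶠ-true _ h e)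

⊑⇒⊆ᵇ : {A B : Subset n} → A ⊑ B → (A ⊆ᵇ B) ≡ true
⊑⇒⊆ᵇ h = true-allᶠ _ (λ e → true-impl (at h e))

-- Finite sets

⊑-refl : {A : Subset n} → A ⊑ A
⊑-refl = sub λ _ h → h

⊑-tail : ∀ {A B : Subset n} {a b} → (a ∷ A) ⊑ (b ∷ B) → A ⊑ B
⊑-tail f = sub λ e → at f (suc e)

⊑-antisym : {A B : Subset n} → A ⊑ B → B ⊑ A → A ≡ B
⊑-antisym {A = []}        {[]}        f g = refl
⊑-antisym {A = true ∷ A}  {b ∷ B}     f g = cong₂ _∷_ (sym (at f zero refl)) (⊑-antisym (⊑-tail f) (⊑-tail g))
⊑-antisym {A = false ∷ A} {true ∷ B}  f g = cong₂ _∷_ (at g zero refl) (⊑-antisym (⊑-tail f) (⊑-tail g))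
⊑-antisym {A = false ∷ A} {false ∷ B} f g = cong₂ _∷_ refl (⊑-antisym (⊑-tail f) (⊑-tail g))

⊑-trans : {A B C : Subset n} → A ⊑ B → B ⊑ C → A ⊑ C
⊑-trans f g = sub λ e h → at g e (at f e h)

eqᵇ⇒≡ : {A B : Subset n} → eqᵇ A B ≡ true → A ≡ B
eqᵇ⇒≡ {A = A} {B} h = ⊑-antisym (⊆ᵇ⇒⊑ {A = A} (proj₁ (∧-true {A ⊆ᵇ B} h))) (⊆ᵇ⇒⊑ {A = B} (proj₂ (∧-true {A ⊆ᵇ B} h)))

eqᵇ-refl : (A : Subset n) → eqᵇ A A ≡ true
eqᵇ-refl A = true-∧ {A ⊆ᵇ A} (⊑⇒⊆ᵇ {A = A} ⊑-refl) (⊑⇒⊆ᵇ {A = A} ⊑-refl)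

eqᵇ-≢ : {A B : Subset n} → A ≢ B → eqᵇ A B ≡ false
eqᵇ-≢ ne = ¬∋⇒∌ (λ h → ne (eqᵇ⇒≡ h))

lookup-∪ : ∀ (A B : Subset n) e → lookup (A Sub.∪ B) e ≡ lookup A e ∨ lookup B e
lookup-∪ A B e = Vec.lookup-zipWith _∨_ e A B

lookup-─ : ∀ (A B : Subset n) e → lookup (A Sub.─ B) e ≡ lookup A e ∧ not (lookup B e)
lookup-─ (a ∷ A) (true ∷ B)  zero    = sym (Data.Bool.Properties.∧-zeroʳ a)
lookup-─ (a ∷ A) (false ∷ B) zero    = sym (Data.Bool.Properties.∧-identityʳ a)
lookup-─ (a ∷ A) (b ∷ B)     (suc e) = lookup-─ A B e

∪-∋ : ∀ (A B : Subset n) e → (A Sub.∪ B) ∋ e → A ∋ e ⊎ B ∋ e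
∪-∋ A B e h with lookup A e | lookup B e | trans (sym (lookup-∪ A B e)) h
... | true  | _    | _ = inj₁ refl
... | false | true | _ = inj₂ refl

∪-∋ˡ : ∀ (A B : Subset n) e → A ∋ e → (A Sub.∪ B) ∋ e
∪-∋ˡ A B e h = trans (lookup-∪ A B e) (cong (_∨ lookup B e) h)

∪-∋ʳ : ∀ (A B : Subset n) e → B ∋ e → (A Sub.∪ B) ∋ e
∪-∋ʳ A B e h = trans (lookup-∪ A B e) (trans (cong (lookup A e ∨_) h) (Data.Bool.Properties.∨-zeroʳ _))

─-∋ : ∀ (A B : Subset n) e → (A Sub.─ B) ∋ e → A ∋ e × B ∌ e
─-∋ A B e h with a , b ← ∧-true {lookup A e} (trans (sym (lookup-─ A B e)) h) = a , not-true b

∋-─ : ∀ (A B : Subset n) e → A ∋ e → B ∌ e → (A Sub.─ B) ∋ e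
∋-─ A B e a b = trans (lookup-─ A B e) (true-∧ a (true-not b))

∪⁅⁆≡insert : ∀ (A : Subset n) e → A Sub.∪ Sub.⁅ e ⁆ ≡ A [ e ]≔ true
∪⁅⁆≡insert (a ∷ A) zero    = cong₂ _∷_ (Data.Bool.Properties.∨-zeroʳ a) (Subset.∪-identityʳ A)
∪⁅⁆≡insert (a ∷ A) (suc e) = cong₂ _∷_ (Data.Bool.Properties.∨-identityʳ a) (∪⁅⁆≡insert A e)

⊥-∌ : (e : Fin n) → Sub.⊥ ∌ e
⊥-∌ e = Vec.lookup-replicate e false

insert-⊒ : ∀ (A : Subset n) e → A ⊑ A [ e ]≔ true
insert-⊒ A e = sub go
  where
  go : ∀ x → A ∋ x → A [ e ]≔ true ∋ x
  go x h with x Fin.≟ e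
  ... | yes refl = insert-∋ x A
  ... | no x≢e   = trans (Vec.lookup∘updateAt′ x e x≢e A) h

insert-≢ : ∀ (A : Subset n) {e x} b → x ≢ e → lookup (A [ e ]≔ b) x ≡ lookup A x
insert-≢ A {e} {x} b x≢e = Vec.lookup∘updateAt′ x e x≢e A

∋-insert : ∀ (A : Subset n) e x → A [ e ]≔ true ∋ x → x ≡ e ⊎ A ∋ x
∋-insert A e x h with x Fin.≟ e
... | yes p  = inj₁ p
... | no x≢e = inj₂ (trans (sym (insert-≢ A true x≢e)) h)

∋-remove : ∀ (A : Subset n) e x → A [ e ]≔ false ∋ x → x ≢ e × A ∋ x
∋-remove A e x h with x Fin.≟ e
... | yes refl = ∋∌-⊥ h (remove-∌ e A)
... | no x≢e   = x≢e , trans (sym (insert-≢ A false x≢e)) h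

remove-∋ : ∀ (A : Subset n) e x → x ≢ e → A ∋ x → A [ e ]≔ false ∋ x
remove-∋ A e x x≢e h = trans (insert-≢ A false x≢e) h

insert-⊑ : ∀ {A B : Subset n} {e} → A ⊑ B → B ∋ e → A [ e ]≔ true ⊑ B
insert-⊑ {A = A} {B} {e} f h = sub go
  where
  go : ∀ x → A [ e ]≔ true ∋ x → B ∋ x
  go x hx with ∋-insert A e x hx
  ... | inj₁ refl = h
  ... | inj₂ hA   = at f x hA

insert-mono : ∀ {A B : Subset n} e → A ⊑ B → A [ e ]≔ true ⊑ B [ e ]≔ true
insert-mono {A = A} {B} e f = insert-⊑ (⊑-trans f (insert-⊒ B e)) (insert-∋ e B)

∣∣-mono : {A B : Subset n} → A ⊑ B → ∣ A ∣ ≤ ∣ B ∣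
∣∣-mono {A = []}        {[]}        f = z≤n
∣∣-mono {A = true ∷ A}  {true ∷ B}  f = s≤s (∣∣-mono (⊑-tail f))
∣∣-mono {A = true ∷ A}  {false ∷ B} f with () ← at f zero refl
∣∣-mono {A = false ∷ A} {true ∷ B}  f = ℕ.m≤n⇒m≤1+n (∣∣-mono (⊑-tail f))
∣∣-mono {A = false ∷ A} {false ∷ B} f = ∣∣-mono (⊑-tail f)

⊑-size-≡ : {A B : Subset n} → A ⊑ B → ∣ B ∣ ≤ ∣ A ∣ → A ≡ B
⊑-size-≡ {A = A} {B} f le = ⊑-antisym f (sub g)
  where
  g : ∀ e → B ∋ e → A ∋ e
  g e h with lookup A e in eq
  ... | true  = refl
  ... | false = ⊥-elim (ℕ.<⇒≱ (ℕ.≤-<-trans (∣∣-mono A⊑B-e)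
                  (subst (∣ B [ e ]≔ false ∣ <_) (sym (∣remove∣ e B h)) ℕ.≤-refl)) le)
    where
    A⊑B-e : A ⊑ B [ e ]≔ false
    A⊑B-e = sub λ x hx → remove-∋ B e x (λ { refl → ∋∌-⊥ hx eq }) (at f x hx)

∣∪∣-disjoint : (A B : Subset n) → (∀ e → A ∋ e → B ∌ e) → ∣ A Sub.∪ B ∣ ≡ ∣ A ∣ ℕ.+ ∣ B ∣
∣∪∣-disjoint []          []          d = refl
∣∪∣-disjoint (true ∷ A)  (true ∷ B)  d with () ← d zero refl
∣∪∣-disjoint (true ∷ A)  (false ∷ B) d = cong suc (∣∪∣-disjoint A B (λ e → d (suc e)))
∣∪∣-disjoint (false ∷ A) (true ∷ B)  d = trans (cong suc (∣∪∣-disjoint A B (λ e → d (suc e)))) (sym (ℕ.+-suc _ _))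
∣∪∣-disjoint (false ∷ A) (false ∷ B) d = ∣∪∣-disjoint A B (λ e → d (suc e))

-- Bases and ranks

private
  step : ∀ {n} → IndepSystem n → Subset n → Subset n → ℕ → ℕ
  step N X I r = if (I ⊆ᵇ X) ∧ indep N I then ∣ I ∣ ℕ.⊔ r else r

  step-≥ : ∀ {n} (N : IndepSystem n) X I r → r ≤ step N X I r
  step-≥ N X I r with (I ⊆ᵇ X) ∧ indep N I
  ... | true  = ℕ.m≤n⊔m ∣ I ∣ r
  ... | false = ℕ.≤-refl

  fold-ub : ∀ {n} (N : IndepSystem n) X xs {I} → I ∈ xs → I ⊑ X → indep N I ≡ true → ∣ I ∣ ≤ foldr (step N X) 0 xs
  fold-ub N X (I ∷ xs) (here refl) f h rewrite true-∧ {I ⊆ᵇ X} (⊑⇒⊆ᵇ f) h = ℕ.m≤m⊔n ∣ I ∣ _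
  fold-ub N X (J ∷ xs) (there i)   f h = ℕ.≤-trans (fold-ub N X xs i f h) (step-≥ N X J _)

  fold-attained : ∀ {n} (N : IndepSystem n) → indep N Sub.⊥ ≡ true → ∀ X xs →
    ∃ λ I → I ⊑ X × indep N I ≡ true × ∣ I ∣ ≡ foldr (step N X) 0 xs
  fold-attained {n} N h⊥ X [] = Sub.⊥ , (sub λ e h → ∋∌-⊥ h (⊥-∌ e)) , h⊥ , Subset.∣⊥∣≡0 n
  fold-attained N h⊥ X (J ∷ xs) with (J ⊆ᵇ X) ∧ indep N J in eq
  ... | false = fold-attained N h⊥ X xs
  ... | true  with ℕ.⊔-sel ∣ J ∣ (foldr (step N X) 0 xs) | fold-attained N h⊥ X xs
  ...   | inj₁ p | _ = J , ⊆ᵇ⇒⊑ (proj₁ (∧-true eq)) , proj₂ (∧-true {J ⊆ᵇ X} eq) , sym p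
  ...   | inj₂ p | I , a , b , c = I , a , b , trans c (sym p)

size≤rank : ∀ (N : IndepSystem n) {X I} → I ⊑ X → indep N I ≡ true → ∣ I ∣ ≤ rank N X
size≤rank {n} N {X} f h = fold-ub N X (subsets n) (∈-subsets _) f h

size≡rank : (N : IndepSystem n) → indep N Sub.⊥ ≡ true → ∀ X →
  ∃ λ I → I ⊑ X × indep N I ≡ true × ∣ I ∣ ≡ rank N X
size≡rank {n} N h⊥ X = fold-attained N h⊥ X (subsets n)

module Matroid {n : ℕ} (N : IndepSystem n) (mat : IsMatroid N) where
  open IsMatroid mat

  Ind : Subset n → Set
  Ind I = indep N I ≡ true

  ind-ground : ∀ {I} → Ind I → I ⊑ ground N
  ind-ground h = ⊆ᵇ⇒⊑ (indep-ground _ h)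

  ind-⊑ : ∀ {I J} → J ⊑ I → Ind I → Ind J
  ind-⊑ f = indep-down _ _ (⊑⇒⊆ᵇ f)

  augment : ∀ {I J} → Ind I → Ind J → ∣ I ∣ < ∣ J ∣ → ∃ λ e → J ∋ e × I ∌ e × Ind (I [ e ]≔ true)
  augment {I} hI hJ lt with e , a , b , c ← indep-aug _ _ hI hJ lt =
    e , a , b , subst Ind (∪⁅⁆≡insert I e) c

  -- Iterated augmentation, by recursion on the number of elements still missing. That the new
  -- elements come from `J` is what lets it serve as a basis exchange.
  extend : ∀ {I J} → Ind I → Ind J → ∣ I ∣ ≤ ∣ J ∣ →
    ∃ λ K → Ind K × I ⊑ K × (∀ e → K ∋ e → I ∋ e ⊎ J ∋ e) × ∣ K ∣ ≡ ∣ J ∣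
  extend {I} {J} hI hJ le = go (∣ J ∣ ℕ.∸ ∣ I ∣) I hI (ℕ.m∸n+n≡m le)
    where
    go : ∀ k I → Ind I → k ℕ.+ ∣ I ∣ ≡ ∣ J ∣ →
      ∃ λ K → Ind K × I ⊑ K × (∀ e → K ∋ e → I ∋ e ⊎ J ∋ e) × ∣ K ∣ ≡ ∣ J ∣
    go zero    I hI eq = I , hI , ⊑-refl , (λ _ → inj₁) , eq
    go (suc k) I hI eq
      with e , Je , Ie , hIe ← augment hI hJ (subst (∣ I ∣ <_) eq (s≤s (ℕ.m≤n+m _ k)))
      with K , hK , I⊑K , sup , sz ← go k (I [ e ]≔ true) hIe
             (trans (cong (k ℕ.+_) (∣insert∣ e I Ie)) (trans (ℕ.+-suc k _) eq))
      = K , hK , ⊑-trans (insert-⊒ I e) I⊑K , sup′ , sz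
      where
      sup′ : ∀ x → K ∋ x → I ∋ x ⊎ J ∋ x
      sup′ x hx with sup x hx
      ... | inj₂ h = inj₂ h
      ... | inj₁ h with ∋-insert I e x h
      ...   | inj₁ refl = inj₂ Je
      ...   | inj₂ h′   = inj₁ h′

  rank-ub : ∀ {X I} → I ⊑ X → Ind I → ∣ I ∣ ≤ rank N X
  rank-ub = size≤rank N

  rank-attained : ∀ X → ∃ λ I → I ⊑ X × Ind I × ∣ I ∣ ≡ rank N X
  rank-attained = size≡rank N indep-empty

  rank-≤ : ∀ {X k} → (∀ I → I ⊑ X → Ind I → ∣ I ∣ ≤ k) → rank N X ≤ k
  rank-≤ {X} h with I , a , b , c ← rank-attained X = subst (_≤ _) c (h I a b)

  rank-mono : ∀ {X Y} → X ⊑ Y → rank N X ≤ rank N Y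
  rank-mono f = rank-≤ (λ I g h → rank-ub (⊑-trans g f) h)

  rank-ind : ∀ {I} → Ind I → rank N I ≡ ∣ I ∣
  rank-ind {I} h = ℕ.≤-antisym (rank-≤ {I} (λ J f _ → ∣∣-mono f)) (rank-ub {I} ⊑-refl h)

  rank-insert : ∀ X e → rank N (X [ e ]≔ true) ≤ suc (rank N X)
  rank-insert X e = rank-≤ bound
    where
    bound : ∀ I → I ⊑ X [ e ]≔ true → Ind I → ∣ I ∣ ≤ suc (rank N X)
    bound I f h with lookup I e in eq
    ... | false = ℕ.m≤n⇒m≤1+n (rank-ub {X} (sub λ x hx → drop x hx (at f x hx)) h)
      where
      drop : ∀ x → I ∋ x → X [ e ]≔ true ∋ x → X ∋ x
      drop x hx g with ∋-insert X e x g
      ... | inj₁ refl = ∋∌-⊥ hx eq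
      ... | inj₂ p    = p
    ... | true  = subst (_≤ _) (sym (∣remove∣ e I eq)) (s≤s (rank-ub {X} {I [ e ]≔ false} (sub drop) (ind-⊑ (sub λ x hx → proj₂ (∋-remove I e x hx)) h)))
      where
      drop : ∀ x → I [ e ]≔ false ∋ x → X ∋ x
      drop x hx with x≢e , Ix ← ∋-remove I e x hx with ∋-insert X e x (at f x Ix)
      ... | inj₁ p = ⊥-elim (x≢e p)
      ... | inj₂ p = p

  -- Closure is monotone. A maximal independent subset of `X` is extended to one of `Y`; were the
  -- rank to rise, some element would augment the latter, and it could only be `e`, which would then
  -- augment the former inside `X ∪ e`.
  rank-insert-≡ : ∀ {X Y} e → X ⊑ Y → rank N (X [ e ]≔ true) ≡ rank N X → rank N (Y [ e ]≔ true) ≡ rank N Y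
  rank-insert-≡ {X} {Y} e f eq = ℕ.≤-antisym (ℕ.≮⇒≥ absurd) (rank-mono (insert-⊒ Y e))
    where
    absurd : ¬ rank N Y < rank N (Y [ e ]≔ true)
    absurd lt
      with I , I⊑X , hI , sI ← rank-attained X
      with J , J⊑Y , hJ , sJ ← rank-attained Y
      with K , hK , I⊑K , K⊑ , sK ← extend hI hJ (subst₂ _≤_ (sym sI) (sym sJ) (rank-mono f))
      with L , L⊑ , hL , sL ← rank-attained (Y [ e ]≔ true)
      with x , Lx , Kx , hKx ← augment hK hL (subst₂ _<_ (sym (trans sK sJ)) (sym sL) lt)
      with ∋-insert Y e x (at L⊑ x Lx)
    ... | inj₂ Yx = ℕ.<-irrefl (trans sK sJ) (subst (_≤ rank N Y) (∣insert∣ x K Kx)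
                      (rank-ub {Y} (insert-⊑ (sub λ y Ky → K⊑Y y (K⊑ y Ky)) Yx) hKx))
      where
      K⊑Y : ∀ y → I ∋ y ⊎ J ∋ y → Y ∋ y
      K⊑Y y (inj₁ h) = at f y (at I⊑X y h)
      K⊑Y y (inj₂ h) = at J⊑Y y h
    ... | inj₁ refl = ℕ.<-irrefl sI (subst₂ _≤_ (∣insert∣ x I I∌x) eq
                        (rank-ub (insert-mono x I⊑X) (ind-⊑ (insert-mono x I⊑K) hKx)))
      where
      I∌x : I ∌ x
      I∌x = ¬∋⇒∌ (λ h → ∋∌-⊥ (at I⊑K x h) Kx)

  -- Maximality is replaced by size, which augmentation shows to be equivalent.
  Basis : Subset n → Set
  Basis B = Ind B × ∣ B ∣ ≡ rank N (ground N)

  isBasis⇒Basis : ∀ {B} → isBasis N B ≡ true → Basis B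
  isBasis⇒Basis {B} h with hB , mx ← ∧-true {indep N B} h
    with J , J⊑ , hJ , sJ ← rank-attained (ground N)
    = hB , ℕ.≤-antisym (rank-ub (ind-ground hB) hB) (subst (_≤ ∣ B ∣) sJ (ℕ.≮⇒≥ absurd))
    where
    absurd : ¬ ∣ B ∣ < ∣ J ∣
    absurd lt with e , Je , Be , hBe ← augment hB hJ lt =
      ∋∌-⊥ (subst Ind (sym (∪⁅⁆≡insert B e)) hBe)
        (not-true (impl-true (allᶠ-true _ mx e) (true-∧ {lookup (ground N) e} (at J⊑ e Je) (true-not Be))))

  Basis⇒isBasis : ∀ {B} → Basis B → isBasis N B ≡ true
  Basis⇒isBasis {B} (hB , sB) = true-∧ hB (true-allᶠ _ (λ e → true-impl (λ h → true-not (¬∋⇒∌ (absurd e h)))))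
    where
    absurd : ∀ e → lookup (ground N) e ∧ not (lookup B e) ≡ true → ¬ Ind (B Sub.∪ Sub.⁅ e ⁆)
    absurd e h hBe with _ , Be ← ∧-true {lookup (ground N) e} h =
      ℕ.<-irrefl sB (subst (_≤ rank N (ground N)) (∣insert∣ e B (not-true Be))
        (rank-ub (ind-ground hBe′) hBe′))
      where hBe′ = subst Ind (∪⁅⁆≡insert B e) hBe

  isBasis? : ∀ B → Dec (Basis B)
  isBasis? B = (indep N B Data.Bool.≟ true) ×-dec (∣ B ∣ ℕ.≟ rank N (ground N))

  basis-⊑-≡ : ∀ {A B} → Basis A → Basis B → A ⊑ B → A ≡ B
  basis-⊑-≡ (_ , sA) (_ , sB) f = ⊑-size-≡ f (ℕ.≤-reflexive (trans sB (sym sA)))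

  Avoids : Subset n → Subset n → Set
  Avoids B Z = ∀ e → Z ∋ e → B ∌ e

  -- These are the independent sets of the dual matroid, with the avoiding basis as witness;
  -- `rank⇒cospan` and `cospan⇒rank` connect them with the rank condition in `dual`.
  Cospan : Subset n → Set
  Cospan Z = ∃ λ B → Basis B × Avoids B Z

  cospan⇒rank : ∀ {Z} → Cospan Z → rank N (ground N Sub.─ Z) ≡ rank N (ground N)
  cospan⇒rank {Z} (B , (hB , sB) , av) = ℕ.≤-antisym (rank-mono {ground N Sub.─ Z} {ground N} (sub λ e h → proj₁ (─-∋ (ground N) Z e h)))
    (subst (_≤ rank N (ground N Sub.─ Z)) sB (rank-ub {ground N Sub.─ Z} (sub λ e h → ∋-─ (ground N) Z e (at (ind-ground hB) e h)
      (¬∋⇒∌ (λ Ze → ∋∌-⊥ h (av e Ze)))) hB))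

  rank⇒cospan : ∀ {Z} → rank N (ground N Sub.─ Z) ≡ rank N (ground N) → Cospan Z
  rank⇒cospan {Z} eq with I , I⊑ , hI , sI ← rank-attained (ground N Sub.─ Z) =
    I , (hI , trans sI eq) , λ e Ze → ¬∋⇒∌ (λ Ie → ∋∌-⊥ Ze (proj₂ (─-∋ (ground N) Z e (at I⊑ e Ie))))

  cospan? : ∀ Z → Dec (Cospan Z)
  cospan? Z with rank N (ground N Sub.─ Z) ℕ.≟ rank N (ground N)
  ... | yes p = yes (rank⇒cospan p)
  ... | no ¬p = no (λ h → ¬p (cospan⇒rank h))

  cospan-⊑ : ∀ {Y Z} → Y ⊑ Z → Cospan Z → Cospan Y
  cospan-⊑ f (B , b , av) = B , b , λ e h → av e (at f e h)

-- The colexicographic order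

data _≺_ : ∀ {n} → Subset n → Subset n → Set where
  head : ∀ {n} {A : Subset n} → (false ∷ A) ≺ (true ∷ A)
  tail : ∀ {n} {A B : Subset n} {a b} → A ≺ B → (a ∷ A) ≺ (b ∷ B)

≺-cmp : (A B : Subset n) → A ≡ B ⊎ A ≺ B ⊎ B ≺ A
≺-cmp []      []      = inj₁ refl
≺-cmp (a ∷ A) (b ∷ B) with ≺-cmp A B
≺-cmp (a ∷ A)     (b ∷ B)      | inj₂ (inj₁ h) = inj₂ (inj₁ (tail h))
≺-cmp (a ∷ A)     (b ∷ B)      | inj₂ (inj₂ h) = inj₂ (inj₂ (tail h))
≺-cmp (true ∷ A)  (true ∷ A)   | inj₁ refl     = inj₁ refl
≺-cmp (false ∷ A) (false ∷ A)  | inj₁ refl     = inj₁ refl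
≺-cmp (true ∷ A)  (false ∷ A)  | inj₁ refl     = inj₂ (inj₂ head)
≺-cmp (false ∷ A) (true ∷ A)   | inj₁ refl     = inj₂ (inj₁ head)

≺-witness : {A B : Subset n} → A ≺ B →
  ∃ λ x → A ∌ x × B ∋ x × (∀ y → x Fin.< y → lookup A y ≡ lookup B y)
≺-witness head     = zero , refl , refl , λ { (suc y) _ → refl }
≺-witness (tail h) with x , a , b , f ← ≺-witness h =
  suc x , a , b , λ { (suc y) lt → f y (ℕ.≤-pred lt) }

≺-intro : ∀ {A B : Subset n} x → A ∌ x → B ∋ x → (∀ y → x Fin.< y → lookup A y ≡ lookup B y) → A ≺ B
≺-intro {A = false ∷ A} {true ∷ B} zero    refl refl f =
  subst (λ C → (false ∷ A) ≺ (true ∷ C)) (⊑-antisym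
    (sub λ e h → trans (sym (f (suc e) (s≤s z≤n))) h) (sub λ e h → trans (f (suc e) (s≤s z≤n)) h)) head
≺-intro {A = a ∷ A}     {b ∷ B}    (suc x) a∌ b∋     f = tail (≺-intro x a∌ b∋ (λ y lt → f (suc y) (s≤s lt)))

card : ℕ → ℕ
card zero    = 1
card (suc n) = card n ℕ.* 2

bit : Bool → Fin 2
bit false = zero
bit true  = suc zero

-- Coordinate 0 is the least significant bit, so the largest element in which two sets differ
-- decides which number is larger, as in the colexicographic order.
code : Subset n → Fin (card n)
code []      = zero
code (a ∷ A) = Fin.combine (code A) (bit a)

code-mono : {A B : Subset n} → A ≺ B → code A Fin.< code B
code-mono (head {A = A}) = subst₂ _<_ (sym (Fin.toℕ-combine (code A) zero)) (sym (Fin.toℕ-combine (code A) (suc zero)))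
  (ℕ.+-monoʳ-< (2 ℕ.* Fin.toℕ (code A)) (s≤s z≤n))
code-mono (tail {a = a} {b} h) = Fin.combine-monoˡ-< (bit a) (bit b) (code-mono h)

code-injective : {A B : Subset n} → code A ≡ code B → A ≡ B
code-injective {A = A} {B} eq with ≺-cmp A B
... | inj₁ p        = p
... | inj₂ (inj₁ h) = ⊥-elim (Fin.<-irrefl eq (code-mono h))
... | inj₂ (inj₂ h) = ⊥-elim (Fin.<-irrefl (sym eq) (code-mono h))

code-surjective : (i : Fin (card n)) → ∃ λ A → code {n} A ≡ i
code-surjective {zero}  zero = [] , refl
code-surjective {suc n} i with j , k , refl ← Fin.combine-surjective {card n} {2} i
  with A , refl ← code-surjective {n} j with k
... | zero     = (false ∷ A) , refl
... | suc zero = (true ∷ A) , refl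

-- Activities, the external order and its maximum

all-false : ∀ {A : Set} (p : A → Bool) xs → all p xs ≡ false → ∃ λ x → p x ≡ false
all-false p (x ∷ xs) h with p x in eq
... | false = x , eq
... | true  = all-false p xs h

maximiser : {A : Set} {P : A → Set} (f : A → ℕ) → (∀ x → Dec (P x)) → (xs : List A) →
  (∀ x → x ∈ xs → ¬ P x) ⊎ (∃ λ x → P x × (∀ y → y ∈ xs → P y → f y ≤ f x))
maximiser f P? []       = inj₁ (λ _ ())
maximiser f P? (x ∷ xs) with P? x | maximiser f P? xs
... | no ¬p | inj₁ none = inj₁ (λ { _ (here refl) → ¬p ; y (there i) → none y i })
... | yes p | inj₁ none = inj₂ (x , p , λ { _ (here refl) _ → ℕ.≤-refl ; y (there i) q → ⊥-elim (none y i q) })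
... | no ¬p | inj₂ (z , q , mx) = inj₂ (z , q , λ { _ (here refl) p → ⊥-elim (¬p p) ; y (there i) r → mx y i r })
... | yes p | inj₂ (z , q , mx) with ℕ.≤-total (f x) (f z)
...   | inj₁ le = inj₂ (z , q , λ { _ (here refl) _ → le ; y (there i) r → mx y i r })
...   | inj₂ ge = inj₂ (x , p , λ { _ (here refl) _ → ℕ.≤-refl ; y (there i) r → ℕ.≤-trans (mx y i r) ge })

T⇒true : ∀ {b} → Data.Bool.T b → b ≡ true
T⇒true {true} _ = refl

above : Fin n → Subset n → Subset n
above e B = Vec.tabulate (λ t → lookup B t ∧ (Fin.toℕ e ℕ.<ᵇ Fin.toℕ t))

above-∋ : ∀ (e : Fin n) B t → above e B ∋ t → B ∋ t × e Fin.< t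
above-∋ e B t h with a , b ← ∧-true {lookup B t} (trans (sym (Vec.lookup∘tabulate _ t)) h) =
  a , ℕ.<ᵇ⇒< _ _ (subst Data.Bool.T (sym b) _)

∋-above : ∀ (e : Fin n) B t → B ∋ t → e Fin.< t → above e B ∋ t
∋-above e B t h lt = trans (Vec.lookup∘tabulate _ t) (true-∧ h (T⇒true (ℕ.<⇒<ᵇ lt)))

≤ᵇ-true : ∀ {a b} → (a ℕ.≤ᵇ b) ≡ true → a ≤ b
≤ᵇ-true h = ℕ.≤ᵇ⇒≤ _ _ (subst Data.Bool.T (sym h) _)

true-≤ᵇ : ∀ {a b} → a ≤ b → (a ℕ.≤ᵇ b) ≡ true
true-≤ᵇ le = T⇒true (ℕ.≤⇒≤ᵇ le)

module Ordered {n : ℕ} (M : IndepSystem n) (full : ground M ≡ ⊤) (mat : IsMatroid M) where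
  open Matroid M mat public

  ⊑-ground : ∀ {A} → A ⊑ ground M
  ⊑-ground = sub λ e _ → trans (cong (λ G → lookup G e) full) (Vec.lookup-replicate e true)

  Circuit : Subset n → Set
  Circuit C = indep M C ≡ false × (∀ D → D ⊑ C → D ≢ C → Ind D)

  circuit-sound : ∀ {C} → isCircuit M C ≡ true → Circuit C
  circuit-sound {C} h with _ , h₁ ← ∧-true {C ⊆ᵇ ground M} h with a , b ← ∧-true {not (indep M C)} h₁ =
    not-true a , λ D f ne → impl-true {(D ⊆ᵇ C) ∧ not (eqᵇ D C)} (all-true _ (subsets n) b (∈-subsets D))
      (true-∧ (⊑⇒⊆ᵇ {A = D} f) (true-not (eqᵇ-≢ ne)))

  circuit-below : ∀ D → indep M D ≡ false → ∃ λ C → C ⊑ D × isCircuit M C ≡ true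
  circuit-below D dep = go (suc ∣ D ∣) D ℕ.≤-refl dep
    where
    go : ∀ k D → ∣ D ∣ < k → indep M D ≡ false → ∃ λ C → C ⊑ D × isCircuit M C ≡ true
    go (suc k) D (s≤s lt) dep
      with all (λ D′ → not ((D′ ⊆ᵇ D) ∧ not (eqᵇ D′ D)) ∨ indep M D′) (subsets n) in eq
    ... | true  = D , ⊑-refl , true-∧ {D ⊆ᵇ ground M} (⊑⇒⊆ᵇ {A = D} ⊑-ground) (true-∧ (true-not dep) eq)
    ... | false with D′ , h ← all-false _ (subsets n) eq
        with (D′ ⊆ᵇ D) ∧ not (eqᵇ D′ D) in eq₁ | h
    ...   | true | dep′ with a , b ← ∧-true {D′ ⊆ᵇ D} eq₁
        with C , f , c ← go k D′ (ℕ.<-≤-trans (ℕ.≰⇒> λ ge → ∋∌-⊥ (trans (cong (eqᵇ D′) (sym (⊑-size-≡ (⊆ᵇ⇒⊑ {A = D′} {D} a) ge))) (eqᵇ-refl D′)) (not-true b)) lt) dep′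
      = C , ⊑-trans f (⊆ᵇ⇒⊑ {A = D′} {D} a) , c

  ActiveVia : Subset n → Fin n → Subset n → Set
  ActiveVia F e C = isCircuit M C ≡ true × C ⊑ F [ e ]≔ true × C ∋ e × (∀ c → C ∋ c → e Fin.≤ c)

  active-sound : ∀ {F e} → isActive M F e ≡ true → ∃ (ActiveVia F e)
  active-sound {F} {e} h with C , h₁ ← any-true _ (subsets n) h
    with a , h₂ ← ∧-true {isCircuit M C} h₁
    with b , h₃ ← ∧-true {C ⊆ᵇ (F Sub.∪ Sub.⁅ e ⁆)} h₂
    with c , d ← ∧-true {lookup C e} h₃
    = C , a , subst (C ⊑_) (∪⁅⁆≡insert F e) (⊆ᵇ⇒⊑ b) , c , λ x hx → ≤ᵇ-true (impl-true (allᶠ-true _ d x) hx)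

  active-complete : ∀ {F e C} → ActiveVia F e C → isActive M F e ≡ true
  active-complete {F} {e} {C} (a , b , c , d) = true-any _ (subsets n) (∈-subsets C)
    (true-∧ a (true-∧ {C ⊆ᵇ (F Sub.∪ Sub.⁅ e ⁆)} (⊑⇒⊆ᵇ (subst (C ⊑_) (sym (∪⁅⁆≡insert F e)) b))
      (true-∧ c (true-allᶠ _ (λ x → true-impl (λ hx → true-≤ᵇ (d x hx)))))))

  active-mono : ∀ {F G e} → F ⊑ G → isActive M F e ≡ true → isActive M G e ≡ true
  active-mono {e = e} f h with C , a , b , c ← active-sound h = active-complete (a , ⊑-trans b (insert-mono e f) , c)

  -- The circuit found in `I ∪ e` has to contain `e`, since `I` is independent, and everything else
  -- in it lies above `e`.
  active-intro : ∀ {F I e} → Ind I → indep M (I [ e ]≔ true) ≡ false → I ⊑ F → (∀ x → I ∋ x → e Fin.< x) →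
    isActive M F e ≡ true
  active-intro {F} {I} {e} hI dep f lt with C , g , c ← circuit-below (I [ e ]≔ true) dep =
    active-complete (c , ⊑-trans g (insert-mono e f) , C∋e , min)
    where
    C∋e : C ∋ e
    C∋e with lookup C e in eq
    ... | true  = refl
    ... | false = ∋∌-⊥ (ind-⊑ (sub drop) hI) (proj₁ (circuit-sound c))
      where
      drop : ∀ x → C ∋ x → I ∋ x
      drop x hx with ∋-insert I e x (at g x hx)
      ... | inj₁ refl = ∋∌-⊥ hx eq
      ... | inj₂ h    = h
    min : ∀ x → C ∋ x → e Fin.≤ x
    min x hx with ∋-insert I e x (at g x hx)
    ... | inj₁ refl = ℕ.≤-refl
    ... | inj₂ h    = ℕ.<⇒≤ (lt x h)

  ext-∋ : ∀ {B e} → Ext M B ∋ e → isActive M B e ≡ true × B ∌ e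
  ext-∋ {B} {e} h with a , b ← ─-∋ (Act M B) B e h = trans (sym (Vec.lookup∘tabulate _ e)) a , b

  ∋-ext : ∀ {B e} → isActive M B e ≡ true → B ∌ e → Ext M B ∋ e
  ∋-ext {B} {e} a b = ∋-─ (Act M B) B e (trans (Vec.lookup∘tabulate _ e) a) b

  IsMax : Subset n → Subset n → Set
  IsMax J B = Basis B × Avoids B J × (∀ A → Basis A → Avoids A J → ¬ (B ≺ A))

  max-basis : ∀ {J} → Cospan J → ∃ (IsMax J)
  max-basis {J} (B₀ , b₀ , av₀) with maximiser (Fin.toℕ ∘ code) dec (subsets n)
    where
    dec : ∀ B → Dec (Basis B × Avoids B J)
    dec B = isBasis? B ×-dec
            Fin.all? (λ e → (lookup J e Data.Bool.≟ true) →-dec (lookup B e Data.Bool.≟ false))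
  ... | inj₁ none = ⊥-elim (none B₀ (∈-subsets B₀) (b₀ , av₀))
  ... | inj₂ (B , (b , av) , mx) = B , b , av , λ A a av′ lt → ℕ.<⇒≱ (code-mono lt) (mx A (∈-subsets A) (a , av′))

  -- Otherwise the part of `B` above `e`, with `e` added, could be completed from `B` to a basis
  -- that still avoids `J` and is colexicographically larger.
  max-dependent : ∀ {J B e} → IsMax J B → B ∌ e → J ∌ e → indep M (above e B [ e ]≔ true) ≡ false
  max-dependent {J} {B} {e} ((hB , sB) , av , mx) Be Je = ¬∋⇒∌ absurd
    where
    I = above e B [ e ]≔ true
    absurd : ¬ Ind I
    absurd hI with K , hK , I⊑K , sup , sK ← extend hI hB (subst (∣ I ∣ ≤_) (sym sB) (rank-ub ⊑-ground hI)) =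
      mx K (hK , trans sK sB) avK (≺-intro e Be (at I⊑K e (insert-∋ e (above e B))) agree)
      where
      K-sup : ∀ x → K ∋ x → x ≡ e ⊎ B ∋ x
      K-sup x hx with sup x hx
      ... | inj₂ h = inj₂ h
      ... | inj₁ h with ∋-insert (above e B) e x h
      ...   | inj₁ p = inj₁ p
      ...   | inj₂ q = inj₂ (proj₁ (above-∋ e B x q))
      avK : Avoids K J
      avK x Jx = ¬∋⇒∌ λ Kx → case K-sup x Kx of λ
        { (inj₁ refl) → ∋∌-⊥ Jx Je ; (inj₂ h) → ∋∌-⊥ h (av x Jx) }
      agree : ∀ y → e Fin.< y → lookup B y ≡ lookup K y
      agree y lt with lookup B y in eq
      ... | true  = sym (at I⊑K y (at (insert-⊒ (above e B) e) y (∋-above e B y eq lt)))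
      ... | false = sym (¬∋⇒∌ λ Ky → case K-sup y Ky of λ
        { (inj₁ refl) → Fin.<-irrefl refl lt ; (inj₂ h) → ∋∌-⊥ h eq })

  max-active : ∀ {J B e} → IsMax J B → B ∌ e → J ∌ e → isActive M B e ≡ true
  max-active {J} {B} {e} m@((hB , _) , _) Be Je = active-intro (ind-⊑ above⊑ hB) (max-dependent {J} m Be Je) above⊑
    (λ x h → proj₂ (above-∋ e B x h))
    where
    above⊑ : above e B ⊑ B
    above⊑ = sub λ x h → proj₁ (above-∋ e B x h)

  -- By `max-active` each element of `A` outside `B` lies in `Ext M B`. So the colexicographic
  -- maximum of the bases avoiding `J` is their maximum for the external order too.
  max-extLeq : ∀ {J B} → IsMax J B → ∀ A → Avoids A J → extLeq M A B ≡ true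
  max-extLeq {J} {B} m A av = ⊑⇒⊆ᵇ {A = A} {B Sub.∪ Ext M B} (sub go)
    where
    go : ∀ e → A ∋ e → (B Sub.∪ Ext M B) ∋ e
    go e h with lookup B e in eq
    ... | true  = ∪-∋ˡ B (Ext M B) e eq
    ... | false = ∪-∋ʳ B (Ext M B) e (∋-ext (max-active {J} m eq (¬∋⇒∌ λ Je → ∋∌-⊥ h (av e Je))) eq)

  abstract
    T : Subset n
    T = topBasis M

    T-∋ : ∀ {e} → T ∋ e → isActive M (ground M) e ≡ false
    T-∋ {e} h = trans (sym (Vec.lookup∘tabulate _ e)) (proj₂ (─-∋ (ground M) (Act M (ground M)) e h))

    ∋-T : ∀ {e} → isActive M (ground M) e ≡ false → T ∋ e
    ∋-T {e} h = ∋-─ (ground M) (Act M (ground M)) e (at (⊑-ground {⊤}) e (Vec.lookup-replicate e true))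
      (trans (Vec.lookup∘tabulate _ e) h)

    T≡topBasis : T ≡ topBasis M
    T≡topBasis = refl

  cospan-⊥ : Cospan Sub.⊥
  cospan-⊥ with I , _ , h , s ← rank-attained (ground M) = I , (h , s) , λ e h′ → ∋∌-⊥ h′ (⊥-∌ e)

  -- If `e` were the minimum of a circuit `C`, exchanging `e` for an element of `C` above it would
  -- give a larger basis. That element is found by extending `C` without `e` to a basis `K` and
  -- augmenting `B` without `e` from `K`.
  max-inactive : ∀ {B e} → IsMax Sub.⊥ B → B ∋ e → isActive M (ground M) e ≡ false
  max-inactive {B} {e} ((hB , sB) , _ , mx) Be = ¬∋⇒∌ absurd
    where
    absurd : isActive M (ground M) e ≢ true
    absurd act
      with C , c , _ , Ce , min ← active-sound {ground M} act
      with depC , proper ← circuit-sound c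
      with hC ← proper (C [ e ]≔ false) (sub λ x h → proj₂ (∋-remove C e x h))
                  (λ eq → ∋∌-⊥ Ce (trans (cong (λ D → lookup D e) (sym eq)) (remove-∌ e C)))
      with K , hK , C⊑K , sup , sK ← extend hC hB (subst (∣ C [ e ]≔ false ∣ ≤_) (sym sB) (rank-ub ⊑-ground hC))
      with b , Kb , B-e∌b , hb ← augment {B [ e ]≔ false} (ind-⊑ (sub λ x h → proj₂ (∋-remove B e x h)) hB) hK
                                   (subst (suc ∣ B [ e ]≔ false ∣ ≤_) (sym sK) (ℕ.≤-reflexive (sym (∣remove∣ e B Be))))
      with b Fin.≟ e
    -- If the augmenting element were `e` itself, `K` would contain the whole circuit.
    ... | yes refl = ∋∌-⊥ (ind-⊑ {K} (sub C⊑) hK) depC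
      where
      C⊑ : ∀ x → C ∋ x → K ∋ x
      C⊑ x h with x Fin.≟ b
      ... | yes refl = Kb
      ... | no x≢b   = at C⊑K x (remove-∋ C b x x≢b h)
    ... | no b≢e with sup b Kb
    ...   | inj₂ Bb = ∋∌-⊥ (remove-∋ B e b b≢e Bb) B-e∌b
    ...   | inj₁ Cb = mx (B [ e ]≔ false [ b ]≔ true)
              (hb , trans (∣insert∣ b (B [ e ]≔ false) B-e∌b) (trans (sym (∣remove∣ e B Be)) sB))
              (λ x h → ∋∌-⊥ h (⊥-∌ x))
              (≺-intro b (trans (sym (insert-≢ B false b≢e)) B-e∌b) (insert-∋ b (B [ e ]≔ false)) agree)
      where
      e<b : e Fin.< b
      e<b = ℕ.≤∧≢⇒< (min b (proj₂ (∋-remove C e b Cb))) (λ eq → b≢e (sym (Fin.toℕ-injective eq)))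
      agree : ∀ y → b Fin.< y → lookup B y ≡ lookup (B [ e ]≔ false [ b ]≔ true) y
      agree y lt = sym (trans (insert-≢ (B [ e ]≔ false) true (λ { refl → Fin.<-irrefl refl lt }))
        (insert-≢ B false (λ { refl → Fin.<-irrefl refl (Fin.<-trans e<b lt) })))

  -- Elements of the colexicographically largest basis are never active and all others are, so
  -- defining T through activities picks out exactly this basis.
  max≡T : ∀ {B} → IsMax Sub.⊥ B → B ≡ T
  max≡T {B} m = ⊑-antisym (sub λ e h → ∋-T (max-inactive {B} m h)) (sub λ e h → go e (T-∋ h))
    where
    go : ∀ e → isActive M (ground M) e ≡ false → B ∋ e
    go e h with lookup B e in eq
    ... | true  = refl
    ... | false = ∋∌-⊥ (active-mono (⊑-ground {B}) (max-active {Sub.⊥} m eq (⊥-∌ e))) h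

  T-basis : Basis T
  T-basis with B , m ← max-basis {Sub.⊥} cospan-⊥ = subst Basis (max≡T m) (proj₁ m)

  -- Elements of T are active with respect to no set, so they never enter through `Ext`. This is why
  -- passing from `B` to the part of T outside `B` reverses the order.
  extLeq-T : ∀ {A B} → extLeq M A B ≡ true → ∀ e → T ∋ e → A ∋ e → B ∋ e
  extLeq-T {A} {B} h e Te Ae with ∪-∋ B (Ext M B) e (at (⊆ᵇ⇒⊑ {A = A} {B Sub.∪ Ext M B} h) e Ae)
  ... | inj₁ Be = Be
  ... | inj₂ x  = ∋∌-⊥ (active-mono (⊑-ground {B}) (proj₁ (ext-∋ {B} x))) (T-∋ Te)

  -- Suppose the largest difference `x` lay in `A`. Then `x` is the minimum of a circuit whose other
  -- elements are in `B` above `x`, where `A` and `B` agree, so the independent set `A` would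
  -- contain the circuit.
  extLeq-≺ : ∀ {A B} → Ind A → extLeq M A B ≡ true → A ≢ B → A ≺ B
  extLeq-≺ {A} {B} hA le ne with ≺-cmp A B
  ... | inj₁ p        = ⊥-elim (ne p)
  ... | inj₂ (inj₁ h) = h
  ... | inj₂ (inj₂ h) with x , Bx , Ax , agree ← ≺-witness h
    with ∪-∋ B (Ext M B) x (at (⊆ᵇ⇒⊑ {A = A} {B Sub.∪ Ext M B} le) x Ax)
  ...   | inj₁ Bx′ = ∋∌-⊥ Bx′ Bx
  ...   | inj₂ ex with C , c , C⊑ , Cx , min ← active-sound {B} (proj₁ (ext-∋ {B} ex)) =
    ∋∌-⊥ (ind-⊑ (sub C⊑A) hA) (proj₁ (circuit-sound c))
    where
    C⊑A : ∀ y → C ∋ y → A ∋ y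
    C⊑A y hy with y Fin.≟ x
    ... | yes refl = Ax
    ... | no y≢x with ∋-insert B x y (at C⊑ y hy)
    ...   | inj₁ p  = ⊥-elim (y≢x p)
    ...   | inj₂ By = trans (sym (agree y (ℕ.≤∧≢⇒< (min y hy) (λ eq → y≢x (sym (Fin.toℕ-injective eq)))))) By

-- Alternating sums over subsets

ΣS : (Subset n → ℤ) → ℤ
ΣS {zero}  f = f []
ΣS {suc n} f = ΣS (λ s → f (true ∷ s) + f (false ∷ s))

ΣS-cong : {f g : Subset n → ℤ} → (∀ s → f s ≡ g s) → ΣS f ≡ ΣS g
ΣS-cong {zero}  h = h []
ΣS-cong {suc n} h = ΣS-cong (λ s → cong₂ _+_ (h (true ∷ s)) (h (false ∷ s)))

ΣS-+ : (f g : Subset n → ℤ) → ΣS (λ s → f s + g s) ≡ ΣS f + ΣS g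
ΣS-+ {zero}  f g = refl
ΣS-+ {suc n} f g = trans (ΣS-cong (λ s → lem (f (true ∷ s)) (g (true ∷ s)) (f (false ∷ s)) (g (false ∷ s)))) (ΣS-+ {n} _ _)
  where
  lem : ∀ a b c d → a + b + (c + d) ≡ a + c + (b + d)
  lem = solve-∀

ΣS-neg : (f : Subset n → ℤ) → ΣS (λ s → - f s) ≡ - ΣS f
ΣS-neg {zero}  f = refl
ΣS-neg {suc n} f = trans (ΣS-cong (λ s → sym (ℤ.neg-distrib-+ (f (true ∷ s)) (f (false ∷ s))))) (ΣS-neg {n} _)

ΣS-0 : {f : Subset n → ℤ} → (∀ s → f s ≡ 0ℤ) → ΣS f ≡ 0ℤ
ΣS-0 {zero}  h = h []
ΣS-0 {suc n} h = ΣS-0 {n} (λ s → cong₂ _+_ (h (true ∷ s)) (h (false ∷ s)))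

ΣS-single : ∀ {f : Subset n → ℤ} t → (∀ s → s ≢ t → f s ≡ 0ℤ) → ΣS f ≡ f t
ΣS-single []          h = refl
ΣS-single {f = f} (true ∷ t) h = trans (ΣS-single t (λ s ne →
    cong₂ _+_ (h (true ∷ s) (ne ∘ cong Vec.tail)) (h (false ∷ s) (λ ()))))
  (trans (cong (_+_ (f (true ∷ t))) (h (false ∷ t) (λ ()))) (ℤ.+-identityʳ _))
ΣS-single {f = f} (false ∷ t) h = trans (ΣS-single t (λ s ne →
    cong₂ _+_ (h (true ∷ s) (λ ())) (h (false ∷ s) (ne ∘ cong Vec.tail))))
  (trans (cong (_+ f (false ∷ t)) (h (true ∷ t) (λ ()))) (ℤ.+-identityˡ _))

ΣS-pair : ∀ {f g : Subset n → ℤ} e →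
  (∀ s → s ∌ e → f (s [ e ]≔ true) + f s ≡ g (s [ e ]≔ true) + g s) → ΣS f ≡ ΣS g
ΣS-pair zero    h = ΣS-cong (λ s → h (false ∷ s) refl)
ΣS-pair {f = f} {g} (suc e) h = ΣS-pair e (λ s s∌e →
  trans (lem (f (true ∷ s [ e ]≔ true)) (f (false ∷ s [ e ]≔ true)) (f (true ∷ s)) (f (false ∷ s)))
 (trans (cong₂ _+_ (h (true ∷ s) s∌e) (h (false ∷ s) s∌e))
        (sym (lem (g (true ∷ s [ e ]≔ true)) (g (false ∷ s [ e ]≔ true)) (g (true ∷ s)) (g (false ∷ s))))))
  where
  lem : ∀ a b c d → a + b + (c + d) ≡ (a + c) + (b + d)
  lem = solve-∀

ΣS-toggle : ∀ {f : Subset n → ℤ} e → (∀ s → s ∌ e → f (s [ e ]≔ true) + f s ≡ 0ℤ) → ΣS f ≡ 0ℤ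
ΣS-toggle {n} e h = trans (ΣS-pair {g = λ _ → 0ℤ} e h) (ΣS-0 {n} (λ _ → refl))

when : Bool → ℤ → ℤ
when b x = if b then x else 0ℤ

when-neg : ∀ b x → when b (- x) ≡ - when b x
when-neg true  x = refl
when-neg false x = refl

true⇔true : ∀ {a b} → (a ≡ true → b ≡ true) → (b ≡ true → a ≡ true) → a ≡ b
true⇔true {true}  {true}  f g = refl
true⇔true {true}  {false} f g = sym (f refl)
true⇔true {false} {true}  f g = g refl
true⇔true {false} {false} f g = refl

signℤ-insert : ∀ (s : Subset n) {e} → s ∌ e → signℤ ∣ s [ e ]≔ true ∣ ≡ - signℤ ∣ s ∣
signℤ-insert s {e} h = cong signℤ (∣insert∣ e s h)

size-suc : ∀ {n k} (S : Subset n) → ∣ S ∣ ≡ suc k → ∃ λ e → S ∋ e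
size-suc (true ∷ S)  h = zero , refl
size-suc (false ∷ S) h with e , p ← size-suc S h = suc e , p

size-0 : (S : Subset n) → ∣ S ∣ ≡ 0 → S ≡ Sub.⊥
size-0 []          h = refl
size-0 (false ∷ S) h = cong (false ∷_) (size-0 S h)

∪-insert : ∀ (J S : Subset n) e → J Sub.∪ (S [ e ]≔ true) ≡ (J [ e ]≔ true) Sub.∪ S
∪-insert (j ∷ J) (s ∷ S) zero    = cong (_∷ _) (Data.Bool.Properties.∨-zeroʳ j)
∪-insert (j ∷ J) (s ∷ S) (suc e) = cong (_ ∷_) (∪-insert J S e)

∪-mono : ∀ (J : Subset n) {S R} → S ⊑ R → (J Sub.∪ S) ⊑ (J Sub.∪ R)
∪-mono J {S} {R} f = sub λ e h → case ∪-∋ J S e h of λ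
  { (inj₁ a) → ∪-∋ˡ J R e a ; (inj₂ b) → ∪-∋ʳ J R e (at f e b) }

⊑-∪ˡ : (J S : Subset n) → J ⊑ (J Sub.∪ S)
⊑-∪ˡ J S = sub λ e h → ∪-∋ˡ J S e h

∪-⊥ : (J : Subset n) → J Sub.∪ Sub.⊥ ≡ J
∪-⊥ J = Subset.∪-identityʳ J

∌-∪ : ∀ (J S : Subset n) e → J ∌ e → S ∌ e → (J Sub.∪ S) ∌ e
∌-∪ J S e a b = trans (lookup-∪ J S e) (cong₂ _∨_ a b)

remove-⊑ : ∀ (S : Subset n) e → S [ e ]≔ false ⊑ S
remove-⊑ S e = sub λ x h → proj₂ (∋-remove S e x h)

∣remove∣-pred : ∀ {n k} (S : Subset n) {e} → S ∋ e → ∣ S ∣ ≡ suc k → ∣ S [ e ]≔ false ∣ ≡ k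
∣remove∣-pred S {e} h eq = ℕ.suc-injective (trans (sym (∣remove∣ e S h)) eq)

-- Complexes interpolating between the order complex and the independence complex of M*|T

module Complexes {n : ℕ} (M : IndepSystem n) (full : ground M ≡ ⊤) (mat : IsMatroid M) where
  open Ordered M full mat public

  -- One simplex carries every complex: the elements of the ground set come first, then all subsets
  -- of it, bases or not, in colexicographic order.
  V : ℕ
  V = n ℕ.+ card n

  eT : Fin n → Fin V
  eT e = e Fin.↑ˡ card n

  eB : Subset n → Fin V
  eB B = n Fin.↑ʳ code B

  eT≢eB : ∀ {e B} → eT e ≢ eB B
  eT≢eB {e} {B} eq = inj₁≢inj₂ (trans (sym (Fin.splitAt-↑ˡ n e (card n))) (trans (cong (Fin.splitAt n) eq) (Fin.splitAt-↑ʳ n (card n) (code B))))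
    where
    inj₁≢inj₂ : ∀ {A B : Set} {a : A} {b : B} → inj₁ a ≢ inj₂ b
    inj₁≢inj₂ ()

  eB-injective : ∀ {A B} → eB A ≡ eB B → A ≡ B
  eB-injective eq = code-injective (Fin.↑ʳ-injective n _ _ eq)

  vertex-cases : ∀ (v : Fin V) → (∃ λ e → eT e ≡ v) ⊎ (∃ λ B → eB B ≡ v)
  vertex-cases v with Fin.splitAt n v in eq
  ... | inj₁ e = inj₁ (e , Fin.splitAt⁻¹-↑ˡ eq)
  ... | inj₂ i with B , p ← code-surjective {n} i =
    inj₂ (B , trans (cong (n Fin.↑ʳ_) p) (Fin.splitAt⁻¹-↑ʳ {n} eq))

  tp : Subset V → Subset n
  tp s = Vec.tabulate (λ e → lookup s (eT e))

  tp-∋ : ∀ s e → lookup (tp s) e ≡ lookup s (eT e)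
  tp-∋ s e = Vec.lookup∘tabulate _ e

  lookup-ext : ∀ {m} {A B : Subset m} → (∀ e → lookup A e ≡ lookup B e) → A ≡ B
  lookup-ext f = ⊑-antisym (sub λ e h → trans (sym (f e)) h) (sub λ e h → trans (f e) h)

  tp-eT : ∀ s e b → tp (s [ eT e ]≔ b) ≡ tp s [ e ]≔ b
  tp-eT s e b = lookup-ext go
    where
    go : ∀ x → lookup (tp (s [ eT e ]≔ b)) x ≡ lookup (tp s [ e ]≔ b) x
    go x with x Fin.≟ e
    ... | yes refl = trans (tp-∋ (s [ eT e ]≔ b) x) (trans (Vec.lookup∘updateAt (eT x) s) (sym (Vec.lookup∘updateAt x (tp s))))
    ... | no x≢e   = trans (tp-∋ (s [ eT e ]≔ b) x) (trans (insert-≢ s b (x≢e ∘ Fin.↑ˡ-injective (card n) x e))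
                       (sym (trans (insert-≢ (tp s) b x≢e) (tp-∋ s x))))

  tp-eB : ∀ s B b → tp (s [ eB B ]≔ b) ≡ tp s
  tp-eB s B b = lookup-ext (λ x → trans (tp-∋ (s [ eB B ]≔ b) x) (trans (insert-≢ s b (eT≢eB {B = B})) (sym (tp-∋ s x))))

  eB-eT : ∀ s e b B → lookup (s [ eT e ]≔ b) (eB B) ≡ lookup s (eB B)
  eB-eT s e b B = insert-≢ s b (eT≢eB {B = B} ∘ sym)

  abstract
    LT : Subset n → Subset n → Set
    LT A B = extLeq M A B ≡ true × A ≢ B

    LT-intro : ∀ {A B} → extLeq M A B ≡ true → A ≢ B → LT A B
    LT-intro a b = a , b

    LT-elim : ∀ {A B} → LT A B → extLeq M A B ≡ true × A ≢ B
    LT-elim h = h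

  LT-≺ : ∀ {A B} → Ind A → LT A B → A ≺ B
  LT-≺ hA h with a , b ← LT-elim h = extLeq-≺ hA a b

  -- A simplex is the union of a set I ⊆ T′ and a set of pairwise comparable
  -- bases with code below m, such that all the bases avoid J ∪ I, and J ∪ I is
  -- independent in the dual.  J = ∅, T′ = ∅ gives the order complex,
  -- J = ∅, T′ = T, m = 0 the independence complex of M*|T.
  record X (J T′ : Subset n) (m : ℕ) (s : Subset V) : Set where
    field
      ⊑T′    : tp s ⊑ T′
      cospan : Cospan (J Sub.∪ tp s)
      vertex : ∀ B → s ∋ eB B → Basis B × B ≢ T × Avoids B (J Sub.∪ tp s) × Fin.toℕ (code B) < m
      compar : ∀ A B → s ∋ eB A → s ∋ eB B → A ≡ B ⊎ LT A B ⊎ LT B A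
  open X

  module _ {J T′ : Subset n} {m : ℕ} {e : Fin n} (Te : T′ ∋ e) where
    private
      T″ = T′ [ e ]≔ false

    X-del : ∀ s → X J T′ m s → s ∌ eT e → X J T″ m s
    X-del s x s∌e = record
      { ⊑T′    = sub λ y h → remove-∋ T′ e y (λ { refl → ∋∌-⊥ h (trans (tp-∋ s e) s∌e) }) (at (⊑T′ x) y h)
      ; cospan = cospan x
      ; vertex = vertex x
      ; compar = compar x
      }

    X-del⁻¹ : ∀ s → X J T″ m s → X J T′ m s × s ∌ eT e
    X-del⁻¹ s x = record
      { ⊑T′    = ⊑-trans (⊑T′ x) (remove-⊑ T′ e)
      ; cospan = cospan x
      ; vertex = vertex x
      ; compar = compar x
      } , ¬∋⇒∌ λ h → ∋∌-⊥ (at (⊑T′ x) e (trans (tp-∋ s e) h)) (remove-∌ e T′)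

    private
      ∪-eq : ∀ s → J Sub.∪ tp (s [ eT e ]≔ true) ≡ (J [ e ]≔ true) Sub.∪ tp s
      ∪-eq s = trans (cong (J Sub.∪_) (tp-eT s e true)) (∪-insert J (tp s) e)

    X-link : ∀ s → s ∌ eT e → X J T′ m (s [ eT e ]≔ true) → X (J [ e ]≔ true) T″ m s
    X-link s s∌e x = record
      { ⊑T′    = sub λ y h → remove-∋ T′ e y (λ { refl → ∋∌-⊥ h (trans (tp-∋ s e) s∌e) })
                   (at (⊑T′ x) y (trans (cong (λ S → lookup S y) (tp-eT s e true)) (at (insert-⊒ (tp s) e) y h)))
      ; cospan = subst Cospan (∪-eq s) (cospan x)
      ; vertex = λ B h → let (a , b , c , d) = vertex x B (trans (eB-eT s e true B) h) in a , b , subst (Avoids B) (∪-eq s) c , d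
      ; compar = λ A B h g → compar x A B (trans (eB-eT s e true A) h) (trans (eB-eT s e true B) g)
      }

    X-link⁻¹ : ∀ s → X (J [ e ]≔ true) T″ m s → X J T′ m (s [ eT e ]≔ true) × s ∌ eT e
    X-link⁻¹ s x = record
      { ⊑T′    = sub λ y h → at (insert-⊑ (⊑-trans (⊑T′ x) (remove-⊑ T′ e)) Te) y (trans (cong (λ S → lookup S y) (sym (tp-eT s e true))) h)
      ; cospan = subst Cospan (sym (∪-eq s)) (cospan x)
      ; vertex = λ B h → let (a , b , c , d) = vertex x B (trans (sym (eB-eT s e true B)) h) in a , b , subst (Avoids B) (sym (∪-eq s)) c , d
      ; compar = λ A B h g → compar x A B (trans (sym (eB-eT s e true A)) h) (trans (sym (eB-eT s e true B)) g)
      } , ¬∋⇒∌ λ h → ∋∌-⊥ (at (⊑T′ x) e (trans (tp-∋ s e) h)) (remove-∌ e T′)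

    X-shrink : ∀ s → X (J [ e ]≔ true) T″ m s → X J T″ m s
    X-shrink s x = record
      { ⊑T′    = ⊑T′ x
      ; cospan = cospan-⊑ J⊑ (cospan x)
      ; vertex = λ B h → let (a , b , c , d) = vertex x B h in a , b , (λ y hy → c y (at J⊑ y hy)) , d
      ; compar = compar x
      }
      where
      J⊑ : (J Sub.∪ tp s) ⊑ ((J [ e ]≔ true) Sub.∪ tp s)
      J⊑ = sub λ y h → case ∪-∋ J (tp s) y h of λ
        { (inj₁ a) → ∪-∋ˡ (J [ e ]≔ true) (tp s) y (at (insert-⊒ J e) y a) ; (inj₂ b) → ∪-∋ʳ (J [ e ]≔ true) (tp s) y b }

    -- Linking with `e` moves `e` from `T′` to `J`: from now on the bases must avoid it, and it
    -- still counts in `cospan`. The purpose of `J` is to keep the family closed under this.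
    X-split : Split (eT e) (X J T′ m) (X J T″ m) (X (J [ e ]≔ true) T″ m)
    X-split = record { del⇒ = X-del ; del⇐ = X-del⁻¹ ; link⇒ = X-link ; link⇐ = X-link⁻¹ ; link⊆del = X-shrink }

  -- The void complex lacks even the empty face. It occurs when no basis avoids `J`, and as the link
  -- of a subset that is not a basis or is T.
  empty-acyclic : ∀ {m} {K : Cx m} → (∀ s → ¬ K s) → RelAcyclic ∅ᶜ K
  empty-acyclic none j c hc hbd = 0ᶜ , (λ s ne → ⊥-elim (ne refl)) ,
    λ s ne → none s (proj₁ (hc s (λ eq → ne (trans (cong₂ _+_ eq (bd-0 s)) refl))))

  RelAcyclic-refl : ∀ {m} {K : Cx m} → RelAcyclic K K
  RelAcyclic-refl j c hc hbd = 0ᶜ , (λ s ne → ⊥-elim (ne refl)) ,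
    λ s ne → proj₁ (hc s (λ eq → ne (trans (cong₂ _+_ eq (bd-0 s)) refl)))

  -- With no elements of T left to add, faces are chains of bases avoiding `J`, and the largest such
  -- basis lies above all of them. It differs from T, hence is a vertex, because it misses `j`.
  X-apex : ∀ {J j B} → IsMax J B → J ∋ j → T ∋ j → ∀ s → X J Sub.⊥ (card n) s → X J Sub.⊥ (card n) (s [ eB B ]≔ true)
  X-apex {J} {j} {B} mx@(b , av , _) Jj Tj s x = record
    { ⊑T′    = subst (_⊑ Sub.⊥) (sym (tp-eB s B true)) (⊑T′ x)
    ; cospan = subst (λ S → Cospan (J Sub.∪ S)) (sym (tp-eB s B true)) (cospan x)
    ; vertex = λ A h → subst (λ S → Basis A × A ≢ T × Avoids A (J Sub.∪ S) × _) (sym (tp-eB s B true)) (vert A h)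
    ; compar = λ A C h g → comp A C (mem A h) (mem C g)
    }
    where
    mem : ∀ A → s [ eB B ]≔ true ∋ eB A → A ≡ B ⊎ s ∋ eB A
    mem A h with ∋-insert s (eB B) (eB A) h
    ... | inj₁ p = inj₁ (eB-injective p)
    ... | inj₂ q = inj₂ q
    vert : ∀ A → s [ eB B ]≔ true ∋ eB A → Basis A × A ≢ T × Avoids A (J Sub.∪ tp s) × Fin.toℕ (code A) < card n
    vert A h with mem A h
    ... | inj₂ q    = vertex x A q
    ... | inj₁ refl = b , (λ eq → ∋∌-⊥ Tj (subst (_∌ j) eq (av j Jj))) ,
      (λ y hy → case ∪-∋ J (tp s) y hy of λ { (inj₁ h) → av y h ; (inj₂ h) → ∋∌-⊥ (at (⊑T′ x) y h) (⊥-∌ y) }) ,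
      Fin.toℕ<n (code A)
    below : ∀ A → s ∋ eB A → A ≡ B ⊎ LT A B
    below A h with Vec.≡-dec Data.Bool._≟_ A B
    ... | yes p = inj₁ p
    ... | no ne = inj₂ (LT-intro (max-extLeq {J} mx A (λ y hy → proj₁ (proj₂ (proj₂ (vertex x A h))) y (∪-∋ˡ J (tp s) y hy))) ne)
    comp : ∀ A C → A ≡ B ⊎ s ∋ eB A → C ≡ B ⊎ s ∋ eB C → A ≡ C ⊎ LT A C ⊎ LT C A
    comp A C (inj₂ a)    (inj₂ c)    = compar x A C a c
    comp A C (inj₁ refl) (inj₁ refl) = inj₁ refl
    comp A C (inj₁ refl) (inj₂ c) with below C c
    ... | inj₁ p = inj₁ (sym p)
    ... | inj₂ q = inj₂ (inj₂ q)
    comp A C (inj₂ a) (inj₁ refl) = Data.Sum.map₂ inj₁ (below A a)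

  -- Elements of `T′` are deleted until only bases are left. `J` has to meet T: otherwise the apex
  -- would be T itself, which is not a vertex.
  X-acyclic : ∀ k J T′ → ∣ T′ ∣ ≡ k → (∃ λ j → J ∋ j × T ∋ j) → T′ ⊑ T → RelAcyclic ∅ᶜ (X J T′ (card n))
  X-acyclic zero J T′ sz (j , Jj , Tj) T′⊑T rewrite size-0 T′ sz with cospan? J
  ... | yes co with B , mx ← max-basis {J} co = cone-acyclic (eB B) (X-apex mx Jj Tj)
  ... | no ¬co = empty-acyclic (λ s x → ¬co (cospan-⊑ (⊑-∪ˡ J (tp s)) (cospan x)))
  X-acyclic (suc k) J T′ sz (j , Jj , Tj) T′⊑T with e , T′e ← size-suc T′ sz =
    RelAcyclic-trans (λ _ ()) (λ s x → proj₁ (X-del⁻¹ T′e s x))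
      (X-acyclic k J (T′ [ e ]≔ false) (∣remove∣-pred T′ T′e sz) (j , Jj , Tj) (⊑-trans (remove-⊑ T′ e) T′⊑T))
      (remove-vertex (X-split T′e) (X-acyclic k (J [ e ]≔ true) (T′ [ e ]≔ false) (∣remove∣-pred T′ T′e sz)
        (e , insert-∋ e J , at T′⊑T e T′e) (⊑-trans (remove-⊑ T′ e) T′⊑T)))

  X-mono-T : ∀ {J T′ m} s → X J Sub.⊥ m s → X J T′ m s
  X-mono-T s x = record { ⊑T′ = sub λ y h → ∋∌-⊥ (at (⊑T′ x) y h) (⊥-∌ y) ; cospan = cospan x ; vertex = vertex x ; compar = compar x }

  -- Here `J` is empty, and `X-acyclic` is applied to the links only, whose `J` is the single
  -- element `e` of T.
  order-rel : ∀ k T′ → ∣ T′ ∣ ≡ k → T′ ⊑ T → RelAcyclic (X Sub.⊥ Sub.⊥ (card n)) (X Sub.⊥ T′ (card n))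
  order-rel zero    T′ sz T′⊑T rewrite size-0 T′ sz = RelAcyclic-refl
  order-rel (suc k) T′ sz T′⊑T with e , T′e ← size-suc T′ sz =
    RelAcyclic-trans X-mono-T (λ s x → proj₁ (X-del⁻¹ T′e s x))
      (order-rel k (T′ [ e ]≔ false) (∣remove∣-pred T′ T′e sz) (⊑-trans (remove-⊑ T′ e) T′⊑T))
      (remove-vertex (X-split T′e) (X-acyclic k (Sub.⊥ [ e ]≔ true) (T′ [ e ]≔ false) (∣remove∣-pred T′ T′e sz)
        (e , insert-∋ e Sub.⊥ , at T′⊑T e T′e) (⊑-trans (remove-⊑ T′ e) T′⊑T)))

  ⊈-witness : ∀ {A B : Subset n} → ¬ (A ⊑ B) → ∃ λ e → A ∋ e × B ∌ e
  ⊈-witness {A} {B} h with e , p ← all-false _ (allFin n) (¬∋⇒∌ {A ⊆ᵇ B} (λ eq → h (⊆ᵇ⇒⊑ eq)))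
    with lookup A e in a | lookup B e in b | p
  ... | true | false | _ = e , a , b

  X-mono-m : ∀ {J T′ m m′} → m ≤ m′ → ∀ s → X J T′ m s → X J T′ m′ s
  X-mono-m le s x = record { ⊑T′ = ⊑T′ x ; cospan = cospan x ; compar = compar x
    ; vertex = λ B h → let (a , b , c , d) = vertex x B h in a , b , c , ℕ.<-≤-trans d le }

  Vertex : Subset n → Subset n → ℕ → Set
  Vertex Z B m = Basis B × B ≢ T × Avoids B Z × Fin.toℕ (code B) < m

  module _ (B : Subset n) where
    private
      top : ℕ
      top = Fin.toℕ (code B)
      K K₀ K₁ : Cx V
      K  = X Sub.⊥ T (suc top)
      K₀ = X Sub.⊥ T top
      K₁ s = K (s [ eB B ]≔ true) × s ∌ eB B

    B-del : ∀ s → K s → s ∌ eB B → K₀ s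
    B-del s x s∌B = record { ⊑T′ = ⊑T′ x ; cospan = cospan x ; vertex = vert ; compar = compar x }
      where
      vert : ∀ A → s ∋ eB A → Vertex (Sub.⊥ Sub.∪ tp s) A top
      vert A h with a , b , c , d ← vertex x A h = a , b , c , ℕ.≤∧≢⇒< (ℕ.≤-pred d) λ eq →
        ∋∌-⊥ h (subst (λ C → lookup s (eB C) ≡ false) (sym (code-injective {A = A} {B} (Fin.toℕ-injective eq))) s∌B)

    B-shrink : ∀ s → K (s [ eB B ]≔ true) → K s
    B-shrink s x = record
      { ⊑T′    = subst (_⊑ T) (tp-eB s B true) (⊑T′ x)
      ; cospan = subst (λ S → Cospan (Sub.⊥ Sub.∪ S)) (tp-eB s B true) (cospan x)
      ; vertex = λ A h → subst (λ S → Vertex (Sub.⊥ Sub.∪ S) A (suc top)) (tp-eB s B true) (vertex x A (at (insert-⊒ s (eB B)) (eB A) h))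
      ; compar = λ A C h g → compar x A C (at (insert-⊒ s (eB B)) (eB A) h) (at (insert-⊒ s (eB B)) (eB C) g) }

    B-split : Split (eB B) K K₀ K₁
    B-split = record
      { del⇒ = B-del
      ; del⇐ = λ s x → X-mono-m (ℕ.n≤1+n top) s x , ¬∋⇒∌ (λ h → ℕ.<-irrefl refl (proj₂ (proj₂ (proj₂ (vertex x B h)))))
      ; link⇒ = λ s h x → x , h
      ; link⇐ = λ s h → h
      ; link⊆del = λ s (x , h) → B-del s (B-shrink s x) h
      }

    -- The other bases in the link of `B` have smaller codes, so being comparable with `B` they lie
    -- below it, and then miss `e` as `B` does. Thus `e` can be added, with `B` itself as the
    -- witness for `cospan`.
    B-closed : ∀ {e} → Basis B → T ∋ e → B ∌ e → ∀ s → K₁ s → K₁ (s [ eT e ]≔ true)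
    B-closed {e} b Te Be s (x , s∌B) = record
      { ⊑T′    = subst (_⊑ T) (sym tp-eq) (insert-⊑ (subst (_⊑ T) (tp-eB s B true) (⊑T′ x)) Te)
      ; cospan = B , b , subst (λ S → Avoids B (Sub.⊥ Sub.∪ S)) (sym tp-eq) (avoid B Be (insert-∋ (eB B) s))
      ; vertex = vert
      ; compar = λ A C h g → compar x A C (mem A h) (mem C g)
      } , trans (eB-eT s e true B) s∌B
      where
      s₁ = s [ eB B ]≔ true
      s′ = s [ eT e ]≔ true [ eB B ]≔ true
      tp-eq : tp s′ ≡ tp s [ e ]≔ true
      tp-eq = trans (tp-eB (s [ eT e ]≔ true) B true) (tp-eT s e true)
      mem : ∀ A → s′ ∋ eB A → s₁ ∋ eB A
      mem A h with ∋-insert (s [ eT e ]≔ true) (eB B) (eB A) h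
      ... | inj₁ p = subst (λ v → s₁ ∋ v) (sym p) (insert-∋ (eB B) s)
      ... | inj₂ q = at (insert-⊒ s (eB B)) (eB A) (trans (sym (eB-eT s e true A)) q)
      avoid : ∀ A → A ∌ e → s₁ ∋ eB A → Avoids A (Sub.⊥ Sub.∪ (tp s [ e ]≔ true))
      avoid A Ae h y hy with ∪-∋ Sub.⊥ (tp s [ e ]≔ true) y hy
      ... | inj₁ p = ∋∌-⊥ p (⊥-∌ y)
      ... | inj₂ q with ∋-insert (tp s) e y q
      ...   | inj₁ refl = Ae
      ...   | inj₂ r = proj₁ (proj₂ (proj₂ (vertex x A h))) y
                         (∪-∋ʳ Sub.⊥ (tp s₁) y (trans (cong (λ S → lookup S y) (tp-eB s B true)) r))
      A∌e : ∀ A → s₁ ∋ eB A → A ∌ e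
      A∌e A h with compar x A B h (insert-∋ (eB B) s)
      ... | inj₁ refl = Be
      ... | inj₂ (inj₁ lt) = ¬∋⇒∌ λ Ae → ∋∌-⊥ (extLeq-T {A} {B} (proj₁ (LT-elim lt)) e Te Ae) Be
      ... | inj₂ (inj₂ gt) = ⊥-elim (ℕ.<⇒≱ (code-mono (LT-≺ {B} {A} (proj₁ b) gt)) (ℕ.≤-pred (proj₂ (proj₂ (proj₂ (vertex x A h))))))
      vert : ∀ A → s′ ∋ eB A → Vertex (Sub.⊥ Sub.∪ tp s′) A (suc top)
      vert A h with a , A≢T , _ , lt ← vertex x A (mem A h) = a , A≢T ,
        subst (λ S → Avoids A (Sub.⊥ Sub.∪ S)) (sym tp-eq) (avoid A (A∌e A (mem A h)) (mem A h)) , lt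

    B-link-acyclic : Dec (Basis B) → Dec (B ≡ T) → RelAcyclic ∅ᶜ K₁
    B-link-acyclic (no ¬b) _ = empty-acyclic λ s (x , _) → ¬b (proj₁ (vertex x B (insert-∋ (eB B) s)))
    B-link-acyclic (yes b) (yes p) = empty-acyclic λ s (x , _) → proj₁ (proj₂ (vertex x B (insert-∋ (eB B) s))) p
    B-link-acyclic (yes b) (no B≢T) = cone-acyclic (eT e) (B-closed b Te Be)
      where
      T⊈B : ¬ (T ⊑ B)
      -- Bases have equal size, so T inside `B` would force equality; hence an apex outside `B`
      -- exists.
      T⊈B T⊑B = B≢T (sym (basis-⊑-≡ T-basis b T⊑B))
      outside = ⊈-witness T⊈B
      e  = proj₁ outside
      Te = proj₁ (proj₂ outside)
      Be = proj₂ (proj₂ outside)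

    drop-basis : RelAcyclic K₀ K
    drop-basis = remove-vertex B-split (B-link-acyclic (isBasis? B) (Vec.≡-dec Data.Bool._≟_ B T))

  -- Codes are peeled off from the top; those of sets that are not bases, and that of T, are dropped
  -- with a void link.
  independence-rel : ∀ m → m ≤ card n → RelAcyclic (X Sub.⊥ T 0) (X Sub.⊥ T m)
  independence-rel zero    le = RelAcyclic-refl
  independence-rel (suc m) le with B , eq ← code-surjective {n} (Fin.fromℕ< le) =
    RelAcyclic-trans (X-mono-m z≤n) (X-mono-m (ℕ.n≤1+n m)) (independence-rel m (ℕ.<⇒≤ le))
      (subst (λ k → RelAcyclic (X Sub.⊥ T k) (X Sub.⊥ T (suc k))) (trans (cong Fin.toℕ eq) (Fin.toℕ-fromℕ< le)) (drop-basis B))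

-- Homology of the independence complex of M*|T

≡ᵇ-true : ∀ {a b} → (a ℕ.≡ᵇ b) ≡ true → a ≡ b
≡ᵇ-true {a} {b} h = ℕ.≡ᵇ⇒≡ a b (subst Data.Bool.T (sym h) _)

true-≡ᵇ : ∀ {a b} → a ≡ b → (a ℕ.≡ᵇ b) ≡ true
true-≡ᵇ {zero}  refl = refl
true-≡ᵇ {suc a} refl = true-≡ᵇ {a} refl

when-∧-false : ∀ {a} b x → a ≡ false → when (a ∧ b) x ≡ 0ℤ
when-∧-false b x refl = refl

∪-assoc-insert : ∀ (J S : Subset n) {e} → S ∋ e → (J [ e ]≔ true) Sub.∪ (S [ e ]≔ false) ≡ J Sub.∪ S
∪-assoc-insert J S {e} h = trans (sym (∪-insert J (S [ e ]≔ false) e)) (cong (J Sub.∪_) (insert-remove e S h))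

module Independence {n : ℕ} (M : IndepSystem n) (full : ground M ≡ ⊤) (mat : IsMatroid M) where
  open Complexes M full mat public
  open X public

  r : Subset n → ℕ
  r = rank M

  ρ : ℕ
  ρ = r (ground M)

  co : Subset n → Subset n
  co Z = ground M Sub.─ Z

  cospanᵇ : Subset n → Bool
  cospanᵇ Z = r (co Z) ℕ.≡ᵇ ρ

  cospanᵇ-true : ∀ {Z} → cospanᵇ Z ≡ true → Cospan Z
  cospanᵇ-true h = rank⇒cospan (≡ᵇ-true h)

  true-cospanᵇ : ∀ {Z} → Cospan Z → cospanᵇ Z ≡ true
  true-cospanᵇ h = true-≡ᵇ (cospan⇒rank h)

  ∋-co : ∀ {Z e} → Z ∌ e → co Z ∋ e
  ∋-co {Z} {e} h = ∋-─ (ground M) Z e (at (⊑-ground {⊤}) e (Vec.lookup-replicate e true)) h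

  co-∋ : ∀ {Z e} → co Z ∋ e → Z ∌ e
  co-∋ {Z} {e} h = proj₂ (─-∋ (ground M) Z e h)

  co-anti : ∀ {Y Z} → Y ⊑ Z → co Z ⊑ co Y
  co-anti {Y} {Z} f = sub λ e h → ∋-co {Y} (¬∋⇒∌ λ y → ∋∌-⊥ (at f e y) (co-∋ {Z} h))

  co-insert : ∀ {Z e} → co Z ⊑ co (Z [ e ]≔ true) [ e ]≔ true
  co-insert {Z} {e} = sub go
    where
    go : ∀ x → co Z ∋ x → co (Z [ e ]≔ true) [ e ]≔ true ∋ x
    go x h with x Fin.≟ e
    ... | yes refl = insert-∋ x (co (Z [ x ]≔ true))
    ... | no x≢e   = at (insert-⊒ (co (Z [ e ]≔ true)) e) x (∋-co {Z [ e ]≔ true} (trans (insert-≢ Z true x≢e) (co-∋ {Z} h)))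

  co-remove : ∀ {Z e} → Z ∋ e → co (Z [ e ]≔ false) ≡ co Z [ e ]≔ true
  co-remove {Z} {e} Ze = ⊑-antisym (sub f) (insert-⊑ (co-anti (remove-⊑ Z e)) (∋-co {Z [ e ]≔ false} (remove-∌ e Z)))
    where
    f : ∀ x → co (Z [ e ]≔ false) ∋ x → co Z [ e ]≔ true ∋ x
    f x h with x Fin.≟ e
    ... | yes refl = insert-∋ x (co Z)
    ... | no x≢e   = at (insert-⊒ (co Z) e) x (∋-co {Z} (trans (sym (insert-≢ Z false x≢e)) (co-∋ {Z [ e ]≔ false} h)))

  -- If e lies in the closure of Y, then e is a coloop of the dual on the complement of Y.
  cospan-coloop : ∀ {Y Z e} → r (Y [ e ]≔ true) ≡ r Y → Y ⊑ co (Z [ e ]≔ true) → Cospan Z → Cospan (Z [ e ]≔ true)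
  cospan-coloop {Y} {Z} {e} eq Y⊑ c = rank⇒cospan (ℕ.≤-antisym (rank-mono {co (Z [ e ]≔ true)} ⊑-ground)
    (subst₂ _≤_ (cospan⇒rank c) (rank-insert-≡ e Y⊑ eq) (rank-mono (co-insert {Z} {e}))))

  term : Subset n → Subset n → Subset n → ℤ
  term J T′ I = when ((I ⊆ᵇ T′) ∧ cospanᵇ (J Sub.∪ I)) (signℤ ∣ I ∣)

  -- Signs follow the number of elements, so this is minus the usual reduced Euler characteristic of
  -- `X J T′ 0`.
  χ : Subset n → Subset n → ℤ
  χ J T′ = ΣS (term J T′)

  term-∌ : ∀ {J T′ I e} → T′ ∌ e → I ∋ e → term J T′ I ≡ 0ℤ
  term-∌ {J} {T′} {I} {e} T′e Ie = when-∧-false (cospanᵇ (J Sub.∪ I)) (signℤ ∣ I ∣)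
    (¬∋⇒∌ λ h → ∋∌-⊥ (at (⊆ᵇ⇒⊑ {A = I} {T′} h) e Ie) T′e)

  ⊆ᵇ-remove : ∀ {T′ I : Subset n} {e} → I ∌ e → (I ⊆ᵇ T′) ≡ (I ⊆ᵇ (T′ [ e ]≔ false))
  ⊆ᵇ-remove {T′} {I} {e} I∌e = true⇔true
    (λ h → ⊑⇒⊆ᵇ {A = I} {T′ [ e ]≔ false} (sub λ x hx → remove-∋ T′ e x (λ { refl → ∋∌-⊥ hx I∌e }) (at (⊆ᵇ⇒⊑ {A = I} {T′} h) x hx)))
    (λ h → ⊑⇒⊆ᵇ (⊑-trans (⊆ᵇ⇒⊑ {A = I} h) (remove-⊑ T′ e)))

  ⊆ᵇ-insert : ∀ {T′ I : Subset n} {e} → T′ ∋ e → (I [ e ]≔ true ⊆ᵇ T′) ≡ (I ⊆ᵇ T′)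
  ⊆ᵇ-insert {T′} {I} {e} Te = true⇔true
    (λ h → ⊑⇒⊆ᵇ (⊑-trans (insert-⊒ I e) (⊆ᵇ⇒⊑ {B = T′} h)))
    (λ h → ⊑⇒⊆ᵇ (insert-⊑ (⊆ᵇ⇒⊑ {A = I} {T′} h) Te))

  -- Sets through `e` are counted by the link, with one element less and so the opposite sign. All
  -- sums run over the subsets of the whole ground set, and on the right the terms through `e` are
  -- zero.
  χ-split : ∀ {J T′ e} → T′ ∋ e → χ J T′ ≡ χ J (T′ [ e ]≔ false) - χ (J [ e ]≔ true) (T′ [ e ]≔ false)
  χ-split {J} {T′} {e} Te = trans (ΣS-pair {f = term J T′} e pair)
    (trans (ΣS-+ (term J T″) (λ I → - term J⁺ T″ I)) (cong (_+_ (χ J T″)) (ΣS-neg (term J⁺ T″))))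
    where
    T″ = T′ [ e ]≔ false
    J⁺ = J [ e ]≔ true
    del : ∀ I → I ∌ e → term J T′ I ≡ term J T″ I
    del I I∌e = cong (λ b → when (b ∧ cospanᵇ (J Sub.∪ I)) (signℤ ∣ I ∣)) (⊆ᵇ-remove {T′} {I} I∌e)
    lnk : ∀ I → I ∌ e → term J T′ (I [ e ]≔ true) ≡ - term J⁺ T″ I
    lnk I I∌e = trans (cong₂ (λ b x → when (b ∧ cospanᵇ (J Sub.∪ (I [ e ]≔ true))) x)
                        (trans (⊆ᵇ-insert {T′} {I} Te) (⊆ᵇ-remove {T′} {I} I∌e)) (signℤ-insert I I∌e))
               (trans (cong (λ Z → when ((I ⊆ᵇ T″) ∧ cospanᵇ Z) (- signℤ ∣ I ∣)) (∪-insert J I e))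
                      (when-neg ((I ⊆ᵇ T″) ∧ cospanᵇ (J⁺ Sub.∪ I)) (signℤ ∣ I ∣)))
    zeros : ∀ J′ I → term J′ T″ (I [ e ]≔ true) ≡ 0ℤ
    zeros J′ I = term-∌ {J′} {T″} {I [ e ]≔ true} {e} (remove-∌ e T′) (insert-∋ e I)
    lem : ∀ x y → - x + y ≡ 0ℤ + - 0ℤ + (y + - x)
    lem = solve-∀
    pair : ∀ I → I ∌ e → term J T′ (I [ e ]≔ true) + term J T′ I ≡
      (term J T″ (I [ e ]≔ true) + - term J⁺ T″ (I [ e ]≔ true)) + (term J T″ I + - term J⁺ T″ I)
    pair I I∌e = trans (cong₂ _+_ (lnk I I∌e) (del I I∌e))
      (trans (lem (term J⁺ T″ I) (term J T″ I))
        (cong₂ (λ x y → x + - y + (term J T″ I + - term J⁺ T″ I)) (sym (zeros J I)) (sym (zeros J⁺ I))))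

  co-∪-insert : ∀ {J T′ I e} → I ⊑ T′ → T′ ∋ e → co (J Sub.∪ T′) ⊑ co ((J Sub.∪ I) [ e ]≔ true)
  co-∪-insert {J} {T′} {I} {e} f Te = co-anti (insert-⊑ (∪-mono J f) (∪-∋ʳ J T′ e Te))

  ∪-insert-out : ∀ {J I : Subset n} {e} → J Sub.∪ (I [ e ]≔ true) ≡ (J Sub.∪ I) [ e ]≔ true
  ∪-insert-out {J} {I} {e} = trans (∪-insert J I e) (trans (cong (Sub._∪ I) (sym (∪⁅⁆≡insert J e)))
    (trans (Subset.∪-assoc J Sub.⁅ e ⁆ I) (trans (cong (J Sub.∪_) (Subset.∪-comm Sub.⁅ e ⁆ I))
      (trans (sym (Subset.∪-assoc J I Sub.⁅ e ⁆)) (∪⁅⁆≡insert (J Sub.∪ I) e)))))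

  -- The rank condition makes `e` a coloop of the dual on `T′` after contracting `J`, so toggling
  -- `e` preserves faces and changes the sign.
  χ-coloop : ∀ {J T′ e} → T′ ∋ e → r (co (J Sub.∪ T′) [ e ]≔ true) ≡ r (co (J Sub.∪ T′)) → χ J T′ ≡ 0ℤ
  χ-coloop {J} {T′} {e} Te eq = ΣS-toggle {f = term J T′} e λ I I∌e →
    trans (cong (_+ term J T′ I) (flip I I∌e)) (ℤ.+-inverseˡ (term J T′ I))
    where
    same : ∀ I → I ⊑ T′ → cospanᵇ (J Sub.∪ (I [ e ]≔ true)) ≡ cospanᵇ (J Sub.∪ I)
    same I f = true⇔true
      (λ h → true-cospanᵇ (cospan-⊑ (∪-mono J (insert-⊒ I e)) (cospanᵇ-true h)))
      (λ h → true-cospanᵇ (subst Cospan (sym (∪-insert-out {J} {I}))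
               (cospan-coloop eq (co-∪-insert {J} f Te) (cospanᵇ-true h))))
    cond : ∀ I → (I [ e ]≔ true ⊆ᵇ T′) ∧ cospanᵇ (J Sub.∪ (I [ e ]≔ true)) ≡ (I ⊆ᵇ T′) ∧ cospanᵇ (J Sub.∪ I)
    cond I = trans (cong (_∧ cospanᵇ (J Sub.∪ (I [ e ]≔ true))) (⊆ᵇ-insert {T′} {I} Te)) (inner (I ⊆ᵇ T′) refl)
      where
      inner : ∀ b → (I ⊆ᵇ T′) ≡ b → b ∧ cospanᵇ (J Sub.∪ (I [ e ]≔ true)) ≡ b ∧ cospanᵇ (J Sub.∪ I)
      inner true  h = same I (⊆ᵇ⇒⊑ h)
      inner false h = refl
    flip : ∀ I → I ∌ e → term J T′ (I [ e ]≔ true) ≡ - term J T′ I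
    flip I I∌e = trans (cong₂ when (cond I) (signℤ-insert I I∌e)) (when-neg ((I ⊆ᵇ T′) ∧ cospanᵇ (J Sub.∪ I)) (signℤ ∣ I ∣))

  χ-empty : ∀ {J T′} → ¬ Cospan J → χ J T′ ≡ 0ℤ
  χ-empty {J} {T′} ¬c = ΣS-0 λ I → cong (λ b → when b (signℤ ∣ I ∣))
    (¬∋⇒∌ λ h → ¬c (cospan-⊑ (⊑-∪ˡ J I) (cospanᵇ-true (proj₂ (∧-true {I ⊆ᵇ T′} h)))))

  χ-base : ∀ {J} → Cospan J → χ J Sub.⊥ ≡ 1ℤ
  χ-base {J} c = trans (ΣS-single {f = term J Sub.⊥} Sub.⊥ other)
    (cong₂ when (true-∧ {Sub.⊥ {n} ⊆ᵇ Sub.⊥} (⊑⇒⊆ᵇ {A = Sub.⊥ {n}} ⊑-refl) (true-cospanᵇ (subst Cospan (sym (∪-⊥ J)) c)))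
      (cong signℤ (Subset.∣⊥∣≡0 n)))
    where
    other : ∀ I → I ≢ Sub.⊥ → term J Sub.⊥ I ≡ 0ℤ
    other I ne = when-∧-false (cospanᵇ (J Sub.∪ I)) (signℤ ∣ I ∣) (¬∋⇒∌ λ h →
      ne (⊑-antisym (⊆ᵇ⇒⊑ h) (sub λ e h′ → ∋∌-⊥ h′ (⊥-∌ e))))

  sign-split : ∀ d k₀ k₁ → signℤ (suc d) * + (k₀ ℕ.+ k₁) ≡ signℤ (suc d) * + k₀ - signℤ d * + k₁
  sign-split d k₀ k₁ = trans (cong (_*_ (signℤ (suc d))) (ℤ.pos-+ k₀ k₁)) (lem (signℤ d) (+ k₀) (+ k₁))
    where
    lem : ∀ s x y → - s * (x + y) ≡ - s * x - s * y
    lem = solve-∀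

  -- For disjoint `J` and `T′` with `Cospan J`, `dim-eq` says that `dim′` is the rank of `T′` in the
  -- dual after contracting `J`, written without subtraction. `euler` pins down the number of
  -- generators: homology in one degree has rank equal to the Euler characteristic up to sign.
  record IndependenceWedge (J T′ : Subset n) : Set where
    field
      {dim′ rk} : ℕ
      wedge : Wedge (X J T′ 0) dim′ rk
      euler : signℤ dim′ * + rk ≡ χ J T′
      dim-eq : dim′ ℕ.+ ρ ≡ ∣ T′ ∣ ℕ.+ r (co (J Sub.∪ T′))

  no-bases : ∀ {J T′ s} → X J T′ 0 s → ∀ B → s ∌ eB B
  no-bases x B = ¬∋⇒∌ λ h → ℕ.<⇒≱ (proj₂ (proj₂ (proj₂ (vertex x B h)))) z≤n

  wedge-base : ∀ {J} → Cospan J → IndependenceWedge J Sub.⊥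
  wedge-base {J} c = record
    { wedge  = point-wedge Sub.⊥ ⊥∈X only (Subset.∣⊥∣≡0 V)
    ; euler  = sym (χ-base c)
    ; dim-eq = trans (sym (cospan⇒rank c)) (sym (cong₂ ℕ._+_ (Subset.∣⊥∣≡0 n) (cong (r ∘ co) (∪-⊥ J))))
    }
    where
    tp⊥ : tp Sub.⊥ ⊑ Sub.⊥
    tp⊥ = sub λ e h → ∋∌-⊥ (trans (sym (tp-∋ Sub.⊥ e)) h) (⊥-∌ (eT e))
    ⊥∈X : X J Sub.⊥ 0 Sub.⊥
    ⊥∈X = record
      { ⊑T′    = tp⊥
      ; cospan = cospan-⊑ {J Sub.∪ tp Sub.⊥} {J} (sub λ e h → case ∪-∋ J (tp Sub.⊥) e h of λ
                   { (inj₁ p) → p ; (inj₂ q) → ∋∌-⊥ (at tp⊥ e q) (⊥-∌ e) }) c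
      ; vertex = λ B h → ∋∌-⊥ h (⊥-∌ (eB B))
      ; compar = λ A B h _ → ∋∌-⊥ h (⊥-∌ (eB A))
      }
    only : ∀ s → X J Sub.⊥ 0 s → s ≡ Sub.⊥
    only s x = ⊑-antisym (sub λ v h → go v h (vertex-cases v)) (sub λ v h → ∋∌-⊥ h (⊥-∌ v))
      where
      go : ∀ v → s ∋ v → (∃ λ e → eT e ≡ v) ⊎ (∃ λ B → eB B ≡ v) → Sub.⊥ ∋ v
      go v h (inj₁ (e , refl)) = ∋∌-⊥ (at (⊑T′ x) e (trans (tp-∋ s e) h)) (⊥-∌ e)
      go v h (inj₂ (B , refl)) = ∋∌-⊥ h (no-bases x B)

  module _ {J T′ : Subset n} {e : Fin n} {k : ℕ} (Te : T′ ∋ e) (Je : J ∌ e) (sz : ∣ T′ ∣ ≡ suc k) (c : Cospan J) where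
    private
      T″ J⁺ Y : Subset n
      T″ = T′ [ e ]≔ false
      J⁺ = J [ e ]≔ true
      Y  = co (J Sub.∪ T′)

      sz″ : ∣ T″ ∣ ≡ k
      sz″ = ∣remove∣-pred T′ Te sz

      Y-del : co (J Sub.∪ T″) ≡ Y [ e ]≔ true
      Y-del = trans (cong co eq) (co-remove (∪-∋ʳ J T′ e Te))
        where
        eq : J Sub.∪ T″ ≡ (J Sub.∪ T′) [ e ]≔ false
        eq = ⊑-antisym
          (sub λ x h → remove-∋ (J Sub.∪ T′) e x (λ { refl → ∋∌-⊥ h (∌-∪ J T″ x Je (remove-∌ x T′)) }) (at (∪-mono J (remove-⊑ T′ e)) x h))
          (sub λ x h → let (x≢e , h′) = ∋-remove (J Sub.∪ T′) e x h in case ∪-∋ J T′ x h′ of λ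
            { (inj₁ p) → ∪-∋ˡ J T″ x p ; (inj₂ q) → ∪-∋ʳ J T″ x (remove-∋ T′ e x x≢e q) })

    -- Every face can be enlarged by `e`, so the complex is a cone: no generators, and one dimension
    -- more than the deletion.
    wedge-coloop : r (Y [ e ]≔ true) ≡ r Y → IndependenceWedge J T″ → IndependenceWedge J T′
    wedge-coloop eq w = record
      { wedge  = cone-wedge (eT e) closed bound
      ; euler  = trans (ℤ.*-zeroʳ (signℤ (suc dim′))) (sym (χ-coloop {J} Te eq))
      ; dim-eq = trans (cong suc dim-eq) (cong₂ ℕ._+_ (trans (cong suc sz″) (sym sz)) (trans (cong r Y-del) eq))
      }
      where
      open IndependenceWedge w
      closed : ∀ s → X J T′ 0 s → X J T′ 0 (s [ eT e ]≔ true)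
      closed s x = record
        { ⊑T′    = subst (_⊑ T′) (sym (tp-eT s e true)) (insert-⊑ (⊑T′ x) Te)
        ; cospan = subst Cospan (sym (trans (cong (J Sub.∪_) (tp-eT s e true)) (∪-insert-out {J} {tp s})))
                     (cospan-coloop eq (co-∪-insert {J} (⊑T′ x) Te) (cospan x))
        ; vertex = λ B h → ∋∌-⊥ h (trans (eB-eT s e true B) (no-bases x B))
        ; compar = λ A B h _ → ∋∌-⊥ h (trans (eB-eT s e true A) (no-bases x A))
        }
      bound : ∀ s → X J T′ 0 s → ∣ s ∣ ≤ suc dim′
      bound s x = case-on (lookup s (eT e)) refl
        where
        case-on : ∀ b → lookup s (eT e) ≡ b → ∣ s ∣ ≤ suc dim′
        case-on false h = ℕ.m≤n⇒m≤1+n (Wedge.dim wedge s (X-del Te s x h))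
        case-on true  h = subst (_≤ suc dim′) (sym (∣remove∣ (eT e) s h)) (s≤s (Wedge.dim wedge (s [ eT e ]≔ false)
          (X-shrink Te (s [ eT e ]≔ false) (X-link Te (s [ eT e ]≔ false) (remove-∌ (eT e) s)
            (subst (X J T′ 0) (sym (insert-remove (eT e) s h)) x)))))

    module _ (neq : r (Y [ e ]≔ true) ≢ r Y) where
      rank-suc : r (Y [ e ]≔ true) ≡ suc (r Y)
      rank-suc = ℕ.≤-antisym (rank-insert Y e) (ℕ.≤∧≢⇒< (rank-mono (insert-⊒ Y e)) (neq ∘ sym))

      dim-del : ∀ {d} → d ℕ.+ ρ ≡ ∣ T″ ∣ ℕ.+ r (co (J Sub.∪ T″)) → d ℕ.+ ρ ≡ ∣ T′ ∣ ℕ.+ r Y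
      dim-del eq = trans eq (trans (cong₂ ℕ._+_ sz″ (trans (cong r Y-del) rank-suc))
                     (trans (ℕ.+-suc k (r Y)) (cong (ℕ._+ r Y) (sym sz))))

      -- No face contains `e`, so the complex equals its deletion.
      wedge-loop : ¬ Cospan J⁺ → IndependenceWedge J T″ → IndependenceWedge J T′
      wedge-loop ¬c w = record
        { wedge  = Wedge-⇔ (λ s x → proj₁ (X-del⁻¹ {T′ = T′} Te s x)) (λ s x → X-del {T′ = T′} Te s x (s∌e s x)) wedge
        ; euler  = trans euler (sym (trans (χ-split {J} {T′} Te) (trans (cong (λ z → χ J T″ - z) (χ-empty {J⁺} {T″} ¬c)) (ℤ.+-identityʳ (χ J T″)))))
        ; dim-eq = dim-del {dim′} dim-eq
        }
        where
        open IndependenceWedge w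
        s∌e : ∀ s → X J T′ 0 s → s ∌ eT e
        s∌e s x = ¬∋⇒∌ λ h → ¬c (cospan-⊑ (insert-⊑ (⊑-∪ˡ J (tp s)) (∪-∋ʳ J (tp s) e (trans (tp-∋ s e) h))) (cospan x))

      wedge-split : IndependenceWedge J T″ → IndependenceWedge J⁺ T″ → IndependenceWedge J T′
      wedge-split w₀ w₁ = record
        { wedge  = Wedge-split (X-split Te) (subst (λ d → Wedge (X J T″ 0) d W₀.rk) d-eq W₀.wedge) W₁.wedge
        ; euler  = trans (sign-split W₁.dim′ W₀.rk W₁.rk) (trans (cong₂ _-_
                     (trans (cong (λ d → signℤ d * + W₀.rk) (sym d-eq)) W₀.euler) W₁.euler) (sym (χ-split {J} {T′} Te)))
        ; dim-eq = trans (cong (ℕ._+ ρ) (sym d-eq)) dim₀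
        }
        where
        module W₀ = IndependenceWedge w₀
        module W₁ = IndependenceWedge w₁
        dim₀ : W₀.dim′ ℕ.+ ρ ≡ ∣ T′ ∣ ℕ.+ r Y
        dim₀ = dim-del {W₀.dim′} W₀.dim-eq
        dim₁ : suc W₁.dim′ ℕ.+ ρ ≡ ∣ T′ ∣ ℕ.+ r Y
        dim₁ = trans (cong suc W₁.dim-eq) (cong₂ ℕ._+_ (trans (cong suc sz″) (sym sz)) (cong (r ∘ co) (∪-assoc-insert J T′ Te)))
        -- `Wedge-split` needs the link exactly one dimension below the deletion. This is where `e`
        -- not being a coloop enters, through `rank-suc`.
        d-eq : W₀.dim′ ≡ suc W₁.dim′
        d-eq = ℕ.+-cancelʳ-≡ ρ _ _ (trans dim₀ (sym dim₁))

  -- Deletion and contraction of `e` in the dual matroid: coloop, loop, or neither.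
  independence-wedge : ∀ k J T′ → ∣ T′ ∣ ≡ k → (∀ e → T′ ∋ e → J ∌ e) → Cospan J → IndependenceWedge J T′
  independence-wedge zero    J T′ sz disj c = subst (IndependenceWedge J) (sym (size-0 T′ sz)) (wedge-base c)
  independence-wedge (suc k) J T′ sz disj c = go (r (co (J Sub.∪ T′) [ e ]≔ true) ℕ.≟ r (co (J Sub.∪ T′))) (cospan? J⁺)
    where
    e  = proj₁ (size-suc T′ sz)
    Te = proj₂ (size-suc T′ sz)
    T″ = T′ [ e ]≔ false
    J⁺ = J [ e ]≔ true
    sz″ = ∣remove∣-pred T′ Te sz
    w₀ : IndependenceWedge J T″
    w₀ = independence-wedge k J T″ sz″ (λ x h → disj x (at (remove-⊑ T′ e) x h)) c
    disj⁺ : ∀ x → T″ ∋ x → J⁺ ∌ x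
    disj⁺ x h = let (x≢e , T′x) = ∋-remove T′ e x h in trans (insert-≢ J true x≢e) (disj x T′x)
    go : Dec (r (co (J Sub.∪ T′) [ e ]≔ true) ≡ r (co (J Sub.∪ T′))) → Dec (Cospan J⁺) → IndependenceWedge J T′
    go (yes eq) _       = wedge-coloop Te (disj e Te) sz c eq w₀
    go (no neq) (no ¬c) = wedge-loop Te (disj e Te) sz c neq ¬c w₀
    go (no neq) (yes c⁺) = wedge-split Te (disj e Te) sz c neq w₀ (independence-wedge k J⁺ T″ sz″ disj⁺ c⁺)

-- The Möbius function of the lattice of flats

ΣS-swap : ∀ {m n} (f : Subset m → Subset n → ℤ) → ΣS (λ z → ΣS (f z)) ≡ ΣS (λ A → ΣS (λ z → f z A))
ΣS-swap {zero}  f = refl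
ΣS-swap {suc m} f = trans (ΣS-cong (λ z → sym (ΣS-+ (f (true ∷ z)) (f (false ∷ z)))))
  (ΣS-swap (λ z A → f (true ∷ z) A + f (false ∷ z) A))

ΣS-when : ∀ b (f : Subset n → ℤ) → when b (ΣS f) ≡ ΣS (λ s → when b (f s))
ΣS-when     true  f = refl
ΣS-when {n} false f = sym (ΣS-0 {n} (λ _ → refl))

sum-filter : ∀ {A : Set} (p : A → Bool) (g : A → ℤ) xs →
  sumℤ (map g (filterᵇ p xs)) ≡ sumℤ (map (λ z → when (p z) (g z)) xs)
sum-filter p g []       = refl
sum-filter p g (x ∷ xs) with p x
... | true  = cong (_+_ (g x)) (sum-filter p g xs)
... | false = trans (sum-filter p g xs) (sym (ℤ.+-identityˡ _))

sum-subsets : (f : Subset n → ℤ) → sumℤ (map f (subsets n)) ≡ ΣS f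
sum-subsets {zero}  f = ℤ.+-identityʳ (f [])
sum-subsets {suc n} f = trans (go (subsets n)) (sum-subsets (λ s → f (true ∷ s) + f (false ∷ s)))
  where
  go : ∀ xs → sumℤ (map f (concatMap (λ s → (true ∷ s) ∷ (false ∷ s) ∷ []) xs)) ≡
              sumℤ (map (λ s → f (true ∷ s) + f (false ∷ s)) xs)
  go []       = refl
  go (x ∷ xs) = trans (sym (ℤ.+-assoc (f (true ∷ x)) (f (false ∷ x)) _)) (cong (_+_ (f (true ∷ x) + f (false ∷ x))) (go xs))

module Flats {n : ℕ} (N : IndepSystem n) (mat : IsMatroid N) where
  open Matroid N mat

  private
    G : Subset n
    G = ground N
    cl : Subset n → Subset n
    cl = closure N

  lookup-cl : ∀ A e → lookup (cl A) e ≡ lookup G e ∧ (rank N (A [ e ]≔ true) ℕ.≡ᵇ rank N A)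
  lookup-cl A e = trans (Vec.lookup∘tabulate _ e) (cong (λ B → lookup G e ∧ (rank N B ℕ.≡ᵇ rank N A)) (∪⁅⁆≡insert A e))

  cl-∋ : ∀ {A e} → cl A ∋ e → G ∋ e × rank N (A [ e ]≔ true) ≡ rank N A
  cl-∋ {A} {e} h with a , b ← ∧-true {lookup G e} (trans (sym (lookup-cl A e)) h) = a , ≡ᵇ-true b

  ∋-cl : ∀ {A e} → G ∋ e → rank N (A [ e ]≔ true) ≡ rank N A → cl A ∋ e
  ∋-cl {A} {e} a b = trans (lookup-cl A e) (true-∧ a (true-≡ᵇ b))

  cl⊑G : ∀ {A} → cl A ⊑ G
  cl⊑G {A} = sub λ e h → proj₁ (cl-∋ {A} h)

  cl-⊒ : ∀ {A} → A ⊑ G → A ⊑ cl A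
  cl-⊒ {A} f = sub λ e h → ∋-cl {A} (at f e h) (cong (rank N) (insert-idem e A h))

  cl-mono : ∀ {A B} → A ⊑ B → cl A ⊑ cl B
  cl-mono {A} {B} f = sub λ e h → let (a , b) = cl-∋ {A} h in ∋-cl {B} a (rank-insert-≡ e f b)

  rank-cl : ∀ {A} → A ⊑ G → rank N (cl A) ≡ rank N A
  rank-cl {A} f with I , I⊑ , hI , sI ← rank-attained A | J , J⊑ , hJ , sJ ← rank-attained (cl A) =
    ℕ.≤-antisym (subst₂ _≤_ sJ sI (ℕ.≮⇒≥ absurd)) (rank-mono (cl-⊒ f))
    where
    absurd : ¬ ∣ I ∣ < ∣ J ∣
    absurd lt with e , Je , Ie , hIe ← augment hI hJ lt =
      ℕ.<-irrefl sI (subst₂ _≤_ (∣insert∣ e I Ie) (proj₂ (cl-∋ {A} (at J⊑ e Je))) (rank-ub (insert-mono e I⊑) hIe))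

  cl-idem : ∀ {A} → A ⊑ G → cl (cl A) ≡ cl A
  cl-idem {A} f = ⊑-antisym (sub go) (cl-⊒ (cl⊑G {A}))
    where
    go : ∀ e → cl (cl A) ∋ e → cl A ∋ e
    go e h with a , b ← cl-∋ {cl A} h = ∋-cl {A} a (ℕ.≤-antisym
      (subst (rank N (A [ e ]≔ true) ≤_) (trans b (rank-cl f)) (rank-mono (insert-mono e (cl-⊒ f)))) (rank-mono (insert-⊒ A e)))

  Flat : Subset n → Set
  Flat F = F ⊑ G × cl F ≡ F

  isFlat⇒ : ∀ {F} → isFlat N F ≡ true → Flat F
  isFlat⇒ {F} h with a , b ← ∧-true {F ⊆ᵇ G} h = ⊆ᵇ⇒⊑ a , eqᵇ⇒≡ b

  ⇒isFlat : ∀ {F} → Flat F → isFlat N F ≡ true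
  ⇒isFlat {F} (a , b) = true-∧ {F ⊆ᵇ G} (⊑⇒⊆ᵇ a) (trans (cong (λ A → eqᵇ A F) b) (eqᵇ-refl F))

  G-flat : Flat G
  G-flat = ⊑-refl , ⊑-antisym (cl⊑G {G}) (cl-⊒ ⊑-refl)

  ⊥⊑ : ∀ {A : Subset n} → Sub.⊥ ⊑ A
  ⊥⊑ = sub λ e h → ∋∌-⊥ h (⊥-∌ e)

  spans : Subset n → Subset n → Bool
  spans F A = (A ⊆ᵇ G) ∧ eqᵇ (cl A) F

  -- Crapo's formula for the Möbius function from the bottom to the flat F of a loopless matroid.
  μΣ : Subset n → ℤ
  μΣ F = ΣS (λ A → when (spans F A) (signℤ ∣ A ∣))

  Loopless : Set
  Loopless = ∀ e → G ∋ e → Ind Sub.⁅ e ⁆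

  module _ (ll : Loopless) where
    cl-⊥ : cl Sub.⊥ ≡ Sub.⊥
    cl-⊥ = ⊑-antisym (sub go) ⊥⊑
      where
      go : ∀ e → cl Sub.⊥ ∋ e → Sub.⊥ ∋ e
      go e h with a , b ← cl-∋ {Sub.⊥} h = ⊥-elim (ℕ.<⇒≱ (s≤s z≤n)
        (subst₂ _≤_ (∣insert∣ e Sub.⊥ (⊥-∌ e)) (trans b (trans (rank-ind indep-⊥) (Subset.∣⊥∣≡0 n)))
          (rank-ub {Sub.⊥ [ e ]≔ true} ⊑-refl (subst Ind eq (ll e a)))))
        where
        indep-⊥ : Ind Sub.⊥
        indep-⊥ = IsMatroid.indep-empty mat
        eq : Sub.⁅ e ⁆ ≡ Sub.⊥ [ e ]≔ true
        eq = trans (sym (Subset.∪-identityˡ Sub.⁅ e ⁆)) (∪⁅⁆≡insert Sub.⊥ e)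

    private
      below : Subset n → Subset n → Bool
      below F z = isFlat N z ∧ (botFlat N ⊆ᵇ z) ∧ (z ⊆ᵇ F) ∧ not (eqᵇ z F)

      inside-G : Subset n → Subset n → Bool
      inside-G F A = (A ⊆ᵇ G) ∧ ((A ⊆ᵇ F) ∧ not (eqᵇ (cl A) F))

    μΣ-⊥ : μΣ Sub.⊥ ≡ 1ℤ
    μΣ-⊥ = trans (ΣS-single {f = λ A → when (spans Sub.⊥ A) (signℤ ∣ A ∣)} Sub.⊥ other)
      (cong₂ when (true-∧ {Sub.⊥ ⊆ᵇ G} (⊑⇒⊆ᵇ {A = Sub.⊥} {G} ⊥⊑)
        (trans (cong (λ A → eqᵇ A Sub.⊥) cl-⊥) (eqᵇ-refl (Sub.⊥ {n})))) (cong signℤ (Subset.∣⊥∣≡0 n)))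
      where
      other : ∀ A → A ≢ Sub.⊥ → when (spans Sub.⊥ A) (signℤ ∣ A ∣) ≡ 0ℤ
      other A ne = cong (λ b → when b (signℤ ∣ A ∣)) (¬∋⇒∌ λ h → let (a , b) = ∧-true {A ⊆ᵇ G} h in
        ne (⊑-antisym (subst (A ⊑_) (eqᵇ⇒≡ b) (cl-⊒ (⊆ᵇ⇒⊑ a))) ⊥⊑))

    below-cl : ∀ {F A} → Flat F → A ⊑ G → below F (cl A) ≡ (A ⊆ᵇ F) ∧ not (eqᵇ (cl A) F)
    below-cl {F} {A} (F⊑G , clF) f = true⇔true
      (λ h → let h₁ = proj₂ (∧-true {botFlat N ⊆ᵇ cl A} (proj₂ (∧-true {isFlat N (cl A)} h)))
                 (a , b) = ∧-true {cl A ⊆ᵇ F} h₁ in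
        true-∧ {A ⊆ᵇ F} (⊑⇒⊆ᵇ (⊑-trans (cl-⊒ f) (⊆ᵇ⇒⊑ {A = cl A} {F} a))) b)
      (λ h → let (a , b) = ∧-true {A ⊆ᵇ F} h in
        true-∧ {isFlat N (cl A)} (⇒isFlat {cl A} (cl⊑G {A} , cl-idem f))
          (true-∧ {botFlat N ⊆ᵇ cl A} (⊑⇒⊆ᵇ (cl-mono {Sub.⊥} {A} ⊥⊑))
            (true-∧ {cl A ⊆ᵇ F} (⊑⇒⊆ᵇ (subst (cl A ⊑_) clF (cl-mono (⊆ᵇ⇒⊑ {A = A} {F} a)))) b)))

    -- Each `A` spans exactly one flat, its closure, so the sum over the flats strictly below `F`
    -- has at most one nonzero term.
    inner-sum : ∀ {F} → Flat F → ∀ A →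
      ΣS (λ z → when (below F z) (when (spans z A) (signℤ ∣ A ∣))) ≡ when (inside-G F A) (signℤ ∣ A ∣)
    inner-sum {F} fl A = trans (ΣS-single {f = g} (cl A) other) (value (A ⊆ᵇ G) refl)
      where
      g : Subset n → ℤ
      g z = when (below F z) (when (spans z A) (signℤ ∣ A ∣))
      when-0 : ∀ b → when b 0ℤ ≡ 0ℤ
      when-0 true  = refl
      when-0 false = refl
      other : ∀ z → z ≢ cl A → g z ≡ 0ℤ
      other z ne = trans (cong (λ b → when (below F z) (when b (signℤ ∣ A ∣)))
        (¬∋⇒∌ λ h → ne (sym (eqᵇ⇒≡ (proj₂ (∧-true {A ⊆ᵇ G} h)))))) (when-0 (below F z))
      value : ∀ b → (A ⊆ᵇ G) ≡ b → g (cl A) ≡ when (inside-G F A) (signℤ ∣ A ∣)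
      value false h = trans (cong (λ b → when (below F (cl A)) (when (b ∧ eqᵇ (cl A) (cl A)) (signℤ ∣ A ∣))) h)
        (trans (when-0 (below F (cl A))) (cong (λ b → when (b ∧ ((A ⊆ᵇ F) ∧ not (eqᵇ (cl A) F))) (signℤ ∣ A ∣)) (sym h)))
      value true h = trans (cong₂ (λ b c → when b (when c (signℤ ∣ A ∣))) (below-cl {F} {A} fl (⊆ᵇ⇒⊑ h)) (true-∧ {A ⊆ᵇ G} h (eqᵇ-refl (cl A))))
        (cong (λ b → when (b ∧ ((A ⊆ᵇ F) ∧ not (eqᵇ (cl A) F))) (signℤ ∣ A ∣)) (sym h))

    split-sum : ∀ {F} → Flat F → ∀ A →
      when (spans F A) (signℤ ∣ A ∣) + when (inside-G F A) (signℤ ∣ A ∣) ≡ when (A ⊆ᵇ F) (signℤ ∣ A ∣)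
    split-sum {F} (F⊑G , clF) A = table (A ⊆ᵇ G) (eqᵇ (cl A) F) (A ⊆ᵇ F)
      (λ a b → ⊑⇒⊆ᵇ (subst (A ⊑_) (eqᵇ⇒≡ {A = cl A} {F} b) (cl-⊒ (⊆ᵇ⇒⊑ a)))) (λ c → ⊑⇒⊆ᵇ (⊑-trans (⊆ᵇ⇒⊑ {A = A} {F} c) F⊑G))
      where
      x = signℤ ∣ A ∣
      table : ∀ a b c → (a ≡ true → b ≡ true → c ≡ true) → (c ≡ true → a ≡ true) →
        when (a ∧ b) x + when (a ∧ (c ∧ not b)) x ≡ when c x
      table true  true  true  f g = ℤ.+-identityʳ x
      table true  true  false f g with () ← f refl refl
      table true  false true  f g = ℤ.+-identityˡ x
      table true  false false f g = refl
      table false b     true  f g with () ← g refl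
      table false b     false f g = refl

    total-0 : ∀ {F e} → F ∋ e → ΣS {n} (λ A → when (A ⊆ᵇ F) (signℤ ∣ A ∣)) ≡ 0ℤ
    total-0 {F} {e} Fe = ΣS-toggle {f = λ A → when (A ⊆ᵇ F) (signℤ ∣ A ∣)} e λ A A∌e →
      trans (cong₂ (λ b x → when b x + when (A ⊆ᵇ F) (signℤ ∣ A ∣)) (same A) (signℤ-insert A A∌e))
        (trans (cong (_+ when (A ⊆ᵇ F) (signℤ ∣ A ∣)) (when-neg (A ⊆ᵇ F) (signℤ ∣ A ∣))) (ℤ.+-inverseˡ (when (A ⊆ᵇ F) (signℤ ∣ A ∣))))
      where
      same : ∀ A → (A [ e ]≔ true ⊆ᵇ F) ≡ (A ⊆ᵇ F)
      same A = true⇔true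
        (λ h → ⊑⇒⊆ᵇ (⊑-trans (insert-⊒ A e) (⊆ᵇ⇒⊑ {B = F} h)))
        (λ h → ⊑⇒⊆ᵇ (insert-⊑ (⊆ᵇ⇒⊑ {A = A} {F} h) Fe))

    -- By induction the sum over smaller flats counts the `A` inside `F` that fail to span `F`;
    -- those that span it contribute the negative, as the alternating sum over all subsets of a
    -- nonempty `F` is zero. Flats strictly below `F` have fewer elements, so fuel above the size of
    -- `F` suffices.
    mobius≡μΣ : ∀ f F → Flat F → ∣ F ∣ < f → mobius N f F ≡ μΣ F
    mobius≡μΣ (suc f) F fl (s≤s le) = go (eqᵇ F (botFlat N)) refl
      where
      S : ℤ
      S = sumℤ (map (mobius N f) (filterᵇ (below F) (subsets n)))
      go : ∀ b → eqᵇ F (botFlat N) ≡ b → (if b then + 1 else - S) ≡ μΣ F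
      go true  h = trans (sym μΣ-⊥) (cong μΣ (sym (trans (eqᵇ⇒≡ {A = F} h) cl-⊥)))
      go false h = trans (cong -_ S-eq) (neg (trans (sym (ΣS-+ (λ A → when (spans F A) (signℤ ∣ A ∣)) (λ A → when (inside-G F A) (signℤ ∣ A ∣))))
          (trans (ΣS-cong (split-sum fl)) (total-0 {F} {e} Fe))))
        where
        neg : ∀ {x y} → x + y ≡ 0ℤ → - y ≡ x
        neg {x} {y} eq = trans (lem x y) (trans (cong (λ z → x - z) eq) (ℤ.+-identityʳ x))
          where
          lem : ∀ x y → - y ≡ x - (x + y)
          lem = solve-∀
        nonempty : ∃ λ e → F ∋ e
        nonempty with ∣ F ∣ in sz
        ... | suc k = size-suc F sz
        ... | zero  = ∋∌-⊥ (trans (cong₂ eqᵇ (size-0 F sz) cl-⊥) (eqᵇ-refl (Sub.⊥ {n}))) h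
        e  = proj₁ nonempty
        Fe = proj₂ nonempty
        IH : ∀ z → when (below F z) (mobius N f z) ≡ when (below F z) (μΣ z)
        IH z = case-on (below F z) refl
          where
          case-on : ∀ b → below F z ≡ b → when b (mobius N f z) ≡ when b (μΣ z)
          case-on false _ = refl
          case-on true  h =
            let (a , h₁) = ∧-true {isFlat N z} h
                (b , c) = ∧-true {z ⊆ᵇ F} (proj₂ (∧-true {botFlat N ⊆ᵇ z} h₁)) in
            mobius≡μΣ f z (isFlat⇒ {z} a) (ℕ.<-≤-trans (ℕ.≰⇒> λ ge →
              ∋∌-⊥ (trans (cong (eqᵇ z) (sym (⊑-size-≡ (⊆ᵇ⇒⊑ {A = z} {F} b) ge))) (eqᵇ-refl z)) (not-true c)) le)
        S-eq : S ≡ ΣS (λ A → when (inside-G F A) (signℤ ∣ A ∣))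
        S-eq = trans (sum-filter (below F) (mobius N f) (subsets n))
              (trans (sum-subsets (λ z → when (below F z) (mobius N f z)))
              (trans (ΣS-cong IH)
              (trans (ΣS-cong (λ z → ΣS-when (below F z) (λ A → when (spans z A) (signℤ ∣ A ∣))))
              (trans (ΣS-swap (λ z A → when (below F z) (when (spans z A) (signℤ ∣ A ∣)))) (ΣS-cong (inner-sum fl))))))

    muTilde-loopless : muTilde N ≡ ℤ.∣ μΣ G ∣
    muTilde-loopless = trans (cong (λ b → if b then ℤ.∣ mobius N (suc n) G ∣ else 0)
        (true-allᶠ _ (λ e → true-impl {lookup G e} (ll e))))
      (cong ℤ.∣_∣ (mobius≡μΣ (suc n) G G-flat (s≤s (Subset.∣p∣≤n G))))

  spans-rank : ∀ {A} → A ⊑ G → eqᵇ (cl A) G ≡ (rank N A ℕ.≡ᵇ rank N G)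
  spans-rank {A} f = true⇔true
    (λ h → true-≡ᵇ (trans (sym (rank-cl f)) (cong (rank N) (eqᵇ⇒≡ {A = cl A} {G} h))))
    (λ h → trans (cong (λ B → eqᵇ B G) (⊑-antisym (cl⊑G {A}) (sub λ e Ge → ∋-cl {A} Ge (ℕ.≤-antisym
      (subst (rank N (A [ e ]≔ true) ≤_) (sym (≡ᵇ-true h)) (rank-mono (insert-⊑ f Ge))) (rank-mono (insert-⊒ A e)))))) (eqᵇ-refl G))

-- Contraction

module Contraction {n : ℕ} (M : IndepSystem n) (full : ground M ≡ ⊤) (mat : IsMatroid M) (S : Subset n) where
  open Independence M full mat

  private
    N : IndepSystem n
    N = contractTo M S
    Q : Subset n
    Q = co S

  ground-N : ground N ≡ S
  ground-N = ⊑-antisym (sub λ e h → go e (co-∋ {Q} h)) (sub λ e h → ∋-co {Q} (¬∋⇒∌ λ q → ∋∌-⊥ h (co-∋ {S} q)))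
    where
    go : ∀ e → Q ∌ e → S ∋ e
    go e q with lookup S e in eq
    ... | true  = refl
    ... | false = ∋∌-⊥ (∋-co {S} eq) q

  private
    attained = rank-attained Q
    IQ : Subset n
    IQ = proj₁ attained
    IQ⊑ : IQ ⊑ Q
    IQ⊑ = proj₁ (proj₂ attained)
    hQ : Ind IQ
    hQ = proj₁ (proj₂ (proj₂ attained))
    sQ : ∣ IQ ∣ ≡ r Q
    sQ = proj₂ (proj₂ (proj₂ attained))

    disjoint : ∀ {I} → I ⊑ S → ∀ e → I ∋ e → IQ ∌ e
    disjoint f e h = ¬∋⇒∌ λ q → ∋∌-⊥ (at f e h) (co-∋ {S} (at IQ⊑ e q))

    size-∪ : ∀ {I} → I ⊑ S → ∣ I Sub.∪ IQ ∣ ≡ ∣ I ∣ ℕ.+ r Q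
    size-∪ {I} f = trans (∣∪∣-disjoint I IQ (disjoint f)) (cong (∣ I ∣ ℕ.+_) sQ)

    IQ-max : ∀ {L x} → Ind L → IQ ⊑ L → L ∋ x → Q ∋ x → IQ ∋ x
    IQ-max {L} {x} hL f Lx Qx with lookup IQ x in eq
    ... | true  = refl
    ... | false = ⊥-elim (ℕ.<-irrefl sQ (subst (_≤ r Q) (∣insert∣ x IQ eq)
                    (rank-ub (insert-⊑ IQ⊑ Qx) (ind-⊑ (insert-⊑ f Lx) hL))))

    -- A maximal independent subset `IQ` of the contracted part `Q` is fixed once and for all.
    -- Extending it inside `A ∪ Q` brings in no further element of `Q`, so all growth comes from
    -- `A`.
    extend-IQ : ∀ A → ∃ λ L → Ind L × IQ ⊑ L × (∀ e → L ∋ e → A ∋ e ⊎ IQ ∋ e) × ∣ L ∣ ≡ r (A Sub.∪ Q)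
    extend-IQ A = let
        (K , K⊑ , hK , sK) = rank-attained (A Sub.∪ Q)
        (L , hL , IQ⊑L , sup , sL) = extend hQ hK (subst₂ _≤_ (sym sQ) (sym sK)
          (rank-mono {Q} {A Sub.∪ Q} (sub λ e h → ∪-∋ʳ A Q e h)))
      in L , hL , IQ⊑L , (λ e h → case sup e h of λ
        { (inj₁ q) → inj₂ q
        ; (inj₂ k) → case ∪-∋ A Q e (at K⊑ e k) of λ { (inj₁ a) → inj₁ a ; (inj₂ q) → inj₂ (IQ-max hL IQ⊑L h q) } })
        , trans sL sK

  rank-∪ : ∀ k I → ∣ I ∣ ≡ k → ∀ Z → r (I Sub.∪ Z) ≤ k ℕ.+ r Z
  rank-∪ zero    I sz Z = ℕ.≤-reflexive (cong r (trans (cong (Sub._∪ Z) (size-0 I sz)) (Subset.∪-identityˡ Z)))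
  rank-∪ (suc k) I sz Z with e , Ie ← size-suc I sz =
    ℕ.≤-trans (rank-mono {I Sub.∪ Z} {(I′ Sub.∪ Z) [ e ]≔ true} (sub go))
      (ℕ.≤-trans (rank-insert (I′ Sub.∪ Z) e) (s≤s (rank-∪ k I′ (∣remove∣-pred I Ie sz) Z)))
    where
    I′ = I [ e ]≔ false
    go : ∀ x → (I Sub.∪ Z) ∋ x → (I′ Sub.∪ Z) [ e ]≔ true ∋ x
    go x h with x Fin.≟ e
    ... | yes refl = insert-∋ x (I′ Sub.∪ Z)
    ... | no x≢e   = at (insert-⊒ (I′ Sub.∪ Z) e) x (case ∪-∋ I Z x h of λ
      { (inj₁ a) → ∪-∋ˡ I′ Z x (remove-∋ I e x x≢e a) ; (inj₂ b) → ∪-∋ʳ I′ Z x b })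

  -- Independence in the contraction amounts to independence in `M` together with `IQ`: counting
  -- forces the extension of `IQ` inside `I ∪ Q` to use all of `I`.
  indep-N⇒ : ∀ {I} → indep N I ≡ true → I ⊑ S × Ind (I Sub.∪ IQ)
  indep-N⇒ {I} h = I⊑S , subst Ind L≡ hL
    where
    I⊑S : I ⊑ S
    I⊑S = subst (I ⊑_) ground-N (⊆ᵇ⇒⊑ (proj₁ (∧-true {I ⊆ᵇ ground N} h)))
    rk : r (I Sub.∪ Q) ≡ ∣ I ∣ ℕ.+ r Q
    rk = ≡ᵇ-true (proj₂ (∧-true {I ⊆ᵇ ground N} h))
    ext = extend-IQ I
    L   = proj₁ ext
    hL  = proj₁ (proj₂ ext)
    L≡ : L ≡ I Sub.∪ IQ
    L≡ = ⊑-size-≡ (sub λ e h → case proj₁ (proj₂ (proj₂ (proj₂ ext))) e h of λ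
        { (inj₁ a) → ∪-∋ˡ I IQ e a ; (inj₂ q) → ∪-∋ʳ I IQ e q })
      (ℕ.≤-reflexive (trans (size-∪ I⊑S) (trans (sym rk) (sym (proj₂ (proj₂ (proj₂ (proj₂ ext))))))))

  ⇒indep-N : ∀ {I} → I ⊑ S → Ind (I Sub.∪ IQ) → indep N I ≡ true
  ⇒indep-N {I} f h = true-∧ {I ⊆ᵇ ground N} (⊑⇒⊆ᵇ (subst (I ⊑_) (sym ground-N) f)) (true-≡ᵇ (ℕ.≤-antisym
    (rank-∪ ∣ I ∣ I refl Q) (subst (_≤ r (I Sub.∪ Q)) (size-∪ f) (rank-ub (∪-mono I IQ⊑) h))))

  contraction-matroid : IsMatroid N
  contraction-matroid = record
    { indep-ground = λ I h → proj₁ (∧-true {I ⊆ᵇ ground N} h)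
    ; indep-empty  = ⇒indep-N {Sub.⊥} (sub λ e h → ∋∌-⊥ h (⊥-∌ e)) (subst Ind (sym (Subset.∪-identityˡ IQ)) hQ)
    ; indep-down   = λ I J f h → let (I⊑S , hI) = indep-N⇒ {I} h ; J⊑I = ⊆ᵇ⇒⊑ {A = J} {I} f in
        ⇒indep-N {J} (⊑-trans J⊑I I⊑S) (ind-⊑ (sub λ e h → case ∪-∋ J IQ e h of λ
          { (inj₁ a) → ∪-∋ˡ I IQ e (at J⊑I e a) ; (inj₂ q) → ∪-∋ʳ I IQ e q }) hI)
    ; indep-aug    = aug
    }
    where
    aug : ∀ I J → indep N I ≡ true → indep N J ≡ true → ∣ I ∣ < ∣ J ∣ →
      Σ (Fin n) λ e → lookup J e ≡ true × lookup I e ≡ false × indep N (I Sub.∪ Sub.⁅ e ⁆) ≡ true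
    aug I J hI hJ lt = let
        (I⊑S , iI) = indep-N⇒ {I} hI
        (J⊑S , iJ) = indep-N⇒ {J} hJ
        (e , Je , Ie , h) = augment iI iJ (subst₂ _<_ (sym (size-∪ I⊑S)) (sym (size-∪ J⊑S)) (ℕ.+-monoˡ-< (r Q) lt))
        J∋e : J ∋ e
        J∋e = case ∪-∋ J IQ e Je of λ { (inj₁ a) → a ; (inj₂ q) → ∋∌-⊥ (∪-∋ʳ I IQ e q) Ie }
      in e , J∋e , ¬∋⇒∌ (λ a → ∋∌-⊥ (∪-∋ˡ I IQ e a) Ie) ,
         subst (λ K → indep N K ≡ true) (sym (∪⁅⁆≡insert I e))
           (⇒indep-N {I [ e ]≔ true} (insert-⊑ I⊑S (at J⊑S e J∋e)) (subst Ind (sym (insert-∪ I e)) h))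
      where
      insert-∪ : ∀ I e → (I [ e ]≔ true) Sub.∪ IQ ≡ (I Sub.∪ IQ) [ e ]≔ true
      insert-∪ I e = trans (sym (∪-insert I IQ e)) (∪-insert-out {I} {IQ})

  private
    module MN = Matroid N contraction-matroid

  rank-contraction : ∀ {A} → A ⊑ S → rank N A ℕ.+ r Q ≡ r (A Sub.∪ Q)
  rank-contraction {A} A⊑S = ℕ.≤-antisym le ge
    where
    le : rank N A ℕ.+ r Q ≤ r (A Sub.∪ Q)
    le with I , I⊑A , hI , sI ← MN.rank-attained A with I⊑S , iI ← indep-N⇒ {I} hI =
      subst (_≤ r (A Sub.∪ Q)) (trans (size-∪ I⊑S) (cong (ℕ._+ r Q) sI))
        (rank-ub {A Sub.∪ Q} (sub λ e h → case ∪-∋ I IQ e h of λ { (inj₁ a) → ∪-∋ˡ A Q e (at I⊑A e a) ; (inj₂ q) → ∪-∋ʳ A Q e (at IQ⊑ e q) }) iI)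
    ge : r (A Sub.∪ Q) ≤ rank N A ℕ.+ r Q
    ge with L , hL , IQ⊑L , sup , sL ← extend-IQ A =
      subst (_≤ rank N A ℕ.+ r Q) (trans (sym (size-∪ (⊑-trans I⊑A A⊑S))) (trans (cong ∣_∣ I∪IQ) sL))
        (ℕ.+-monoˡ-≤ (r Q) (MN.rank-ub {A} {I} I⊑A (⇒indep-N {I} (⊑-trans I⊑A A⊑S) (subst Ind (sym I∪IQ) hL))))
      where
      I = L Sub.─ IQ
      I⊑A : I ⊑ A
      I⊑A = sub λ e h → let (l , q) = ─-∋ L IQ e h in case sup e l of λ { (inj₁ a) → a ; (inj₂ q′) → ∋∌-⊥ q′ q }
      I∪IQ : I Sub.∪ IQ ≡ L
      I∪IQ = ⊑-antisym (sub λ e h → case ∪-∋ I IQ e h of λ { (inj₁ a) → proj₁ (─-∋ L IQ e a) ; (inj₂ q) → at IQ⊑L e q }) (sub back)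
        where
        back : ∀ e → L ∋ e → (I Sub.∪ IQ) ∋ e
        back e h with lookup IQ e in eq
        ... | true  = ∪-∋ʳ I IQ e eq
        ... | false = ∪-∋ˡ I IQ e (∋-─ L IQ e h eq)

-- The rank of the homology and the rank of M*|T

signℤ-+ : ∀ a b → signℤ (a ℕ.+ b) ≡ signℤ a * signℤ b
signℤ-+ zero    b = sym (ℤ.*-identityˡ (signℤ b))
signℤ-+ (suc a) b = trans (cong -_ (signℤ-+ a b)) (ℤ.neg-distribˡ-* (signℤ a) (signℤ b))

signℤ-square : ∀ a → signℤ a * signℤ a ≡ 1ℤ
signℤ-square zero    = refl
signℤ-square (suc a) = trans (lem (signℤ a)) (signℤ-square a)
  where
  lem : ∀ x → - x * - x ≡ x * x
  lem = solve-∀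

∣signℤ∣ : ∀ a → ℤ.∣ signℤ a ∣ ≡ 1
∣signℤ∣ zero    = refl
∣signℤ∣ (suc a) = trans (ℤ.∣-i∣≡∣i∣ (signℤ a)) (∣signℤ∣ a)

∣signℤ*∣ : ∀ a x → ℤ.∣ signℤ a * x ∣ ≡ ℤ.∣ x ∣
∣signℤ*∣ a x = trans (ℤ.abs-* (signℤ a) x) (trans (cong (ℕ._* ℤ.∣ x ∣) (∣signℤ∣ a)) (ℕ.*-identityˡ ℤ.∣ x ∣))

ΣS-scale : ∀ a (f : Subset n → ℤ) → ΣS (λ s → a * f s) ≡ a * ΣS f
ΣS-scale {zero}  a f = refl
ΣS-scale {suc n} a f = trans (ΣS-cong (λ s → sym (ℤ.*-distribˡ-+ a (f (true ∷ s)) (f (false ∷ s)))))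
  (ΣS-scale a (λ s → f (true ∷ s) + f (false ∷ s)))

_△_ : Subset n → Subset n → Subset n
_△_ = Vec.zipWith _xor_

-- Symmetric difference with `S` permutes all subsets and is complementation on the subsets of `S`,
-- so complements can be taken without first restricting the sum.
ΣS-△ : (S : Subset n) (f : Subset n → ℤ) → ΣS f ≡ ΣS (λ s → f (S △ s))
ΣS-△ []          f = refl
ΣS-△ (false ∷ S) f = ΣS-△ S (λ s → f (true ∷ s) + f (false ∷ s))
ΣS-△ (true ∷ S)  f = trans (ΣS-△ S (λ s → f (true ∷ s) + f (false ∷ s)))
  (ΣS-cong (λ s → ℤ.+-comm (f (true ∷ S △ s)) (f (false ∷ S △ s))))

lookup-△ : ∀ (S s : Subset n) e → lookup (S △ s) e ≡ lookup S e xor lookup s e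
lookup-△ S s e = Vec.lookup-zipWith _xor_ e S s

△-⊆ᵇ : (S s : Subset n) → ((S △ s) ⊆ᵇ S) ≡ (s ⊆ᵇ S)
△-⊆ᵇ S s = true⇔true (λ h → ⊑⇒⊆ᵇ {A = s} {S} (sub λ e → f e (lookup-△ S s e) (at (⊆ᵇ⇒⊑ {A = S △ s} {S} h) e)))
                     (λ h → ⊑⇒⊆ᵇ {A = S △ s} {S} (sub λ e → g e (lookup-△ S s e) (at (⊆ᵇ⇒⊑ {A = s} {S} h) e)))
  where
  f : ∀ e → lookup (S △ s) e ≡ lookup S e xor lookup s e → ((S △ s) ∋ e → S ∋ e) → s ∋ e → S ∋ e
  f e eq h p with lookup S e
  ... | true  = refl
  ... | false = h (trans eq p)
  g : ∀ e → lookup (S △ s) e ≡ lookup S e xor lookup s e → (s ∋ e → S ∋ e) → (S △ s) ∋ e → S ∋ e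
  g e eq h p with lookup S e
  ... | true  = refl
  ... | false = h (trans (sym eq) p)

∣△∣ : (S s : Subset n) → s ⊑ S → ∣ S △ s ∣ ℕ.+ ∣ s ∣ ≡ ∣ S ∣
∣△∣ []          []          f = refl
∣△∣ (true ∷ S)  (true ∷ s)  f = trans (ℕ.+-suc (∣ S △ s ∣) (∣ s ∣)) (cong suc (∣△∣ S s (⊑-tail f)))
∣△∣ (true ∷ S)  (false ∷ s) f = cong suc (∣△∣ S s (⊑-tail f))
∣△∣ (false ∷ S) (true ∷ s)  f with () ← at f zero refl
∣△∣ (false ∷ S) (false ∷ s) f = ∣△∣ S s (⊑-tail f)

signℤ-△ : (S s : Subset n) → s ⊑ S → signℤ ∣ S △ s ∣ ≡ signℤ ∣ S ∣ * signℤ ∣ s ∣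
signℤ-△ S s f = sym (begin
  signℤ ∣ S ∣ * y                    ≡⟨ cong (λ k → signℤ k * y) (∣△∣ S s f) ⟨
  signℤ (∣ S △ s ∣ ℕ.+ ∣ s ∣) * y    ≡⟨ cong (_* y) (signℤ-+ (∣ S △ s ∣) (∣ s ∣)) ⟩
  x * y * y                          ≡⟨ ℤ.*-assoc x y y ⟩
  x * (y * y)                        ≡⟨ cong (x *_) (signℤ-square ∣ s ∣) ⟩
  x * 1ℤ                             ≡⟨ ℤ.*-identityʳ x ⟩
  x                                  ∎)
  where
  open ≡-Reasoning
  x = signℤ ∣ S △ s ∣
  y = signℤ ∣ s ∣

module Invariants {n : ℕ} (M : IndepSystem n) (full : ground M ≡ ⊤) (mat : IsMatroid M) where
  open Independence M full mat

  module _ (S : Subset n) where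
    open Contraction M full mat S

    private
      N : IndepSystem n
      N = contractTo M S
      Q : Subset n
      Q = co S
      module FN = Flats N contraction-matroid

      △-∪ : ∀ {s} → s ⊑ S → (S △ s) Sub.∪ Q ≡ co (Sub.⊥ Sub.∪ s)
      △-∪ {s} f = ⊑-antisym (sub there′) (sub back)
        where
        ⊥∪s : ∀ e → s ∌ e → (Sub.⊥ Sub.∪ s) ∌ e
        ⊥∪s e h = ∌-∪ Sub.⊥ s e (⊥-∌ e) h
        there′ : ∀ e → ((S △ s) Sub.∪ Q) ∋ e → co (Sub.⊥ Sub.∪ s) ∋ e
        there′ e h with lookup s e in eq
        ... | false = ∋-co {Sub.⊥ Sub.∪ s} (⊥∪s e eq)
        ... | true  = case ∪-∋ (S △ s) Q e h of λ
          { (inj₁ a) → ∋∌-⊥ a (trans (lookup-△ S s e) (cong₂ _xor_ (at f e eq) eq))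
          ; (inj₂ q) → ∋∌-⊥ (at f e eq) (co-∋ {S} q) }
        back : ∀ e → co (Sub.⊥ Sub.∪ s) ∋ e → ((S △ s) Sub.∪ Q) ∋ e
        back e h with lookup S e in eq
        ... | false = ∪-∋ʳ (S △ s) Q e (∋-co {S} eq)
        ... | true  = ∪-∋ˡ (S △ s) Q e (trans (lookup-△ S s e) (cong₂ _xor_ eq
          (¬∋⇒∌ λ p → ∋∌-⊥ (∪-∋ʳ Sub.⊥ s e p) (co-∋ {Sub.⊥ Sub.∪ s} h))))

      -- The complement of `s` in `S`, together with the contracted part outside `S`, is the
      -- complement of `s` in the ground set; so it spans the contraction exactly when some basis
      -- avoids `s`.
      spans-co : ∀ s → FN.spans S (S △ s) ≡ (s ⊆ᵇ S) ∧ cospanᵇ (Sub.⊥ Sub.∪ s)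
      spans-co s = trans (cong (λ G → ((S △ s) ⊆ᵇ G) ∧ eqᵇ (closure N (S △ s)) S) ground-N)
        (trans (cong (_∧ eqᵇ (closure N (S △ s)) S) (△-⊆ᵇ S s)) (inner (s ⊆ᵇ S) refl))
        where
        inner : ∀ b → (s ⊆ᵇ S) ≡ b → b ∧ eqᵇ (closure N (S △ s)) S ≡ b ∧ cospanᵇ (Sub.⊥ Sub.∪ s)
        inner false h = refl
        inner true  h = trans (cong (eqᵇ (closure N A)) (sym ground-N)) (trans (FN.spans-rank A⊑G) (true⇔true
          (λ p → true-≡ᵇ (trans (sym rA) (trans (cong (ℕ._+ r Q) (≡ᵇ-true p)) rG)))
          (λ p → true-≡ᵇ (ℕ.+-cancelʳ-≡ (r Q) (rank N A) (rank N (ground N)) (trans rA (trans (≡ᵇ-true p) (sym rG)))))))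
          where
          A = S △ s
          s⊑S : s ⊑ S
          s⊑S = ⊆ᵇ⇒⊑ h
          A⊑S : A ⊑ S
          A⊑S = ⊆ᵇ⇒⊑ (trans (△-⊆ᵇ S s) h)
          A⊑G : A ⊑ ground N
          A⊑G = subst (A ⊑_) (sym ground-N) A⊑S
          rA : rank N A ℕ.+ r Q ≡ r (co (Sub.⊥ Sub.∪ s))
          rA = trans (rank-contraction A⊑S) (cong r (△-∪ s⊑S))
          rG : rank N (ground N) ℕ.+ r Q ≡ ρ
          rG = trans (cong (λ G → rank N G ℕ.+ r Q) ground-N) (trans (rank-contraction ⊑-refl)
            (cong r (⊑-antisym {A = S Sub.∪ Q} ⊑-ground (sub λ e _ → cover e))))
            where
            cover : ∀ e → (S Sub.∪ Q) ∋ e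
            cover e with lookup S e in eq
            ... | true  = ∪-∋ˡ S Q e eq
            ... | false = ∪-∋ʳ S Q e (∋-co {S} eq)

      μΣ≡χ : FN.μΣ S ≡ signℤ ∣ S ∣ * χ Sub.⊥ S
      μΣ≡χ = trans (ΣS-△ S (λ A → when (FN.spans S A) (signℤ ∣ A ∣)))
        (trans (ΣS-cong summand) (ΣS-scale (signℤ ∣ S ∣) (term Sub.⊥ S)))
        where
        summand : ∀ s → when (FN.spans S (S △ s)) (signℤ ∣ S △ s ∣) ≡ signℤ ∣ S ∣ * term Sub.⊥ S s
        summand s = trans (cong (λ b → when b (signℤ ∣ S △ s ∣)) (spans-co s)) (value (s ⊆ᵇ S) refl)
          where
          value : ∀ b → (s ⊆ᵇ S) ≡ b → when ((s ⊆ᵇ S) ∧ cospanᵇ (Sub.⊥ Sub.∪ s)) (signℤ ∣ S △ s ∣) ≡ signℤ ∣ S ∣ * term Sub.⊥ S s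
          value false h = trans (when-∧-false (cospanᵇ (Sub.⊥ Sub.∪ s)) (signℤ ∣ S △ s ∣) h)
            (sym (trans (cong (signℤ ∣ S ∣ *_) (when-∧-false (cospanᵇ (Sub.⊥ Sub.∪ s)) (signℤ ∣ s ∣) h)) (ℤ.*-zeroʳ (signℤ ∣ S ∣))))
          value true  h = trans (cong (when _) (signℤ-△ S s (⊆ᵇ⇒⊑ h))) (pull ((s ⊆ᵇ S) ∧ cospanᵇ (Sub.⊥ Sub.∪ s)))
            where
            pull : ∀ b → when b (signℤ ∣ S ∣ * signℤ ∣ s ∣) ≡ signℤ ∣ S ∣ * when b (signℤ ∣ s ∣)
            pull true  = refl
            pull false = sym (ℤ.*-zeroʳ (signℤ ∣ S ∣))

      -- A loop of the contraction lies in the closure of the contracted part, hence is a coloop of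
      -- the dual restricted to `S`.
      loop-χ : ∀ e → S ∋ e → indep N Sub.⁅ e ⁆ ≡ false → χ Sub.⊥ S ≡ 0ℤ
      loop-χ e Se dep = χ-coloop {Sub.⊥} {S} Se (subst (λ Z → r (co Z [ e ]≔ true) ≡ r (co Z)) (sym (Subset.∪-identityˡ S)) eq)
        where
        eq : r (Q [ e ]≔ true) ≡ r Q
        eq with r (Q [ e ]≔ true) ℕ.≟ r Q
        ... | yes p = p
        ... | no ne = ∋∌-⊥ (true-∧ {Sub.⁅ e ⁆ ⊆ᵇ ground N} (⊑⇒⊆ᵇ (subst (Sub.⁅ e ⁆ ⊑_) (sym ground-N) e⊑S))
          (true-≡ᵇ (trans (cong r (trans (Subset.∪-comm Sub.⁅ e ⁆ Q) (∪⁅⁆≡insert Q e)))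
            (trans (ℕ.≤-antisym (rank-insert Q e) (ℕ.≤∧≢⇒< (rank-mono (insert-⊒ Q e)) (ne ∘ sym)))
              (cong (ℕ._+ r Q) (sym (Subset.∣⁅x⁆∣≡1 e))))))) dep
          where
          e⊑S : Sub.⁅ e ⁆ ⊑ S
          e⊑S = sub λ x h → subst (S ∋_) (sym (Subset.x∈⁅y⁆⇒x≡y e (Vec.lookup⇒[]= x Sub.⁅ e ⁆ h))) Se

    muTilde≡∣χ∣ : muTilde N ≡ ℤ.∣ χ Sub.⊥ S ∣
    muTilde≡∣χ∣ = go (loopless N) refl
      where
      go : ∀ b → loopless N ≡ b → muTilde N ≡ ℤ.∣ χ Sub.⊥ S ∣
      go true  h = trans (FN.muTilde-loopless ll)
        (trans (cong (λ G → ℤ.∣ FN.μΣ G ∣) ground-N) (trans (cong ℤ.∣_∣ μΣ≡χ) (∣signℤ*∣ ∣ S ∣ (χ Sub.⊥ S))))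
        where
        ll : FN.Loopless
        ll e Ge = impl-true (allᶠ-true _ h e) Ge
      go false h = trans (cong (λ b → if b then ℤ.∣ mobius N (suc n) (ground N) ∣ else 0) h)
        (cong ℤ.∣_∣ (sym (loop-χ e (subst (_∋ e) ground-N Ge) dep)))
        where
        bad = all-false _ (allFin n) h
        e = proj₁ bad
        split : ∀ {a b} → not a ∨ b ≡ false → a ≡ true × b ≡ false
        split {true} {false} _ = refl , refl
        Ge  = proj₁ (split {lookup (ground N) e} (proj₂ bad))
        dep = proj₂ (split {lookup (ground N) e} (proj₂ bad))

    private
      M* : IndepSystem n
      M* = restrict (dual M) S

      indep*-true : ∀ {I} → indep M* I ≡ true → I ⊑ S × Cospan I
      indep*-true {I} h = let (a , b) = ∧-true {indep (dual M) I} h in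
        ⊆ᵇ⇒⊑ b , cospanᵇ-true (proj₂ (∧-true {I ⊆ᵇ ground M} a))

      true-indep* : ∀ {I} → I ⊑ S → Cospan I → indep M* I ≡ true
      true-indep* {I} f c = true-∧ {indep (dual M) I} (true-∧ {I ⊆ᵇ ground M} (⊑⇒⊆ᵇ {A = I} ⊑-ground) (true-cospanᵇ c)) (⊑⇒⊆ᵇ f)

    -- If a basis avoids `I`, then `S` without `I` together with `Q` has full rank `∣ S ∣`, which
    -- bounds `∣ I ∣` by the rank of `Q`. Conversely, completing a maximal independent subset of `Q`
    -- from `S` to a basis leaves out as many elements of `S` as that subset has.
    rank-dual : Basis S → rank M* S ≡ r (co S)
    rank-dual (hS , sS) = ℕ.≤-antisym le ge
      where
      upper : ∀ {I} → I ⊑ S → Cospan I → ∣ I ∣ ≤ r Q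
      upper {I} f c = ℕ.+-cancelˡ-≤ (∣ S △ I ∣) (∣ I ∣) (r Q) (ℕ.≤-trans
        (ℕ.≤-reflexive (trans (∣△∣ S I f) (trans sS (trans (sym (cospan⇒rank c))
          (cong r (trans (cong co (sym (Subset.∪-identityˡ I))) (sym (△-∪ f))))))))
        (rank-∪ (∣ S △ I ∣) (S △ I) refl Q))
      le : rank M* S ≤ r Q
      le with I , _ , h , sI ← size≡rank M* (true-indep* {Sub.⊥} (sub λ e h → ∋∌-⊥ h (⊥-∌ e)) cospan-⊥) S
        with f , c ← indep*-true {I} h = subst (_≤ r Q) sI (upper f c)
      ge : r Q ≤ rank M* S
      ge with J , J⊑Q , hJ , sJ ← rank-attained Q
        with B , hB , J⊑B , sup , sB ← extend hJ hS (subst (∣ J ∣ ≤_) (sym sS) (rank-ub ⊑-ground hJ))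
        = subst (_≤ rank M* S) (trans I≡J sJ) (size≤rank M* {S} {I} I⊑S (true-indep* {I} I⊑S
            (B , (hB , trans sB sS) , λ e h → proj₂ (─-∋ S B e h))))
        where
        I = S Sub.─ B
        P = B Sub.─ J
        I⊑S : I ⊑ S
        I⊑S = sub λ e h → proj₁ (─-∋ S B e h)
        P-∋ : ∀ e → B ∋ e → S ∋ e → P ∋ e
        P-∋ e b s = ∋-─ B J e b (¬∋⇒∌ λ j → ∋∌-⊥ s (co-∋ {S} (at J⊑Q e j)))
        P⊑S : P ⊑ S
        P⊑S = sub λ e h → let (b , j) = ─-∋ B J e h in case sup e b of λ { (inj₁ p) → ∋∌-⊥ p j ; (inj₂ s) → s }
        I∪P : I Sub.∪ P ≡ S
        I∪P = ⊑-antisym (sub λ e h → case ∪-∋ I P e h of λ { (inj₁ i) → at I⊑S e i ; (inj₂ p) → at P⊑S e p }) (sub back)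
          where
          back : ∀ e → S ∋ e → (I Sub.∪ P) ∋ e
          back e s with lookup B e in eq
          ... | true  = ∪-∋ʳ I P e (P-∋ e eq s)
          ... | false = ∪-∋ˡ I P e (∋-─ S B e s eq)
        J∪P : J Sub.∪ P ≡ B
        J∪P = ⊑-antisym (sub λ e h → case ∪-∋ J P e h of λ { (inj₁ j) → at J⊑B e j ; (inj₂ p) → proj₁ (─-∋ B J e p) }) (sub back)
          where
          back : ∀ e → B ∋ e → (J Sub.∪ P) ∋ e
          back e b with lookup J e in eq
          ... | true  = ∪-∋ˡ J P e eq
          ... | false = ∪-∋ʳ J P e (∋-─ B J e b eq)
        I≡J : ∣ I ∣ ≡ ∣ J ∣
        I≡J = ℕ.+-cancelʳ-≡ (∣ P ∣) (∣ I ∣) (∣ J ∣) (trans (sym (∣∪∣-disjoint I P λ e i → ¬∋⇒∌ λ p →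
            ∋∌-⊥ (proj₁ (─-∋ B J e p)) (proj₂ (─-∋ S B e i))))
          (trans (cong ∣_∣ I∪P) (trans (sym sB) (trans (cong ∣_∣ (sym J∪P)) (∣∪∣-disjoint J P λ e j → ¬∋⇒∌ λ p →
            ∋∌-⊥ j (proj₂ (─-∋ B J e p)))))))

  T-wedge : Wedge (X Sub.⊥ T 0) (rank (restrict (dual M) T) T) (muTilde (contractTo M T))
  T-wedge = subst₂ (Wedge (X Sub.⊥ T 0)) d-eq k-eq wedge
    where
    open IndependenceWedge (independence-wedge ∣ T ∣ Sub.⊥ T refl (λ e _ → ⊥-∌ e) cospan-⊥)
    d-eq : dim′ ≡ rank (restrict (dual M) T) T
    d-eq = trans (ℕ.+-cancelʳ-≡ ρ dim′ (r (co T)) (trans dim-eq (trans (ℕ.+-comm ∣ T ∣ (r (co (Sub.⊥ Sub.∪ T))))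
      (cong₂ ℕ._+_ (cong (r ∘ co) (Subset.∪-identityˡ T)) (proj₂ T-basis))))) (sym (rank-dual T T-basis))
    k-eq : rk ≡ muTilde (contractTo M T)
    k-eq = trans (sym (∣signℤ*∣ dim′ (+ rk))) (trans (cong ℤ.∣_∣ euler) (sym (muTilde≡∣χ∣ T)))

-- From chains of the order complex to chains on the full simplex

cone-scale : ∀ v a (c : Ch m) → cone v (λ s → a * c s) ≗ (λ s → a * cone v c s)
cone-scale v a c s = trans (cone-cong v (λ t → sym (ℤ.+-identityˡ (a * c t))) s)
  (trans (cone-lin v 0ᶜ a c s) (trans (cong (_+ a * cone v c s) (cone-0 v s)) (ℤ.+-identityˡ (a * cone v c s))))

-- No sign appears, because `v` precedes every element of `s`.
cone-δ : ∀ v (s : Subset m) → (∀ u → s ∋ u → v Fin.< u) → cone v (δ s) ≗ δ (s [ v ]≔ true)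
cone-δ zero    (true ∷ s)  h t with () ← h zero refl
cone-δ zero    (false ∷ s) h (true ∷ t)  = refl
cone-δ zero    (false ∷ s) h (false ∷ t) = refl
cone-δ (suc v) (true ∷ s)  h t with () ← h zero refl
cone-δ (suc v) (false ∷ s) h (false ∷ t) = cone-δ v s (λ u p → ℕ.≤-pred (h (suc u) p)) t
cone-δ (suc v) (false ∷ s) h (true ∷ t)  = cong -_ (cone-0 v t)

least : ∀ {m k} (s : Subset m) → ∣ s ∣ ≡ suc k → ∃ λ v → s ∋ v × (∀ u → s ∋ u → v Fin.≤ u)
least (true ∷ s)  h = zero , refl , λ u _ → z≤n
least (false ∷ s) h with v , p , f ← least s h = suc v , p , λ { (suc u) q → s≤s (f u q) }

bd-size-0 : {K : Cx m} {c : Ch m} → Supp K 0 c → bd c ≗ 0ᶜ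
bd-size-0 {c = c} h s = decidable-stable (_ ℤ.≟ _) λ ne → let (v , s∌v , ne₁) = bd-supp c s ne in
  ℕ.0≢1+n (trans (sym (proj₂ (h _ ne₁))) (∣insert∣ v s s∌v))

δ-Supp : ∀ {K : Cx m} {t} → K t → Supp K ∣ t ∣ (δ t)
δ-Supp {t = t} h s ne with refl ← δ-supp t s ne = h , refl

all-++ : ∀ {A : Set} (p : A → Bool) xs ys → all p xs ≡ true → all p ys ≡ true → all p (xs ++ ys) ≡ true
all-++ p []       ys h g = g
all-++ p (x ∷ xs) ys h g = true-∧ {p x} (proj₁ (∧-true {p x} h)) (all-++ p xs ys (proj₂ (∧-true {p x} h)) g)

lookup-removeAt : ∀ {A : Set} {j} (τ : Vec A (suc j)) k →
  ∃ λ (f : Fin j → Fin (suc j)) → (∀ {a b} → a Fin.< b → f a Fin.< f b) × (∀ a → lookup (Vec.removeAt τ k) a ≡ lookup τ (f a))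
lookup-removeAt (x ∷ τ)         zero    = suc , s≤s , λ a → refl
lookup-removeAt (x ∷ τ@(_ ∷ _)) (suc k) with f , mono , eq ← lookup-removeAt τ k =
  g , (λ {a} {b} → g-mono a b) , λ { zero → refl ; (suc a) → eq a }
  where
  g : Fin _ → Fin _
  g zero    = zero
  g (suc a) = suc (f a)
  g-mono : ∀ a b → a Fin.< b → g a Fin.< g b
  g-mono zero    (suc b) _       = s≤s z≤n
  g-mono (suc a) (suc b) (s≤s h) = s≤s (mono h)

vecEqᵇ⇒≡ : ∀ {n j} {σ τ : Vec (Subset n) j} → vecEqᵇ σ τ ≡ true → σ ≡ τ
vecEqᵇ⇒≡ {σ = σ} {τ} h = ext σ τ (λ a → eqᵇ⇒≡ {A = lookup σ a} (allᶠ-true _ h a))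
  where
  ext : ∀ {A : Set} {j} (σ τ : Vec A j) → (∀ a → lookup σ a ≡ lookup τ a) → σ ≡ τ
  ext []      []      f = refl
  ext (x ∷ σ) (y ∷ τ) f = cong₂ _∷_ (f zero) (ext σ τ (λ a → f (suc a)))

vecEqᵇ-refl : ∀ {n j} (σ : Vec (Subset n) j) → vecEqᵇ σ σ ≡ true
vecEqᵇ-refl σ = true-allᶠ _ (λ a → eqᵇ-refl (lookup σ a))

module Transfer {n : ℕ} (M : IndepSystem n) (full : ground M ≡ ⊤) (mat : IsMatroid M) where
  open Independence M full mat public

  -- The exterior product of the vertices makes Φ a chain map on arbitrary tuples, sorted or not.
  ω : ∀ {j} → Vec (Subset n) j → Ch V
  ω []      = δ Sub.⊥
  ω (B ∷ τ) = cone (eB B) (ω τ)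

  Φ : ∀ {j} → Chain n j → Ch V
  Φ []            s = 0ℤ
  Φ ((a , τ) ∷ c) s = a * ω τ s + Φ c s

  Φ-++ : ∀ {j} (c d : Chain n j) s → Φ (c ++ d) s ≡ Φ c s + Φ d s
  Φ-++ []            d s = sym (ℤ.+-identityˡ _)
  Φ-++ ((a , τ) ∷ c) d s = trans (cong (_+_ (a * ω τ s)) (Φ-++ c d s)) (sym (ℤ.+-assoc (a * ω τ s) (Φ c s) (Φ d s)))

  private
    faces : ∀ {j} → ℤ → Vec (Subset n) (suc j) → List (Fin (suc j)) → Chain n j
    faces a τ = map (λ k → (signℤ (Fin.toℕ k) * a , Vec.removeAt τ k))

    -- Removing an entry behind `B` keeps `B` in front and shifts the position by one, whence the
    -- cone and the sign.
    faces-suc : ∀ {j} a B (τ : Vec (Subset n) (suc j)) ks s →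
      Φ (faces a (B ∷ τ) (map suc ks)) s ≡ - cone (eB B) (Φ (faces a τ ks)) s
    faces-suc a B τ []       s = sym (cong -_ (cone-0 (eB B) s))
    faces-suc a B τ@(_ ∷ _) (k ∷ ks) s = begin
      - x * a * cone v y s + Φ (faces a (B ∷ τ) (map suc ks)) s       ≡⟨ cong (_+_ (- x * a * cone v y s)) (faces-suc a B τ ks s) ⟩
      - x * a * cone v y s + - cone v z s                              ≡⟨ lem x a (cone v y s) (cone v z s) ⟩
      - (x * a * cone v y s + cone v z s)                              ≡⟨ cong (λ w → - (w + cone v z s)) (cone-scale v (x * a) y s) ⟨
      - (cone v (λ t → x * a * y t) s + cone v z s)                    ≡⟨ cong -_ (cone-+ v (λ t → x * a * y t) z s) ⟨
      - cone v (λ t → x * a * y t + z t) s                             ∎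
      where
      open ≡-Reasoning
      v = eB B
      x = signℤ (Fin.toℕ k)
      y = ω (Vec.removeAt τ k)
      z = Φ (faces a τ ks)
      lem : ∀ x a y z → - x * a * y + - z ≡ - (x * a * y + z)
      lem = solve-∀

    bd-δ⊥ : bd (δ Sub.⊥) ≗ 0ᶜ {V}
    bd-δ⊥ = bd-size-0 {K = _≡ Sub.⊥} (subst (λ k → Supp (_≡ Sub.⊥) k (δ (Sub.⊥ {V}))) (Subset.∣⊥∣≡0 V) (δ-Supp refl))

    -- The alternating sum of faces is the Leibniz rule applied entry by entry; for a single entry
    -- it is the augmentation.
    bd-ω : ∀ {j} a (τ : Vec (Subset n) (suc j)) s → Φ (faces a τ (allFin (suc j))) s ≡ a * bd (ω τ) s
    bd-ω {zero} a (B ∷ []) s = begin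
      1ℤ * a * δ Sub.⊥ s + 0ℤ                       ≡⟨ lem a (δ Sub.⊥ s) ⟩
      a * δ Sub.⊥ s                                 ≡⟨ cong (a *_) (bd-cycle-cone (eB B) (δ Sub.⊥) bd-δ⊥ s) ⟨
      a * bd (cone (eB B) (δ Sub.⊥)) s              ∎
      where
      open ≡-Reasoning
      lem : ∀ a x → 1ℤ * a * x + 0ℤ ≡ a * x
      lem = solve-∀
    bd-ω {suc j} a (B ∷ τ) s = begin
      1ℤ * a * ω τ s + Φ (faces a (B ∷ τ) (Data.List.tabulate suc)) s    ≡⟨ cong (λ ks → 1ℤ * a * ω τ s + Φ (faces a (B ∷ τ) ks) s) (map-tabulate id suc) ⟨
      1ℤ * a * ω τ s + Φ (faces a (B ∷ τ) (map suc (allFin (suc j)))) s  ≡⟨ cong (_+_ (1ℤ * a * ω τ s)) (faces-suc a B τ (allFin (suc j)) s) ⟩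
      1ℤ * a * ω τ s + - cone v (Φ (faces a τ (allFin (suc j)))) s       ≡⟨ cong (λ w → 1ℤ * a * ω τ s + - w) (cone-cong v (bd-ω a τ) s) ⟩
      1ℤ * a * ω τ s + - cone v (λ t → a * bd (ω τ) t) s                 ≡⟨ cong (λ w → 1ℤ * a * ω τ s + - w) (cone-scale v a (bd (ω τ)) s) ⟩
      1ℤ * a * ω τ s + - (a * cone v (bd (ω τ)) s)                       ≡⟨ lem a (ω τ s) (cone v (bd (ω τ)) s) ⟩
      a * (ω τ s - cone v (bd (ω τ)) s)                                  ≡⟨ cong (a *_) (bd-cone v (ω τ) s) ⟨
      a * bd (cone v (ω τ)) s                                            ∎
      where
      open ≡-Reasoning
      v = eB B
      lem : ∀ a x y → 1ℤ * a * x + - (a * y) ≡ a * (x - y)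
      lem = solve-∀

  Φ-∂ : ∀ {j} (c : Chain n (suc j)) → bd (Φ c) ≗ Φ (∂ c)
  Φ-∂ []            s = bd-0 s
  Φ-∂ {j} ((a , τ) ∷ c) s = begin
    bd (λ t → a * ω τ t + Φ c t) s          ≡⟨ bd-cong (λ t → ℤ.+-comm (a * ω τ t) (Φ c t)) s ⟩
    bd (Φ c +[ a ] ω τ) s                   ≡⟨ bd-lin (Φ c) a (ω τ) s ⟩
    bd (Φ c) s + a * bd (ω τ) s             ≡⟨ ℤ.+-comm (bd (Φ c) s) (a * bd (ω τ) s) ⟩
    a * bd (ω τ) s + bd (Φ c) s             ≡⟨ cong₂ _+_ (sym (bd-ω a τ s)) (Φ-∂ c s) ⟩
    Φ (faces a τ (allFin (suc j))) s + Φ (∂ c) s  ≡⟨ Φ-++ (faces a τ (allFin (suc j))) (∂ c) s ⟨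
    Φ (∂ ((a , τ) ∷ c)) s                   ∎
    where open ≡-Reasoning

  record Valid {j : ℕ} (τ : Vec (Subset n) j) : Set where
    constructor mkValid
    field
      vertices   : ∀ a → Basis (lookup τ a) × lookup τ a ≢ T
      increasing : ∀ a b → a Fin.< b → LT (lookup τ a) (lookup τ b)
  open Valid

  valid⇒Valid : ∀ {j} {τ : Vec (Subset n) j} → validSimplex M τ ≡ true → Valid τ
  valid⇒Valid {j} {τ} h = mkValid vert pair
    where
    h₁ = proj₁ (∧-true {allᶠ (λ a → isVertex M (lookup τ a))} h)
    h₂ = proj₂ (∧-true {allᶠ (λ a → isVertex M (lookup τ a))} h)
    vert : ∀ a → Basis (lookup τ a) × lookup τ a ≢ T
    vert a = let (p , q) = ∧-true {isBasis M (lookup τ a)} (allᶠ-true _ h₁ a) in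
      isBasis⇒Basis p , λ eq → ∋∌-⊥ (trans (cong (eqᵇ (lookup τ a)) (sym (trans eq T≡topBasis))) (eqᵇ-refl (lookup τ a))) (not-true q)
    pair : ∀ a b → a Fin.< b → LT (lookup τ a) (lookup τ b)
    pair a b lt = let (p , q) = ∧-true {extLeq M (lookup τ a) (lookup τ b)}
                        (impl-true (allᶠ-true _ (allᶠ-true _ h₂ a) b) (T⇒true (ℕ.<⇒<ᵇ lt))) in
      LT-intro p (λ eq → ∋∌-⊥ (trans (cong (eqᵇ (lookup τ a)) (sym eq)) (eqᵇ-refl (lookup τ a))) (not-true q))

  Valid⇒valid : ∀ {j} {τ : Vec (Subset n) j} → Valid τ → validSimplex M τ ≡ true
  Valid⇒valid {j} {τ} (mkValid vert pair) = true-∧ {allᶠ (λ a → isVertex M (lookup τ a))}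
    (true-allᶠ _ λ a → true-∧ (Basis⇒isBasis (proj₁ (vert a))) (true-not (eqᵇ-≢ λ eq → proj₂ (vert a) (trans eq (sym T≡topBasis)))))
    (true-allᶠ _ λ a → true-allᶠ _ λ b → true-impl λ h → let (p , q) = LT-elim (pair a b (ℕ.<ᵇ⇒< _ _ (subst Data.Bool.T (sym h) _))) in
      true-∧ {extLeq M (lookup τ a) (lookup τ b)} p (true-not (eqᵇ-≢ q)))

  Valid-tail : ∀ {j B} {τ : Vec (Subset n) j} → Valid (B ∷ τ) → Valid τ
  Valid-tail (mkValid vert pair) = mkValid (λ a → vert (suc a)) λ a b lt → pair (suc a) (suc b) (s≤s lt)

  Valid-removeAt : ∀ {j} {τ : Vec (Subset n) (suc j)} → Valid τ → ∀ k → Valid (Vec.removeAt τ k)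
  Valid-removeAt {τ = τ} (mkValid vert pair) k with f , mono , eq ← lookup-removeAt τ k =
    mkValid (λ a → subst (λ B → Basis B × B ≢ T) (sym (eq a)) (vert (f a)))
    λ a b lt → subst₂ LT (sym (eq a)) (sym (eq b)) (pair (f a) (f b) (mono lt))

  enc : ∀ {j} → Vec (Subset n) j → Subset V
  enc []      = Sub.⊥
  enc (B ∷ τ) = enc τ [ eB B ]≔ true

  enc-∋ : ∀ {j} (τ : Vec (Subset n) j) v → enc τ ∋ v → ∃ λ a → v ≡ eB (lookup τ a)
  enc-∋ []      v h = ∋∌-⊥ h (⊥-∌ v)
  enc-∋ (B ∷ τ) v h = case ∋-insert (enc τ) (eB B) v h of λ
    { (inj₁ p) → zero , p ; (inj₂ q) → let (a , eq) = enc-∋ τ v q in suc a , eq }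

  eB-mono : ∀ {A B} → A ≺ B → eB A Fin.< eB B
  eB-mono {A} {B} h = subst₂ _<_ (sym (Fin.toℕ-↑ʳ n (code A))) (sym (Fin.toℕ-↑ʳ n (code B))) (ℕ.+-monoʳ-< n (code-mono h))

  -- The external order is contained in the order of codes, so an increasing chain of bases is
  -- already sorted as a set of vertices; this is why `ω≡δ` holds with sign +1.
  enc-above : ∀ {j B} {τ : Vec (Subset n) j} → Valid (B ∷ τ) → ∀ v → enc τ ∋ v → eB B Fin.< v
  enc-above {τ = τ} (mkValid vert pair) v h with a , refl ← enc-∋ τ v h =
    eB-mono (LT-≺ (proj₁ (proj₁ (vert zero))) (pair zero (suc a) (s≤s z≤n)))

  enc-∌ : ∀ {j B} {τ : Vec (Subset n) j} → Valid (B ∷ τ) → enc τ ∌ eB B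
  enc-∌ {B = B} val = ¬∋⇒∌ λ h → Fin.<-irrefl refl (enc-above val (eB B) h)

  ω≡δ : ∀ {j} {τ : Vec (Subset n) j} → Valid τ → ω τ ≗ δ (enc τ)
  ω≡δ {τ = []}    val s = refl
  ω≡δ {τ = B ∷ τ} val s = trans (cone-cong (eB B) (ω≡δ (Valid-tail val)) s) (cone-δ (eB B) (enc τ) (enc-above val) s)

  ∣enc∣ : ∀ {j} {τ : Vec (Subset n) j} → Valid τ → ∣ enc τ ∣ ≡ j
  ∣enc∣ {τ = []}    val = Subset.∣⊥∣≡0 V
  ∣enc∣ {τ = B ∷ τ} val = trans (∣insert∣ (eB B) (enc τ) (enc-∌ val)) (cong suc (∣enc∣ (Valid-tail val)))

  ∋-enc : ∀ {j} (τ : Vec (Subset n) j) a → enc τ ∋ eB (lookup τ a)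
  ∋-enc (B ∷ τ) zero    = insert-∋ (eB B) (enc τ)
  ∋-enc (B ∷ τ) (suc a) = at (insert-⊒ (enc τ) (eB B)) (eB (lookup τ a)) (∋-enc τ a)

  enc-injective : ∀ {j} {σ τ : Vec (Subset n) j} → Valid σ → Valid τ → enc σ ≡ enc τ → σ ≡ τ
  enc-injective {σ = []}    {[]}    _ _ _ = refl
  enc-injective {σ = B ∷ σ} {C ∷ τ} vσ vτ eq = cong₂ _∷_ B≡C (enc-injective (Valid-tail vσ) (Valid-tail vτ) tails)
    where
    B≤ : eB B Fin.≤ eB C
    B≤ = case ∋-insert (enc σ) (eB B) (eB C) (subst (_∋ eB C) (sym eq) (insert-∋ (eB C) (enc τ))) of λ
      { (inj₁ p) → ℕ.≤-reflexive (cong Fin.toℕ (sym p)) ; (inj₂ q) → ℕ.<⇒≤ (enc-above vσ (eB C) q) }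
    C≤ : eB C Fin.≤ eB B
    C≤ = case ∋-insert (enc τ) (eB C) (eB B) (subst (_∋ eB B) eq (insert-∋ (eB B) (enc σ))) of λ
      { (inj₁ p) → ℕ.≤-reflexive (cong Fin.toℕ (sym p)) ; (inj₂ q) → ℕ.<⇒≤ (enc-above vτ (eB B) q) }
    B≡C : B ≡ C
    B≡C = eB-injective (Fin.≤-antisym B≤ C≤)
    tails : enc σ ≡ enc τ
    tails = trans (sym (remove-insert (eB B) (enc σ) (enc-∌ vσ)))
      (trans (cong (_[ eB B ]≔ false) eq) (trans (cong (λ D → enc τ [ eB C ]≔ true [ eB D ]≔ false) B≡C) (remove-insert (eB C) (enc τ) (enc-∌ vτ))))

  OrderCx : Cx V
  OrderCx = X Sub.⊥ Sub.⊥ (card n)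

  enc∈OrderCx : ∀ {j} {τ : Vec (Subset n) j} → Valid τ → OrderCx (enc τ)
  enc∈OrderCx {τ = τ} (mkValid vert pair) = record
    { ⊑T′    = sub λ e h → ⊥-elim (no-T e h)
    ; cospan = cospan-⊑ {Sub.⊥ Sub.∪ tp (enc τ)} {Sub.⊥} (sub λ e h → case ∪-∋ Sub.⊥ (tp (enc τ)) e h of λ { (inj₁ p) → p ; (inj₂ q) → ⊥-elim (no-T e q) }) cospan-⊥
    ; vertex = λ B h → let (a , eq) = enc-∋ τ (eB B) h ; (b , ne) = subst (λ A → Basis A × A ≢ T) (sym (eB-injective eq)) (vert a) in
        b , ne , (λ e h → case ∪-∋ Sub.⊥ (tp (enc τ)) e h of λ { (inj₁ p) → ∋∌-⊥ p (⊥-∌ e) ; (inj₂ q) → ⊥-elim (no-T e q) }) , Fin.toℕ<n (code B)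
    ; compar = λ A B h g → let (a , p) = enc-∋ τ (eB A) h ; (b , q) = enc-∋ τ (eB B) g in
        subst₂ (λ A B → A ≡ B ⊎ LT A B ⊎ LT B A) (sym (eB-injective p)) (sym (eB-injective q)) (comp a b)
    }
    where
    no-T : ∀ e → ¬ (tp (enc τ) ∋ e)
    no-T e h = let (a , eq) = enc-∋ τ (eT e) (trans (sym (tp-∋ (enc τ) e)) h) in eT≢eB {B = lookup τ a} eq
    comp : ∀ a b → lookup τ a ≡ lookup τ b ⊎ LT (lookup τ a) (lookup τ b) ⊎ LT (lookup τ b) (lookup τ a)
    comp a b with Fin.<-cmp a b
    ... | tri< lt _ _   = inj₂ (inj₁ (pair a b lt))
    ... | tri≈ _ refl _ = inj₁ refl
    ... | tri> _ _ gt   = inj₂ (inj₂ (pair b a gt))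

  validChain-∷ : ∀ {j} {a} {τ : Vec (Subset n) j} {c} → validChain M ((a , τ) ∷ c) ≡ true → Valid τ × validChain M c ≡ true
  validChain-∷ {τ = τ} h = let (p , q) = ∧-true {validSimplex M τ} h in valid⇒Valid {τ = τ} p , q

  Φ-supp : ∀ {j} (c : Chain n j) → validChain M c ≡ true → ∀ s → Φ c s ≢ 0ℤ → ∃ λ (τ : Vec (Subset n) j) → Valid τ × enc τ ≡ s
  Φ-supp []            h s ne = ⊥-elim (ne refl)
  Φ-supp ((a , τ) ∷ c) h s ne = case ≢0-+ (a * ω τ s) (Φ c s) ne of λ
    { (inj₁ p) → τ , val , δ-supp (enc τ) s (λ z → ≢0-* a (ω τ s) p (trans (ω≡δ val s) z))
    ; (inj₂ q) → Φ-supp c (proj₂ (validChain-∷ {a = a} {τ} {c} h)) s q }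
    where val = proj₁ (validChain-∷ {a = a} {τ} {c} h)

  Φ-Supp : ∀ {j} (c : Chain n j) → validChain M c ≡ true → Supp OrderCx j (Φ c)
  Φ-Supp c h s ne = let (τ , val , eq) = Φ-supp c h s ne in
    subst OrderCx eq (enc∈OrderCx val) , trans (cong ∣_∣ (sym eq)) (∣enc∣ val)

  Φ-coeff : ∀ {j} (c : Chain n j) → validChain M c ≡ true → ∀ {σ} → Valid σ → Φ c (enc σ) ≡ coeff c σ
  Φ-coeff []            h val = refl
  Φ-coeff ((a , τ) ∷ c) h {σ} val = cong₂ _+_ (value (vecEqᵇ τ σ) refl) (Φ-coeff c (proj₂ (validChain-∷ {a = a} {τ} {c} h)) val)
    where
    vτ = proj₁ (validChain-∷ {a = a} {τ} {c} h)
    value : ∀ b → vecEqᵇ τ σ ≡ b → a * ω τ (enc σ) ≡ (if b then a else + 0)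
    value true  e = trans (cong (a *_) (trans (ω≡δ vτ (enc σ)) (trans (cong (λ ρ → δ (enc ρ) (enc σ)) (vecEqᵇ⇒≡ {σ = τ} {σ} e)) (δ-refl (enc σ))))) (ℤ.*-identityʳ a)
    value false e = trans (cong (a *_) (trans (ω≡δ vτ (enc σ)) (δ-≢ (enc τ) (enc σ) λ eq →
      ∋∌-⊥ (trans (cong (vecEqᵇ τ) (sym (enc-injective vτ val eq))) (vecEqᵇ-refl τ)) e))) (ℤ.*-zeroʳ a)

  coeff-invalid : ∀ {j} (c : Chain n j) → validChain M c ≡ true → ∀ {σ} → validSimplex M σ ≡ false → coeff c σ ≡ 0ℤ
  coeff-invalid []            h inv = refl
  coeff-invalid ((a , τ) ∷ c) h {σ} inv = trans (cong₂ (λ b z → (if b then a else + 0) + z)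
      (¬∋⇒∌ {vecEqᵇ τ σ} λ e → ∋∌-⊥ (subst (λ ρ → validSimplex M ρ ≡ true) (vecEqᵇ⇒≡ {σ = τ} {σ} e) (proj₁ (∧-true {validSimplex M τ} h))) inv)
      (coeff-invalid c (proj₂ (validChain-∷ {a = a} {τ} {c} h)) {σ} inv)) refl

  -- Different lists may represent the same chain. On encodings of valid tuples both functions are
  -- given by `coeff`, and elsewhere both vanish.
  ≈⇒Φ : ∀ {j} (c d : Chain n j) → validChain M c ≡ true → validChain M d ≡ true → c ≈ᶜ d → Φ c ≗ Φ d
  ≈⇒Φ c d hc hd eq s with Φ c s ℤ.≟ 0ℤ | Φ d s ℤ.≟ 0ℤ
  ... | yes p | yes q = trans p (sym q)
  ... | no ne | _     = let (σ , val , e) = Φ-supp c hc s ne in subst (λ t → Φ c t ≡ Φ d t) e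
                          (trans (Φ-coeff c hc val) (trans (eq σ) (sym (Φ-coeff d hd val))))
  ... | yes _ | no ne = let (σ , val , e) = Φ-supp d hd s ne in subst (λ t → Φ c t ≡ Φ d t) e
                          (trans (Φ-coeff c hc val) (trans (eq σ) (sym (Φ-coeff d hd val))))

  Φ⇒≈ : ∀ {j} (c d : Chain n j) → validChain M c ≡ true → validChain M d ≡ true → Φ c ≗ Φ d → c ≈ᶜ d
  Φ⇒≈ c d hc hd eq σ = go (validSimplex M σ) refl
    where
    go : ∀ b → validSimplex M σ ≡ b → coeff c σ ≡ coeff d σ
    go true  h = let val = valid⇒Valid {τ = σ} h in trans (sym (Φ-coeff c hc val)) (trans (eq (enc σ)) (Φ-coeff d hd val))
    go false h = trans (coeff-invalid c hc {σ} h) (sym (coeff-invalid d hd {σ} h))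

  validChain-∂ : ∀ {j} (c : Chain n (suc j)) → validChain M c ≡ true → validChain M (∂ c) ≡ true
  validChain-∂ []            h = refl
  validChain-∂ {j} ((a , τ) ∷ c) h = all-++ (λ p → validSimplex M (proj₂ p)) (faces a τ (allFin (suc j))) (∂ c) (go (allFin (suc j)))
    (validChain-∂ c (proj₂ (validChain-∷ {a = a} {τ} {c} h)))
    where
    val = proj₁ (validChain-∷ {a = a} {τ} {c} h)
    go : ∀ ks → validChain M (faces a τ ks) ≡ true
    go []       = refl
    go (k ∷ ks) = true-∧ {validSimplex M (Vec.removeAt τ k)} (Valid⇒valid {τ = Vec.removeAt τ k} (Valid-removeAt val k)) (go ks)

  -- The least vertex of a face comes first in the chain: a basis below it in the external order
  -- would be a smaller vertex.
  decode : ∀ j s → OrderCx s → ∣ s ∣ ≡ j → ∃ λ (τ : Vec (Subset n) j) → Valid τ × enc τ ≡ s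
  decode zero    s x sz = [] , mkValid (λ ()) (λ ()) , sym (size-0 s sz)
  decode (suc j) s x sz = go (vertex-cases v)
    where
    lst = least s sz
    v = proj₁ lst
    sv : s ∋ v
    sv = proj₁ (proj₂ lst)
    go : (∃ λ e → eT e ≡ v) ⊎ (∃ λ B → eB B ≡ v) → ∃ λ (τ : Vec (Subset n) (suc j)) → Valid τ × enc τ ≡ s
    go (inj₁ (e , eq)) = ∋∌-⊥ (at (⊑T′ x) e (trans (tp-∋ s e) (subst (s ∋_) (sym eq) sv))) (⊥-∌ e)
    go (inj₂ (B , eq)) = B ∷ τ , mkValid vert pair , trans (cong₂ (λ t u → t [ u ]≔ true) enc-eq eq) (insert-remove v s sv)
      where
      s′ = s [ v ]≔ false
      s′⊑s : s′ ⊑ s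
      s′⊑s = remove-⊑ s v
      tp⊑ : tp s′ ⊑ tp s
      tp⊑ = sub λ e h → trans (tp-∋ s e) (at s′⊑s (eT e) (trans (sym (tp-∋ s′ e)) h))
      x′ : OrderCx s′
      x′ = record
        { ⊑T′    = ⊑-trans tp⊑ (⊑T′ x)
        ; cospan = cospan-⊑ (∪-mono Sub.⊥ tp⊑) (cospan x)
        ; vertex = λ A h → let (a , b , c , d) = vertex x A (at s′⊑s (eB A) h) in a , b , (λ e h → c e (at (∪-mono Sub.⊥ tp⊑) e h)) , d
        ; compar = λ A C h g → compar x A C (at s′⊑s (eB A) h) (at s′⊑s (eB C) g)
        }
      rec = decode j s′ x′ (∣remove∣-pred s sv sz)
      τ = proj₁ rec
      valτ = proj₁ (proj₂ rec)
      enc-eq : enc τ ≡ s′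
      enc-eq = proj₂ (proj₂ rec)
      sB : s ∋ eB B
      sB = subst (s ∋_) (sym eq) sv
      B-vert = vertex x B sB
      vert : ∀ a → Basis (lookup (B ∷ τ) a) × lookup (B ∷ τ) a ≢ T
      vert zero    = proj₁ B-vert , proj₁ (proj₂ B-vert)
      vert (suc a) = vertices valτ a
      first : ∀ a → LT B (lookup τ a)
      first a = case compar x B C sB (at s′⊑s (eB C) s′C) of λ
        { (inj₁ p) → ∋∌-⊥ (subst (λ D → s′ ∋ eB D) (sym p) s′C) (subst (s′ ∌_) (sym eq) (remove-∌ v s))
        ; (inj₂ (inj₁ lt)) → lt
        ; (inj₂ (inj₂ gt)) → ⊥-elim (ℕ.<⇒≱ (eB-mono (LT-≺ (proj₁ (proj₁ (vertices valτ a))) gt))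
            (subst (Fin._≤ eB C) (sym eq) (proj₂ (proj₂ lst) (eB C) (at s′⊑s (eB C) s′C)))) }
        where
        C = lookup τ a
        s′C : s′ ∋ eB C
        s′C = subst (_∋ eB C) enc-eq (∋-enc τ a)
      pair : ∀ a b → a Fin.< b → LT (lookup (B ∷ τ) a) (lookup (B ∷ τ) b)
      pair zero    (suc b) _        = first b
      pair (suc a) (suc b) (s≤s lt) = increasing valτ a b lt

  -- The list runs over all subsets of the simplex; those with coefficient 0 are left out, since
  -- they need not be faces and so could not be decoded.
  Ψ : ∀ {j} (F : Ch V) → Supp OrderCx j F → ∃ λ (c : Chain n j) → validChain M c ≡ true × Φ c ≗ F
  Ψ {j} F supp = let (c , val , eq) = build (subsets V) in c , val , λ t → trans (eq t)
      (trans (sum-subsets (λ s → F s * δ s t)) (trans (ΣS-single {f = λ s → F s * δ s t} t (λ s ne → trans (cong (F s *_) (δ-≢ s t ne)) (ℤ.*-zeroʳ (F s))))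
        (trans (cong (F t *_) (δ-refl t)) (ℤ.*-identityʳ (F t)))))
    where
    build : ∀ xs → ∃ λ (c : Chain n j) → validChain M c ≡ true × (∀ t → Φ c t ≡ sumℤ (map (λ s → F s * δ s t) xs))
    build []       = [] , refl , λ t → refl
    build (s ∷ xs) = let (c , val , eq) = build xs in add c val eq (F s ℤ.≟ 0ℤ)
      where
      add : ∀ c → validChain M c ≡ true → (∀ t → Φ c t ≡ sumℤ (map (λ s → F s * δ s t) xs)) → Dec (F s ≡ 0ℤ) →
        ∃ λ (c : Chain n j) → validChain M c ≡ true × (∀ t → Φ c t ≡ F s * δ s t + sumℤ (map (λ s → F s * δ s t) xs))
      add c val eq (yes z) = c , val , λ t → trans (eq t) (sym (trans (cong (λ y → y * δ s t + sumℤ (map (λ s → F s * δ s t) xs)) z) (ℤ.+-identityˡ _)))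
      add c val eq (no ne) = let (x , sz) = supp s ne ; (τ , valτ , e) = decode j s x sz in
        (F s , τ) ∷ c , true-∧ {validSimplex M τ} (Valid⇒valid {τ = τ} valτ) val ,
        λ t → cong₂ _+_ (cong (F s *_) (trans (ω≡δ valτ t) (cong (λ u → δ u t) e))) (eq t)

-- Homology through the common refinement

module Comparison {m : ℕ} {K I L : Cx m} (K⊆L : ∀ s → K s → L s) (I⊆L : ∀ s → I s → L s)
  (kl : RelAcyclic K L) (il : RelAcyclic I L) {d k : ℕ} (W : Wedge I d k) where
  open Wedge W

  private
    cancelˡ : ∀ x y → x + y + -1ℤ * y ≡ x
    cancelˡ = solve-∀

  Supp-neg : ∀ {P : Cx m} {j} {c : Ch m} → Supp P j c → Supp P j (λ s → - c s)
  Supp-neg {c = c} h s ne = h s (≢0-neg (c s) ne)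

  -- A filling in `L` whose boundary lies in `K` is a relative cycle, and moving it into `K` by a
  -- boundary does not change its own boundary.
  pull-filling : ∀ j F b → On K F → Supp L (suc j) b → bd b ≗ F → ∃ λ b′ → Supp K (suc j) b′ × bd b′ ≗ F
  pull-filling j F b hF hb eq =
    let (b₂ , hb₂ , on) = kl (suc j) b hb (On-≗ (λ s → sym (eq s)) hF) in
    (λ s → b s + bd b₂ s) , (λ s ne → on s ne , size-absorb hb hb₂ s ne) , λ s → trans (bd-absorb b b₂ s) (eq s)

  move-cycle : ∀ j F → IsCyc K j F → ∃ λ b → Supp L (suc j) b × IsCyc I j (λ s → F s + bd b s)
  move-cycle j F (hF , zF) =
    let (b , hb , on) = il j F (Supp-⊆ K⊆L hF) (0-On zF) in
    b , hb , (λ s ne → on s ne , size-absorb {b = b} hF hb s ne) , λ s → trans (bd-absorb F b s) (zF s)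

  -- The cycle is moved into `I` and filled there; the filling, corrected by the move, is then
  -- pulled back to `K`.
  fill-cycle : ∀ j → j ≢ d → ∀ F → IsCyc K j F → ∃ λ b → Supp K (suc j) b × bd b ≗ F
  fill-cycle j ne F cyc@(hF , _) =
    let (b₁ , hb₁ , cyc′)  = move-cycle j F cyc
        (b₂ , hb₂ , eq) = acyclic j ne (λ s → F s + bd b₁ s) cyc′ in
    pull-filling j F (b₂ +[ -1ℤ ] b₁) (λ s n → proj₁ (hF s n)) (Supp-lin {c = b₂} -1ℤ (Supp-⊆ I⊆L hb₂) hb₁)
      (λ s → trans (bd-lin b₂ -1ℤ b₁ s) (trans (cong (_+ -1ℤ * bd b₁ s) (eq s)) (cancelˡ (F s) (bd b₁ s))))

  -- F is homologous in L to the cycle of I with coordinates v.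
  record Coords (F : Ch m) (v : Vec ℤ k) : Set where
    constructor mkCoords
    field
      filling   : Ch m
      supported : Supp L (suc d) filling
      homologous : ∀ s → F s + bd filling s ≡ lin v basis s

  coords : ∀ F → IsCyc K d F → ∃ (Coords F)
  coords F cyc =
    let (b , hb , cyc′) = move-cycle d F cyc
        (v , eq) = span (λ s → F s + bd b s) cyc′ in
    v , mkCoords b hb λ s → sym (eq s)

  -- Moved into `I`, the filling has degree `suc d`, above the dimension, and so vanishes. Its
  -- boundary, the combination itself, is then 0, and independence of the basis applies.
  coords-boundary : ∀ w b → Supp L (suc d) b → bd b ≗ lin w basis → w ≡ replicate k 0ℤ
  coords-boundary w b hb eq = independent w λ s → trans (sym (eq s)) (trans (sym (bd-absorb b b₂ s)) (trans (bd-cong zero′ s) (bd-0 s)))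
    where
    filled = il (suc d) b hb (On-≗ (λ s → sym (eq s)) (λ s ne → proj₁ (proj₁ (lin-cyc w cycles) s ne)))
    b₂ = proj₁ filled
    zero′ : (λ s → b s + bd b₂ s) ≗ 0ᶜ
    zero′ = Supp-high dim (ℕ.n<1+n d) (λ s ne → proj₂ (proj₂ filled) s ne , size-absorb hb (proj₁ (proj₂ filled)) s ne)

  difference-0 : ∀ {l} (v w : Vec ℤ l) → Vec.zipWith _+_ v (Vec.map -_ w) ≡ replicate l 0ℤ → v ≡ w
  difference-0 []      []      eq = refl
  difference-0 (x ∷ v) (y ∷ w) eq = cong₂ _∷_ (ℤ.i-j≡0⇒i≡j x y (cong Vec.head eq)) (difference-0 v w (cong Vec.tail eq))

  -- Subtracting the two fillings exhibits the difference of the two combinations of basis cycles as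
  -- a boundary in `L`.
  coords-unique : ∀ {F F′ v v′} → F ≗ F′ → Coords F v → Coords F′ v′ → v ≡ v′
  coords-unique {F} {F′} {v} {v′} eq (mkCoords b hb e) (mkCoords b′ hb′ e′) = difference-0 v v′
    (coords-boundary _ (b +[ -1ℤ ] b′) (Supp-lin {c = b} -1ℤ hb hb′) λ s → trans (bd-lin b -1ℤ b′ s)
      (trans (lem (F s) (bd b s) (bd b′ s))
        (trans (cong₂ (λ x y → x + - y) (e s) (trans (cong (_+ bd b′ s) (eq s)) (e′ s)))
          (trans (cong (_+_ (lin v basis s)) (sym (lin-neg v′ basis s))) (sym (lin-add v (Vec.map -_ v′) basis s))))))
    where
    lem : ∀ f x y → x + -1ℤ * y ≡ f + x + - (f + y)
    lem = solve-∀

  coords-+ : ∀ {F F′ v v′} → Coords F v → Coords F′ v′ → Coords (λ s → F s + F′ s) (Vec.zipWith _+_ v v′)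
  coords-+ {F} {F′} {v} {v′} (mkCoords b hb e) (mkCoords b′ hb′ e′) = mkCoords (λ s → b s + b′ s) (Supp-+ {c = b} hb hb′)
    λ s → trans (cong (_+_ (F s + F′ s)) (bd-+ b b′ s)) (trans (lem (F s) (F′ s) (bd b s) (bd b′ s))
      (trans (cong₂ _+_ (e s) (e′ s)) (sym (lin-add v v′ basis s))))
    where
    lem : ∀ f g x y → f + g + (x + y) ≡ f + x + (g + y)
    lem = solve-∀

  coords-surjective : ∀ v → ∃ λ F → IsCyc K d F × Coords F v
  coords-surjective v =
    let (hz , zz) = lin-cyc v cycles
        (b , hb , on) = kl d (lin v basis) (Supp-⊆ I⊆L hz) (0-On zz) in
    (λ s → lin v basis s + bd b s) ,
    ((λ s ne → on s ne , size-absorb {b = b} hz hb s ne) , λ s → trans (bd-absorb (lin v basis) b s) (zz s)) ,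
    mkCoords (λ s → - b s) (Supp-neg {c = b} hb)
    λ s → trans (cong (_+_ (lin v basis s + bd b s)) (bd-neg b s)) (lem (lin v basis s) (bd b s))
    where
    lem : ∀ x y → x + y + - y ≡ x
    lem = solve-∀

  coords-kernel : ∀ F → IsCyc K d F → Coords F (replicate k 0ℤ) → ∃ λ b → Supp K (suc d) b × bd b ≗ F
  coords-kernel F (hF , _) (mkCoords b hb e) = pull-filling d F (λ s → - b s) (λ s ne → proj₁ (hF s ne)) (Supp-neg {c = b} hb)
    λ s → trans (bd-neg b s) (trans (lem (F s) (bd b s)) (trans (cong (_+_ (F s)) (cong -_ (trans (e s) (lin-0 basis s)))) (ℤ.+-identityʳ (F s))))
    where
    lem : ∀ x y → - y ≡ x + - (x + y)
    lem = solve-∀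

  boundary-coords : ∀ F b → Supp K (suc d) b → bd b ≗ F → Coords F (replicate k 0ℤ)
  boundary-coords F b hb eq = mkCoords (λ s → - b s) (Supp-neg {c = b} (Supp-⊆ K⊆L hb))
    λ s → trans (cong (_+_ (F s)) (trans (bd-neg b s) (cong -_ (eq s)))) (trans (ℤ.+-inverseʳ (F s)) (sym (lin-0 basis s)))

-- Reduced homology of the order complex

allSubsets? : {P : Subset n → Set} → (∀ s → Dec (P s)) → Dec (∀ s → P s)
allSubsets? {zero} P? with P? []
... | yes p = yes λ { [] → p }
... | no ¬p = no λ f → ¬p (f [])
allSubsets? {suc n} P? with allSubsets? (λ s → P? (true ∷ s)) | allSubsets? (λ s → P? (false ∷ s))
... | yes f | yes g = yes λ { (true ∷ s) → f s ; (false ∷ s) → g s }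
... | no ¬f | _     = no λ h → ¬f λ s → h (true ∷ s)
... | yes _ | no ¬g = no λ h → ¬g λ s → h (false ∷ s)

module Homology {n : ℕ} (M : IndepSystem n) (full : ground M ≡ ⊤) (mat : IsMatroid M) {d k : ℕ}
  (W : Wedge (Transfer.X M full mat Sub.⊥ (Transfer.T M full mat) 0) d k) where
  open Transfer M full mat

  private
    module R = Comparison {K = OrderCx} {X Sub.⊥ T 0} {X Sub.⊥ T (card n)} X-mono-T (X-mono-m z≤n)
      (order-rel ∣ T ∣ T refl ⊑-refl) (independence-rel (card n) ℕ.≤-refl) W

  Cycle : ∀ {j} → Chain n j → Set
  Cycle c = validChain M c ≡ true × bd (Φ c) ≗ 0ᶜ

  IsCycle⇒Cycle : ∀ j c → IsCycle M j c → Cycle c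
  IsCycle⇒Cycle zero    c h = h , bd-size-0 (Φ-Supp c h)
  IsCycle⇒Cycle (suc j) c (h , eq) = h , λ s → trans (Φ-∂ c s) (≈⇒Φ (∂ c) [] (validChain-∂ c h) refl eq s)

  Cycle⇒IsCycle : ∀ j c → Cycle c → IsCycle M j c
  Cycle⇒IsCycle zero    c (h , _) = h
  Cycle⇒IsCycle (suc j) c (h , eq) = h , Φ⇒≈ (∂ c) [] (validChain-∂ c h) refl (λ s → trans (sym (Φ-∂ c s)) (eq s))

  -- The map onto ℤ^k must be total on lists of simplices, so being a cycle is decided and all other
  -- chains get the default value 0 in `φ′`.
  cycle? : ∀ {j} (c : Chain n j) → Dec (Cycle c)
  cycle? c = (validChain M c Data.Bool.≟ true) ×-dec allSubsets? (λ s → bd (Φ c) s ℤ.≟ 0ℤ)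

  cyc : ∀ {j} (c : Chain n j) → Cycle c → IsCyc OrderCx j (Φ c)
  cyc c (h , eq) = Φ-Supp c h , eq

  fill⇒IsBoundary : ∀ {j} (c : Chain n j) → validChain M c ≡ true →
    (∃ λ b → Supp OrderCx (suc j) b × bd b ≗ Φ c) → IsBoundary M j c
  fill⇒IsBoundary c h (b , hb , eq) = let (e , he , eqe) = Ψ b hb in
    e , he , Φ⇒≈ (∂ e) c (validChain-∂ e he) h (λ s → trans (sym (Φ-∂ e s)) (trans (bd-cong eqe s) (eq s)))

  IsBoundary⇒fill : ∀ {j} (c : Chain n j) → validChain M c ≡ true → IsBoundary M j c →
    ∃ λ b → Supp OrderCx (suc j) b × bd b ≗ Φ c
  IsBoundary⇒fill c h (e , he , eq) =
    Φ e , Φ-Supp e he , λ s → trans (Φ-∂ e s) (≈⇒Φ (∂ e) c (validChain-∂ e he) h eq s)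

  homology-off : ∀ j → j ≢ d → HomologyIso M j 0
  homology-off j ne = (λ _ → []) , (λ _ _ _ _ _ → refl) , (λ _ _ _ _ → refl) ,
    (λ { [] → [] , Cycle⇒IsCycle j [] (refl , bd-0) , refl }) ,
    (λ c hc _ → let h = IsCycle⇒Cycle j c hc in fill⇒IsBoundary c (proj₁ h) (R.fill-cycle j ne (Φ c) (cyc c h))) ,
    λ _ _ _ → refl

  private
    φ′ : (c : Chain n d) → Dec (Cycle c) → Vec ℤ k
    φ′ c (yes h) = proj₁ (R.coords (Φ c) (cyc c h))
    φ′ c (no _)  = replicate k 0ℤ

    φ : Chain n d → Vec ℤ k
    φ c = φ′ c (cycle? c)

    φ-coords : ∀ c → Cycle c → R.Coords (Φ c) (φ c)
    φ-coords c h = go (cycle? c)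
      where
      go : ∀ q → R.Coords (Φ c) (φ′ c q)
      go (yes h′) = proj₂ (R.coords (Φ c) (cyc c h′))
      go (no ¬h)  = ⊥-elim (¬h h)

    Cycle-++ : ∀ (c e : Chain n d) → Cycle c → Cycle e → Cycle (c ++ e)
    Cycle-++ c e (hc , zc) (he , ze) = all-++ (λ p → validSimplex M (proj₂ p)) c e hc he ,
      λ s → trans (bd-cong (Φ-++ c e) s) (trans (bd-+ (Φ c) (Φ e) s) (cong₂ _+_ (zc s) (ze s)))

  homology-at : HomologyIso M d k
  homology-at = φ ,
    (λ c e hc he eq → let h = IsCycle⇒Cycle d c hc ; g = IsCycle⇒Cycle d e he in
      R.coords-unique {Φ c} {Φ e} (≈⇒Φ c e (proj₁ h) (proj₁ g) eq) (φ-coords c h) (φ-coords e g)) ,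
    (λ c e hc he → let h = IsCycle⇒Cycle d c hc ; g = IsCycle⇒Cycle d e he in
      R.coords-unique {Φ (c ++ e)} {λ s → Φ c s + Φ e s} (Φ-++ c e) (φ-coords (c ++ e) (Cycle-++ c e h g)) (R.coords-+ {Φ c} {Φ e} (φ-coords c h) (φ-coords e g))) ,
    (λ v → let (F , (hF , zF) , cF) = R.coords-surjective v ; (c , hc , eq) = Ψ F hF
               h = hc , λ s → trans (bd-cong eq s) (zF s) in
      c , Cycle⇒IsCycle d c h , R.coords-unique {Φ c} {F} eq (φ-coords c h) cF) ,
    (λ c hc φ≡0 → let h = IsCycle⇒Cycle d c hc in
      fill⇒IsBoundary c (proj₁ h) (R.coords-kernel (Φ c) (cyc c h) (subst (R.Coords (Φ c)) φ≡0 (φ-coords c h)))) ,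
    λ c hc hb → let h = IsCycle⇒Cycle d c hc ; (b , Sb , eq) = IsBoundary⇒fill c (proj₁ h) hb in
      R.coords-unique {Φ c} {Φ c} (λ _ → refl) (φ-coords c h) (R.boundary-coords (Φ c) b Sb eq)

private
  degree : ∀ m d → + m ≡ + d - + 1 → suc m ≡ d
  degree m (suc d) refl = refl

  degree⁻¹ : ∀ m d → suc m ≡ d → + m ≡ + d - + 1
  degree⁻¹ m (suc d) refl = refl

-- The grading by number of vertices is one ahead of the homological degree. Degree -1 is that of
-- the empty simplex and is reached when `d` is 0; degrees below -1 are never `+ d - + 1`.
reduced-homology : ∀ (M : IndepSystem n) (full : ground M ≡ ⊤) (mat : IsMatroid M) {d k} →
  Wedge (Transfer.X M full mat Sub.⊥ (Transfer.T M full mat) 0) d k → ∀ i →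
  (i ≡ + d - + 1 → ReducedHomologyIso M i k) × (i ≢ + d - + 1 → ReducedHomologyIso M i 0)
reduced-homology M full mat {d} {k} W (+ m) =
  (λ eq → subst (λ j → HomologyIso M j k) (sym (degree m d eq)) homology-at) ,
  (λ ne → homology-off (suc m) (λ eq → ne (degree⁻¹ m d eq)))
  where open Homology M full mat W
reduced-homology M full mat {d} {k} W -[1+ zero ] =
  (λ eq → subst (λ j → HomologyIso M j k) (d≡0 d eq) homology-at) ,
  (λ ne → homology-off zero (λ eq → ne (cong (λ e → + e - + 1) eq)))
  where
  open Homology M full mat W
  d≡0 : ∀ d → -[1+ zero ] ≡ + d - + 1 → d ≡ zero
  d≡0 zero _ = refl
reduced-homology M full mat {d} W -[1+ suc m ] = (λ eq → impossible d eq) , λ _ → refl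
  where
  impossible : ∀ {A : Set} d → -[1+ suc m ] ≡ + d - + 1 → A
  impossible zero    ()
  impossible (suc d) ()

theorem5p2 : (n : ℕ) (M : IndepSystem n) → ground M ≡ ⊤ → IsMatroid M →
    (i : ℤ) →
    (i ≡ + rank (restrict (dual M) (topBasis M)) (topBasis M) - + 1 →
    ReducedHomologyIso M i (muTilde (contractTo M (topBasis M))))
    × (i ≢ + rank (restrict (dual M) (topBasis M)) (topBasis M) - + 1 →
    ReducedHomologyIso M i 0)
theorem5p2 n M full mat = go
  where
  open Transfer M full mat
  open Invariants M full mat using (T-wedge)
  d = rank (restrict (dual M) (topBasis M)) (topBasis M)
  k = muTilde (contractTo M (topBasis M))
  W : Wedge (X Sub.⊥ T 0) d k
  W = subst (λ S → Wedge (X Sub.⊥ T 0) (rank (restrict (dual M) S) S) (muTilde (contractTo M S))) T≡topBasis T-wedge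
  go : ∀ i → (i ≡ + d - + 1 → ReducedHomologyIso M i k) × (i ≢ + d - + 1 → ReducedHomologyIso M i 0)
  go = reduced-homology M full mat W
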